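{- There is a polynomial-time algorithm with absolute approximation ratio $\frac32$ for Green Bin Packing (GBP), and there is a polynomial-time algorithm with absolute approximation ratio $\frac32$ for Constrained Green Bin Packing (CGBP), where $\beta$, $G$ (and $U$ for CGBP) are part of the input. That is, for every instance of GBP the algorithm outputs a packing $\sigma$ with $b(\sigma)+E(\sigma)\le\frac32\,OPT$, and for every instance of CGBP the algorithm outputs a packing $\sigma$ with $E(\sigma)\le U$ and $b(\sigma)\le\frac32\,OPT$, where $OPT$ is the optimal objective value of the respective problem on that instance.
   Context: Items and packings. There are $n$ items $\mathcal{I}=\{1,\dots,n\}$ with sizes $s_i\in(0,1]$, and parameters $\beta\ge 0$, $G\in[0,1]$. A packing $\sigma$ assigns every item to one of finitely many bins of capacity $1$ so that the load (total size of the items) of each bin is at most $1$. The energy consumed by a bin of load $x$ is $f_{\beta,G}(x)=\max\{0,\beta(x-G)\}$. Write $b(\sigma)$ for the number of bins used by $\sigma$ and $E(\sigma)$ for its total energy consumption, summed over all bins. GBP: given $\mathcal{I},\beta,G$, find a packing minimizing $b(\sigma)+E(\sigma)$. CGBP: given $\mathcal{I},\beta,G$ and $U\ge\sum_{i=1}^n f_{\beta,G}(s_i)$, find a packing minimizing $b(\sigma)$ subject to $E(\sigma)\le U$. -}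

module Defs where

open import Data.Bool.Base using (if_then_else_; _∧_)
open import Data.Fin.Base using (Fin; toℕ)
open import Data.Fin.Properties using (any?) renaming (_≟_ to _≟ᶠ_)
import Data.Integer.Base as ℤ
open import Data.Nat.Base using (ℕ; suc; _+_; _*_; _∸_; _^_; _≤_; _≡ᵇ_)
open import Data.Nat.Logarithm using (⌊log₂_⌋)
import Data.Nat.Properties as ℕₚ
open import Data.Product using (∃-syntax; _×_)
open import Data.Rational.Base as ℚ using (ℚ; 0ℚ; 1ℚ; ↥_; ↧ₙ_)
import Data.Rational.Properties as ℚₚ
open import Data.Vec.Base using (allFin; count)
open import Relation.Binary.PropositionalEquality using (_≡_; _≢_)
open import Relation.Nullary.Decidable using (does)

open import Algebra.Properties.CommutativeMonoid.Sum ℚₚ.+-0-commutativeMonoid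
  using () renaming (sum to ∑ℚ)
open import Algebra.Properties.CommutativeMonoid.Sum ℕₚ.+-0-commutativeMonoid
  using () renaming (sum to ∑ℕ)

------------------------------------------------------------------------
-- Model of computation: a structured random access machine on natural
-- numbers of unbounded size, with logarithmic cost.
--
-- The memory consists of arrays, named by numerals, with infinitely many
-- cells each. A program mentions only finitely many of them.

Store : Set
Store = ℕ → ℕ → ℕ

_[_,_↦_] : Store → ℕ → ℕ → ℕ → Store
(s [ a , i ↦ v ]) b j = if (a ≡ᵇ b) ∧ (i ≡ᵇ j) then v else s b j

infix  9 _at_
infixl 7 _⊗_
infixl 6 _⊕_ _⊖_

data Expr : Set where
  lit         : ℕ → Expr
  _at_        : (array : ℕ) (index : Expr) → Expr
  _⊕_ _⊖_ _⊗_ : Expr → Expr → Expr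

infix  5 _at_≔_
infixr 4 _⨾_

data Cmd : Set where
  skip    : Cmd
  _at_≔_  : (array : ℕ) (index value : Expr) → Cmd
  _⨾_     : Cmd → Cmd → Cmd
  ifnz    : (test : Expr) (then else : Cmd) → Cmd
  whilenz : (test : Expr) (body : Cmd) → Cmd

⟦_⟧ : Expr → Store → ℕ
⟦ lit k  ⟧ s = k
⟦ a at e ⟧ s = s a (⟦ e ⟧ s)
⟦ e ⊕ e′ ⟧ s = ⟦ e ⟧ s + ⟦ e′ ⟧ s
⟦ e ⊖ e′ ⟧ s = ⟦ e ⟧ s ∸ ⟦ e′ ⟧ s
⟦ e ⊗ e′ ⟧ s = ⟦ e ⟧ s * ⟦ e′ ⟧ s

-- Length of the binary expansion, with 0 written as one digit.
bits : ℕ → ℕ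
bits k = suc ⌊log₂ k ⌋

-- Every value that is computed, including every address and every value
-- read from memory, is charged its bit length. Without this, repeated
-- multiplication would make the machine stronger than a Turing machine.
exprCost : Expr → Store → ℕ
exprCost (lit k)  s = bits k
exprCost (a at e) s = exprCost e s + bits (⟦ a at e ⟧ s)
exprCost (e ⊕ e′) s = exprCost e s + exprCost e′ s + bits (⟦ e ⊕ e′ ⟧ s)
exprCost (e ⊖ e′) s = exprCost e s + exprCost e′ s + bits (⟦ e ⊖ e′ ⟧ s)
exprCost (e ⊗ e′) s = exprCost e s + exprCost e′ s + bits (⟦ e ⊗ e′ ⟧ s)

-- Runs c s t s′: started in s, the program c halts in s′ after time t.
data Runs : Cmd → Store → ℕ → Store → Set where
  run-skip : ∀ {s} → Runs skip s 1 s
  run-≔ : ∀ {s a i e} →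
    Runs (a at i ≔ e) s (1 + exprCost i s + exprCost e s)
         (s [ a , ⟦ i ⟧ s ↦ ⟦ e ⟧ s ])
  run-⨾ : ∀ {s s′ s″ c c′ t t′} →
    Runs c s t s′ → Runs c′ s′ t′ s″ → Runs (c ⨾ c′) s (t + t′) s″
  run-then : ∀ {s s′ e c c′ t} → ⟦ e ⟧ s ≢ 0 →
    Runs c s t s′ → Runs (ifnz e c c′) s (1 + exprCost e s + t) s′
  run-else : ∀ {s s′ e c c′ t} → ⟦ e ⟧ s ≡ 0 →
    Runs c′ s t s′ → Runs (ifnz e c c′) s (1 + exprCost e s + t) s′
  run-stop : ∀ {s e c} → ⟦ e ⟧ s ≡ 0 →
    Runs (whilenz e c) s (1 + exprCost e s) s
  run-loop : ∀ {s s′ s″ e c t t′} → ⟦ e ⟧ s ≢ 0 →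
    Runs c s t s′ → Runs (whilenz e c) s′ t′ s″ →
    Runs (whilenz e c) s (1 + exprCost e s + t + t′) s″

------------------------------------------------------------------------
-- Minimization problems and polynomial-time approximation

record MinProblem : Set₁ where
  field
    Instance : Set
    size     : Instance → ℕ            -- bit length of the input
    input    : Instance → Store
    Feasible : Instance → Set          -- the feasible solutions
    value    : ∀ I → Feasible I → ℚ
    Encodes  : ∀ I → Store → Feasible I → Set

module _ (P : MinProblem) where
  open MinProblem P

  IsOPT : Instance → ℚ → Set
  IsOPT I opt = (∃[ τ ] value I τ ≡ opt) × (∀ τ → opt ℚ.≤ value I τ)

  PolyTimeApprox : (ratio : ℚ) → Set
  PolyTimeApprox ratio =
    ∃[ alg ] ∃[ c ] ∃[ d ] ∀ I →
      ∃[ t ] ∃[ s ] ∃[ σ ]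
        Runs alg (input I) t s
        × t ≤ c * size I ^ d
        × Encodes I s σ
        × (∀ opt → IsOPT I opt → value I σ ℚ.≤ ratio ℚ.* opt)

------------------------------------------------------------------------
-- Items, packings, energy

ℕ→ℚ : ℕ → ℚ
ℕ→ℚ k = ℤ.+ k ℚ./ 1

record Items : Set where
  field
    n    : ℕ
    s    : Fin n → ℚ
    s>0  : ∀ i → 0ℚ ℚ.< s i
    s≤1  : ∀ i → s i ℚ.≤ 1ℚ
    β    : ℚ
    β≥0  : 0ℚ ℚ.≤ β
    G    : ℚ
    G≥0  : 0ℚ ℚ.≤ G
    G≤1  : G ℚ.≤ 1ℚ

  f : ℚ → ℚ
  f x = 0ℚ ℚ.⊔ (β ℚ.* (x ℚ.- G))

  load : ∀ {m} → (Fin n → Fin m) → Fin m → ℚ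
  load σ j = ∑ℚ (λ i → if does (σ i ≟ᶠ j) then s i else 0ℚ)

record Packing (I : Items) : Set where
  open Items I
  field
    m      : ℕ
    assign : Fin n → Fin m
    load≤1 : ∀ j → load assign j ℚ.≤ 1ℚ

  -- Only bins that receive an item count as used. An empty bin consumes no
  -- energy, since G ≥ 0.
  b : ℕ
  b = count (λ j → any? (λ i → assign i ≟ᶠ j)) (allFin m)

  E : ℚ
  E = ∑ℚ (λ j → f (load assign j))

record ConstrainedItems : Set where
  field
    items : Items
  open Items items public
  field
    U   : ℚ
    U≥∑ : ∑ℚ (λ i → f (s i)) ℚ.≤ U

record ConstrainedPacking (I : ConstrainedItems) : Set where
  open ConstrainedItems I
  field
    packing : Packing items
  open Packing packing public
  field
    E≤U : E ℚ.≤ U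

------------------------------------------------------------------------
-- Input and output formats

-- All rationals in the input are nonnegative, so the absolute value of the
-- numerator is the numerator.
num den : ℚ → ℕ
num q = ℤ.∣ ↥ q ∣
den q = ↧ₙ q

bitsℚ : ℚ → ℕ
bitsℚ q = bits (num q) + bits (den q)

-- Array 0 holds n, β, G, U (U is 0/1 in the unconstrained problem), arrays 1
-- and 2 hold the numerators and the denominators of the item sizes, and all
-- other cells are 0. On termination, array 3 holds the bin of each item.

memory : Items → ℚ → Store
memory I U = store
  where
  open Items I

  fromFin : ∀ {k} → (Fin k → ℕ) → ℕ → ℕ
  fromFin g j = ∑ℕ (λ i → if toℕ i ≡ᵇ j then g i else 0)

  store : Store
  store 0 0 = n
  store 0 1 = num β
  store 0 2 = den β
  store 0 3 = num G
  store 0 4 = den G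
  store 0 5 = num U
  store 0 6 = den U
  store 1 j = fromFin (λ i → num (s i)) j
  store 2 j = fromFin (λ i → den (s i)) j
  store _ _ = 0

itemsSize : Items → ℕ
itemsSize I = bits n + bitsℚ β + bitsℚ G + ∑ℕ (λ i → bitsℚ (s i))
  where open Items I

EncodesPacking : ∀ {I} → Store → Packing I → Set
EncodesPacking st σ = ∀ i → st 3 (toℕ i) ≡ toℕ (Packing.assign σ i)

GBP : MinProblem
GBP = record
  { Instance = Items
  ; size     = itemsSize
  ; input    = λ I → memory I 0ℚ
  ; Feasible = Packing
  ; value    = λ I σ → let open Packing σ in ℕ→ℚ b ℚ.+ E
  ; Encodes  = λ I → EncodesPacking
  }

CGBP : MinProblem
CGBP = record
  { Instance = ConstrainedItems
  ; size     = λ I → let open ConstrainedItems I in itemsSize items + bitsℚ U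
  ; input    = λ I → let open ConstrainedItems I in memory items U
  ; Feasible = ConstrainedPacking
  ; value    = λ I σ → ℕ→ℚ (ConstrainedPacking.b σ)
  ; Encodes  = λ I st σ → EncodesPacking st (ConstrainedPacking.packing σ)
  }

module Submission where

-- Longest processing time first (LPT) on k bins packs the items in order of
-- decreasing size, each into a least loaded bin. If 3m ≤ 2k + 1, then for every
-- threshold g its loads x satisfy Σ min(x, g) ≥ Σ min(y, g) for the loads y of
-- any assignment to m bins, so its total overflow Σ max(0, x - g) is no larger.
-- With g = 1 this shows that LPT is feasible on ⌊3m/2⌋ bins whenever m bins
-- suffice, and with g = G that it consumes no more energy. So it is enough to
-- run LPT for each k ≤ 2n, in integers over a common denominator, and to keep
-- the best result.
--
-- The inequality is shown by induction along the run. Let an item of size a be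
-- put on a bin of load l. The case l = 0 or l + a ≤ g is clear. Otherwise, if
-- 3l ≥ 2g, then every bin covers two thirds of g and one covers all of g. If
-- 3l < 2g, then every bin holds one or two items, and an item x gets the weight
-- (g - l) + max(0, min(x, g) - l). The inequality follows by comparing weights
-- if at least m bins hold one item, and by counting otherwise.

open import Defs
open import Data.Bool.Base using (Bool; true; false; if_then_else_; T; _∧_; not)
open import Data.Empty using (⊥; ⊥-elim)
open import Data.Fin.Base using (Fin; zero; suc; toℕ; fromℕ<)
open import Data.Fin.Properties using (any?; toℕ<n; toℕ-injective; toℕ-fromℕ<) renaming (_≟_ to _≟ᶠ_)
open import Data.Integer.Base as ℤ using (ℤ)
import Data.Integer.Properties as ℤₚ
open import Data.List.Base using (List; []; _∷_; map)
open import Data.List.Properties using (map-id)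
open import Data.List.Relation.Unary.All as All using (All; []; _∷_)
open import Data.Nat.Base hiding (_/_)
open import Data.Nat.Coprimality using (1-coprimeTo) renaming (sym to coprime-sym)
open import Data.Nat.ListAction using () renaming (sum to sumᴸ)
open import Data.Nat.Logarithm
open import Data.Nat.Properties
open import Data.Nat.Tactic.RingSolver using (solve-∀)
open import Data.Product using (_×_; _,_; proj₁; proj₂; Σ-syntax; ∃-syntax)
open import Data.Rational.Base as ℚ using (ℚ; 0ℚ; 1ℚ; mkℚ; ↧ₙ_; toℚᵘ)
import Data.Rational.Properties as ℚₚ
open import Data.Rational.Unnormalised.Base as ℚᵘ using (mkℚᵘ; *≡*)
import Data.Rational.Unnormalised.Properties as ℚᵘₚ
open import Data.Sum using (_⊎_; inj₁; inj₂; [_,_]′)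
open import Data.Unit using (tt)
open import Data.Vec.Base using (tabulate; allFin; count)
open import Data.Vec.Properties using (count≤n)
open import Function.Base using (_∘_; const; id)
open import Relation.Binary.PropositionalEquality
open import Relation.Nullary
open import Relation.Nullary.Decidable using (does; dec-true)
open import Relation.Unary using (Decidable)
open import Algebra.Properties.CommutativeMonoid.Sum ℚₚ.+-0-commutativeMonoid
  using () renaming (sum to ∑ℚ)
open import Algebra.Properties.CommutativeMonoid.Sum +-0-commutativeMonoid
  using (∑-distrib-+; ∑-comm; sum-cong-≗) renaming (sum to ∑ℕ)

-- Sums over initial segments of ℕ

-- The induction hypothesis serves only the easy case. In the other cases the new item lifts the
-- least loaded bin above g, and the inequality is proved from scratch from the shape of the LPT
-- bins: without its last item, a bin is no fuller than any other. One run has to serve two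
-- thresholds, so `Schedules` quantifies over g. The other assignment is revealed in the order of
-- LPT, so that both sides hold the same items at any time. The conditions 3m ≤ 2k + 1 and 2k ≤ 3m
-- leave only k = ⌊3m/2⌋. The summand 1 is paid by the bin that receives the new item, as this bin
-- covers all of g. Here m counts used bins only. The number m of an optimal packing is unknown, and
-- fewer bins may cost more energy, so every k is tried; m ≤ n gives k ≤ 2n. Polynomial time is
-- obtained by recursion on the program: every loop runs a fixed multiple of n times, and an
-- assigned product has at most one factor outside the input, so that numbers grow by a polynomial
-- number of bits.

Σ< : ℕ → (ℕ → ℕ) → ℕ
Σ< n f = ∑ℕ {n} (λ i → f (toℕ i))

Σ-mono : ∀ n {f g} → (∀ i → i < n → f i ≤ g i) → Σ< n f ≤ Σ< n g
Σ-mono zero    h = z≤n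
Σ-mono (suc n) h = +-mono-≤ (h 0 z<s) (Σ-mono n λ i i<n → h (suc i) (s≤s i<n))

Σ-cong : ∀ n {f g} → (∀ i → i < n → f i ≡ g i) → Σ< n f ≡ Σ< n g
Σ-cong n h = ≤-antisym (Σ-mono n λ i p → ≤-reflexive (h i p))
                       (Σ-mono n λ i p → ≤-reflexive (sym (h i p)))

Σ-+ : ∀ n f g → Σ< n (λ i → f i + g i) ≡ Σ< n f + Σ< n g
Σ-+ n f g = ∑-distrib-+ {n} (f ∘ toℕ) (g ∘ toℕ)

Σ-const : ∀ n c → Σ< n (const c) ≡ n * c
Σ-const zero    c = refl
Σ-const (suc n) c = cong (c +_) (Σ-const n c)

Σ-*ˡ : ∀ n c f → Σ< n (λ i → c * f i) ≡ c * Σ< n f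
Σ-*ˡ zero    c f = sym (*-zeroʳ c)
Σ-*ˡ (suc n) c f = trans (cong (c * f 0 +_) (Σ-*ˡ n c (f ∘ suc)))
                         (sym (*-distribˡ-+ c (f 0) _))

Σ-zero : ∀ n {f} → (∀ i → i < n → f i ≡ 0) → Σ< n f ≡ 0
Σ-zero n h = trans (Σ-cong n h) (trans (Σ-const n 0) (*-zeroʳ n))

term≤Σ : ∀ n {f i} → i < n → f i ≤ Σ< n f
term≤Σ (suc n)     {i = zero}  _         = m≤m+n _ _
term≤Σ (suc n) {f} {i = suc i} (s≤s i<n) = ≤-trans (term≤Σ n {f ∘ suc} i<n) (m≤n+m _ (f 0))

Σ-extend : ∀ {k n f} → k ≤ n → (∀ i → k ≤ i → i < n → f i ≡ 0) → Σ< n f ≡ Σ< k f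
Σ-extend {n = n} z≤n       h = Σ-zero n λ i → h i z≤n
Σ-extend {f = f} (s≤s k≤n) h =
  cong (f 0 +_) (Σ-extend k≤n λ i k≤i i<n → h (suc i) (s≤s k≤i) (s≤s i<n))

-- Packing an item changes a single bin; z is the gain there, added on the left instead of
-- subtracted on the right.
Σ-mono-at : ∀ n {f g i z} → i < n → (∀ j → j < n → j ≢ i → f j ≤ g j) →
            f i + z ≤ g i → Σ< n f + z ≤ Σ< n g
Σ-mono-at (suc n) {f} {g} {zero} {z} _ h fi = begin
  f 0 + Σ< n (f ∘ suc) + z    ≡⟨ lem (f 0) _ z ⟩
  (f 0 + z) + Σ< n (f ∘ suc)  ≤⟨ +-mono-≤ fi (Σ-mono n λ j p → h (suc j) (s≤s p) λ ()) ⟩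
  g 0 + Σ< n (g ∘ suc)        ∎
  where
  open ≤-Reasoning
  lem : ∀ a b c → a + b + c ≡ (a + c) + b
  lem = solve-∀
Σ-mono-at (suc n) {f} {g} {suc i} {z} (s≤s i<n) h fi = begin
  f 0 + Σ< n (f ∘ suc) + z    ≡⟨ +-assoc (f 0) _ z ⟩
  f 0 + (Σ< n (f ∘ suc) + z)  ≤⟨ +-mono-≤ (h 0 z<s λ ())
                                   (Σ-mono-at n i<n (λ j p q → h (suc j) (s≤s p) (q ∘ suc-injective)) fi) ⟩
  g 0 + Σ< n (g ∘ suc)        ∎
  where open ≤-Reasoning

Σ-at : ∀ n {f g i z} → i < n → (∀ j → j < n → j ≢ i → f j ≡ g j) →
       f i + z ≡ g i → Σ< n f + z ≡ Σ< n g
Σ-at (suc n) {f} {g} {zero} {z} _ h fi =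
  trans (lem (f 0) _ z) (cong₂ _+_ fi (Σ-cong n λ j p → h (suc j) (s≤s p) λ ()))
  where
  lem : ∀ a b c → a + b + c ≡ (a + c) + b
  lem = solve-∀
Σ-at (suc n) {f} {g} {suc i} {z} (s≤s i<n) h fi =
  trans (+-assoc (f 0) _ z) (cong₂ _+_ (h 0 z<s λ ())
    (Σ-at n i<n (λ j p q → h (suc j) (s≤s p) (q ∘ suc-injective)) fi))

Σ-≤-at : ∀ n {f g i z} → i < n → (∀ j → j < n → j ≢ i → f j ≤ g j) →
         f i ≤ g i + z → Σ< n f ≤ Σ< n g + z
Σ-≤-at (suc n) {f} {g} {zero} {z} _ h fi = begin
  f 0 + Σ< n (f ∘ suc)        ≤⟨ +-mono-≤ fi (Σ-mono n λ j p → h (suc j) (s≤s p) λ ()) ⟩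
  (g 0 + z) + Σ< n (g ∘ suc)  ≡⟨ lem (g 0) z _ ⟩
  g 0 + Σ< n (g ∘ suc) + z    ∎
  where
  open ≤-Reasoning
  lem : ∀ a b c → (a + b) + c ≡ a + c + b
  lem = solve-∀
Σ-≤-at (suc n) {f} {g} {suc i} {z} (s≤s i<n) h fi = begin
  f 0 + Σ< n (f ∘ suc)        ≤⟨ +-mono-≤ (h 0 z<s λ ())
                                   (Σ-≤-at n i<n (λ j p q → h (suc j) (s≤s p) (q ∘ suc-injective)) fi) ⟩
  g 0 + (Σ< n (g ∘ suc) + z)  ≡⟨ +-assoc (g 0) _ z ⟨
  g 0 + Σ< n (g ∘ suc) + z    ∎
  where open ≤-Reasoning

≡ᵇ-refl : ∀ i → (i ≡ᵇ i) ≡ true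
≡ᵇ-refl zero    = refl
≡ᵇ-refl (suc i) = ≡ᵇ-refl i

≢⇒≡ᵇ : ∀ i j → i ≢ j → (i ≡ᵇ j) ≡ false
≢⇒≡ᵇ zero    zero    p = ⊥-elim (p refl)
≢⇒≡ᵇ zero    (suc j) p = refl
≢⇒≡ᵇ (suc i) zero    p = refl
≢⇒≡ᵇ (suc i) (suc j) p = ≢⇒≡ᵇ i j (p ∘ cong suc)

Σ-last : ∀ n f → Σ< (suc n) f ≡ Σ< n f + f n
Σ-last zero    f = +-comm (f 0) 0
Σ-last (suc n) f = trans (cong (f 0 +_) (Σ-last n (f ∘ suc))) (sym (+-assoc (f 0) _ _))

-- Longest processing time first

cov : ℕ → List ℕ → ℕ
cov g xs = sumᴸ xs ⊓ g

insert : ℕ → ℕ → (ℕ → List ℕ) → ℕ → List ℕ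
insert i a L b = if i ≡ᵇ b then a ∷ L b else L b

insert-at : ∀ i a L → insert i a L i ≡ a ∷ L i
insert-at i a L rewrite ≡ᵇ-refl i = refl

insert-off : ∀ i a L b → b ≢ i → insert i a L b ≡ L b
insert-off i a L b b≢i rewrite ≢⇒≡ᵇ i b (b≢i ∘ sym) = refl

-- L lists the sizes in each of the k bins of LPT, latest item first, and T those
-- in each of the M bins of the other assignment, whose bins in use are marked by e.
record Schedules (k M : ℕ) (e : ℕ → ℕ) (L T : ℕ → List ℕ) : Set where
  field
    tail≤  : ∀ {b x xs} → b < k → L b ≡ x ∷ xs → ∀ b′ → b′ < k → sumᴸ xs ≤ sumᴸ (L b′)
    sorted : ∀ {b x y zs} → b < k → L b ≡ x ∷ y ∷ zs → x ≤ y
    used   : ∀ {b x xs} → b < M → T b ≡ x ∷ xs → 1 ≤ e b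
    same   : ∀ h → Σ< k (λ b → sumᴸ (map h (L b))) ≡ Σ< M (λ b → sumᴸ (map h (T b)))
    covers : ∀ g → Σ< M (cov g ∘ T) ≤ Σ< k (cov g ∘ L)

-- The induction step: one more item on both sides.

module Step {k M : ℕ} {e : ℕ → ℕ} {L T : ℕ → List ℕ} (S : Schedules k M e L T)
            {a i j : ℕ} (i<k : i < k) (j<M : j < M)
            (a≤L : ∀ b → b < k → All (a ≤_) (L b))
            (Li≤L : ∀ b → b < k → sumᴸ (L i) ≤ sumᴸ (L b))
            (1≤ej : 1 ≤ e j) (3m≤2k+1 : 3 * Σ< M e ≤ 2 * k + 1) where
  open Schedules S

  private
    L′ T′ : ℕ → List ℕ
    L′ = insert i a L
    T′ = insert j a T
    m l : ℕ
    m = Σ< M e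
    l = sumᴸ (L i)

  Σ-insert : ∀ n {i} (F : List ℕ → ℕ) L z → i < n → F (a ∷ L i) ≡ F (L i) + z →
             Σ< n (F ∘ insert i a L) ≡ Σ< n (F ∘ L) + z
  Σ-insert n {i} F L z i<n Fa = sym (Σ-at n i<n (λ b _ b≢i → cong F (sym (insert-off i a L b b≢i)))
    (sym (trans (cong F (insert-at i a L)) Fa)))

  -- Equality for every `h` expresses that both sides hold the same multiset of items. A fixed `h`
  -- would not do, since the weights `ω` depend on g and on the current least load.
  same′ : ∀ h → Σ< k (λ b → sumᴸ (map h (L′ b))) ≡ Σ< M (λ b → sumᴸ (map h (T′ b)))
  same′ h = trans (Σ-insert k F L (h a) i<k (+-comm (h a) _))
    (trans (cong (_+ h a) (same h)) (sym (Σ-insert M F T (h a) j<M (+-comm (h a) _))))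
    where
    F : List ℕ → ℕ
    F xs = sumᴸ (map h xs)

  used′ : ∀ {b x xs} → b < M → T′ b ≡ x ∷ xs → 1 ≤ e b
  used′ {b} b<M eq with b ≟ j
  ... | yes refl = 1≤ej
  ... | no b≢j   = used b<M (trans (sym (insert-off j a T b b≢j)) eq)

  sum-mono : ∀ b → sumᴸ (L b) ≤ sumᴸ (L′ b)
  sum-mono b with i ≡ᵇ b
  ... | true  = m≤n+m _ a
  ... | false = ≤-refl

  -- The tail of the bin that receives the item is its old content, of least load by `Li≤L`; for the
  -- other bins, loads have only grown.
  tail≤′ : ∀ {b x xs} → b < k → L′ b ≡ x ∷ xs → ∀ b′ → b′ < k → sumᴸ xs ≤ sumᴸ (L′ b′)
  tail≤′ {b} b<k eq b′ b′<k with b ≟ i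
  ... | no b≢i = ≤-trans (tail≤ b<k (trans (sym (insert-off i a L b b≢i)) eq) b′ b′<k) (sum-mono b′)
  ... | yes refl with trans (sym (insert-at i a L)) eq
  ...   | refl = ≤-trans (Li≤L b′ b′<k) (sum-mono b′)

  sorted′ : ∀ {b x y zs} → b < k → L′ b ≡ x ∷ y ∷ zs → x ≤ y
  sorted′ {b} b<k eq with b ≟ i
  ... | no b≢i = sorted b<k (trans (sym (insert-off i a L b b≢i)) eq)
  ... | yes refl with L i in Li | trans (sym (insert-at i a L)) eq
  ...   | y ∷ zs | refl with subst (All (a ≤_)) Li (a≤L i i<k)
  ...     | a≤y ∷ _ = a≤y

  module _ (g : ℕ) where

    covT≤ : ∀ b → b < M → cov g (T′ b) ≤ g * e b
    covT≤ b b<M with T′ b in eq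
    ... | []     = z≤n
    ... | x ∷ xs = begin
      cov g (x ∷ xs) ≤⟨ m⊓n≤n (sumᴸ (x ∷ xs)) g ⟩
      g              ≡⟨ *-identityʳ g ⟨
      g * 1          ≤⟨ *-monoʳ-≤ g (used′ b<M eq) ⟩
      g * e b        ∎
      where open ≤-Reasoning

    covT≤gm : Σ< M (cov g ∘ T′) ≤ g * m
    covT≤gm = ≤-trans (Σ-mono M covT≤) (≤-reflexive (Σ-*ˡ M g e))

    covL′i : g < l + a → cov g (L′ i) ≡ g
    covL′i g<l+a rewrite insert-at i a L = m≥n⇒m⊓n≡n (≤-trans (<⇒≤ g<l+a) (≤-reflexive (+-comm l a)))

    -- The new item is covered in full, or as much as it would be alone in a bin.
    easy : l ≡ 0 ⊎ l + a ≤ g → Σ< M (cov g ∘ T′) ≤ Σ< k (cov g ∘ L′)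
    easy h = begin
      Σ< M (cov g ∘ T′)        ≤⟨ upperT ⟩
      Σ< M (cov g ∘ T) + a ⊓ g ≤⟨ +-monoˡ-≤ (a ⊓ g) (covers g) ⟩
      Σ< k (cov g ∘ L) + a ⊓ g ≤⟨ lowerL ⟩
      Σ< k (cov g ∘ L′)        ∎
      where
      open ≤-Reasoning
      subadd : ∀ x y → (x + y) ⊓ g ≤ x ⊓ g + y ⊓ g
      subadd x y with ≤-total x g | ≤-total y g
      ... | inj₁ x≤g | inj₁ y≤g rewrite m≤n⇒m⊓n≡m x≤g | m≤n⇒m⊓n≡m y≤g = m⊓n≤m (x + y) g
      ... | inj₂ g≤x | _ rewrite m≥n⇒m⊓n≡n g≤x = ≤-trans (m⊓n≤n (x + y) g) (m≤m+n g _)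
      ... | _ | inj₂ g≤y rewrite m≥n⇒m⊓n≡n g≤y = ≤-trans (m⊓n≤n (x + y) g) (m≤n+m g _)
      upperT : Σ< M (cov g ∘ T′) ≤ Σ< M (cov g ∘ T) + a ⊓ g
      upperT = Σ-≤-at M j<M (λ b _ b≢j → ≤-reflexive (cong (cov g) (insert-off j a T b b≢j)))
        (≤-trans (≤-reflexive (cong (cov g) (insert-at j a T)))
          (≤-trans (subadd a (sumᴸ (T j))) (≤-reflexive (+-comm (a ⊓ g) _))))
      gain : l ≡ 0 ⊎ l + a ≤ g → cov g (L i) + a ⊓ g ≤ cov g (a ∷ L i)
      gain (inj₁ l≡0) rewrite l≡0 | +-identityʳ a = ≤-refl
      gain (inj₂ l+a≤g) = begin
        cov g (L i) + a ⊓ g ≤⟨ +-mono-≤ (m⊓n≤m l g) (m⊓n≤m a g) ⟩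
        l + a               ≡⟨ +-comm l a ⟩
        a + l               ≡⟨ m≤n⇒m⊓n≡m (≤-trans (≤-reflexive (+-comm a l)) l+a≤g) ⟨
        cov g (a ∷ L i)     ∎
      lowerL : Σ< k (cov g ∘ L) + a ⊓ g ≤ Σ< k (cov g ∘ L′)
      lowerL = Σ-mono-at k i<k (λ b _ b≢i → ≤-reflexive (cong (cov g) (sym (insert-off i a L b b≢i))))
        (≤-trans (gain h) (≤-reflexive (cong (cov g) (sym (insert-at i a L)))))

    -- Every load is at least l, so three times the coverage of any bin is at least 2g, and bin i
    -- contributes 3g. The total g(2k + 1) is exactly what 3m ≤ 2k + 1 asks for.
    full : 2 * g ≤ 3 * l → g < l + a → Σ< M (cov g ∘ T′) ≤ Σ< k (cov g ∘ L′)
    full 2g≤3l g<l+a = ≤-trans covT≤gm (*-cancelˡ-≤ 3 (begin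
      3 * (g * m)                ≡⟨ lem₁ g m ⟩
      g * (3 * m)                ≤⟨ *-monoʳ-≤ g 3m≤2k+1 ⟩
      g * (2 * k + 1)            ≡⟨ lem₂ g k ⟩
      k * (2 * g) + g            ≡⟨ cong (_+ g) (Σ-const k (2 * g)) ⟨
      Σ< k (const (2 * g)) + g   ≤⟨ Σ-mono-at k i<k off atᵢ ⟩
      Σ< k (λ b → 3 * cov g (L′ b)) ≡⟨ Σ-*ˡ k 3 (cov g ∘ L′) ⟩
      3 * Σ< k (cov g ∘ L′)      ∎))
      where
      open ≤-Reasoning
      lem₁ : ∀ g m → 3 * (g * m) ≡ g * (3 * m)
      lem₁ = solve-∀
      lem₂ : ∀ g k → g * (2 * k + 1) ≡ k * (2 * g) + g
      lem₂ = solve-∀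
      lem₃ : ∀ g → 2 * g + g ≡ 3 * g
      lem₃ = solve-∀
      off : ∀ b → b < k → b ≢ i → 2 * g ≤ 3 * cov g (L′ b)
      off b b<k b≢i rewrite insert-off i a L b b≢i | *-distribˡ-⊓ 3 (sumᴸ (L b)) g =
        ⊓-glb (≤-trans 2g≤3l (*-monoʳ-≤ 3 (Li≤L b b<k))) (*-monoˡ-≤ g {2} {3} (s≤s (s≤s z≤n)))
      atᵢ : 2 * g + g ≤ 3 * cov g (L′ i)
      atᵢ rewrite covL′i g<l+a = ≤-reflexive (lem₃ g)

    -- Here d = g - l and r = 2l - g, so that no subtraction occurs.
    module Weights (d r : ℕ) (l≡d+r : l ≡ d + r) (g≡2d+r : g ≡ d + d + r) (r<d : r < d) (d<a : d < a) where

      ω : ℕ → ℕ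
      ω x = d + ((x ⊓ g) ∸ l)

      Ω : List ℕ → ℕ
      Ω xs = sumᴸ (map ω xs)

      single : List ℕ → ℕ
      single (x ∷ []) = 1
      single _        = 0

      multiple : List ℕ → ℕ
      multiple xs = 1 ∸ single xs

      single+multiple : ∀ xs → single xs + multiple xs ≡ 1
      single+multiple []           = refl
      single+multiple (_ ∷ [])     = refl
      single+multiple (_ ∷ _ ∷ _)  = refl

      data Shape : List ℕ → Set where
        one : ∀ {x} → l ≤ x → Shape (x ∷ [])
        two : ∀ {x y} → d < x → d < y → x ≤ l → y ≤ l → Shape (x ∷ y ∷ [])

      l<2d : l < d + d
      l<2d rewrite l≡d+r = +-monoʳ-< d r<d

      d≤l : d ≤ l
      d≤l rewrite l≡d+r = m≤m+n d r

      l≤g : l ≤ g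
      l≤g rewrite l≡d+r | g≡2d+r = +-monoˡ-≤ r (m≤m+n d d)

      2d≤g : d + d ≤ g
      2d≤g rewrite g≡2d+r = m≤m+n (d + d) r

      -- All items exceed d, whereas a tail has load at most l < 2d; so a tail holds at most one
      -- item. That item is at most l, and the later item in front of it is no larger.
      shape : ∀ xs → All (d <_) xs → l ≤ sumᴸ xs →
              (∀ {y ys} → xs ≡ y ∷ ys → sumᴸ ys ≤ l) →
              (∀ {y z zs} → xs ≡ y ∷ z ∷ zs → y ≤ z) → Shape xs
      shape []       _ l≤ _ _ = ⊥-elim (<⇒≱ (≤-<-trans z≤n r<d) (≤-trans d≤l l≤))
      shape (x ∷ []) _ l≤ _ _ = one (≤-trans l≤ (≤-reflexive (+-identityʳ x)))
      shape (x ∷ y ∷ []) (d<x ∷ d<y ∷ []) _ tl st =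
        two d<x d<y (≤-trans (st refl) y≤l) y≤l
        where
        y≤l : y ≤ l
        y≤l = ≤-trans (≤-reflexive (sym (+-identityʳ y))) (tl refl)
      shape (x ∷ y ∷ z ∷ zs) (_ ∷ d<y ∷ d<z ∷ _) _ tl _ = ⊥-elim (<⇒≱ (<-≤-trans l<2d
        (+-mono-≤ (<⇒≤ d<y) (≤-trans (<⇒≤ d<z) (m≤m+n z _)))) (tl refl))

      L′-shape : ∀ b → b < k → Shape (L′ b)
      L′-shape b b<k = shape (L′ b) (large b b<k)
        (≤-trans (Li≤L b b<k) (sum-mono b)) (tl b b<k) (sorted′ b<k)
        where
        large : ∀ b → b < k → All (d <_) (L′ b)
        large b b<k with i ≡ᵇ b
        ... | true  = d<a ∷ All.map (<-≤-trans d<a) (a≤L b b<k)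
        ... | false = All.map (<-≤-trans d<a) (a≤L b b<k)
        tl : ∀ b → b < k → ∀ {y ys} → L′ b ≡ y ∷ ys → sumᴸ ys ≤ l
        tl b b<k eq with b ≟ i
        ... | no b≢i = tail≤ b<k (trans (sym (insert-off i a L b b≢i)) eq) i i<k
        ... | yes refl with trans (sym (insert-at i a L)) eq
        ...   | refl = ≤-refl

      ω-small : ∀ {x} → x ≤ l → ω x ≡ d
      ω-small {x} x≤l = trans (cong (d +_) (m≤n⇒m∸n≡0 (≤-trans (m⊓n≤m x g) x≤l))) (+-identityʳ d)

      r+ω : ∀ x → r + ω x ≡ l + ((x ⊓ g) ∸ l)
      r+ω x = trans (sym (+-assoc r d _)) (cong (_+ ((x ⊓ g) ∸ l)) (trans (+-comm r d) (sym l≡d+r)))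

      two-cov : ∀ {x y} → d < x → d < y → d + d ≤ cov g (x ∷ y ∷ [])
      two-cov {x} {y} d<x d<y = ⊓-glb (+-mono-≤ (<⇒≤ d<x) (≤-trans (<⇒≤ d<y) (m≤m+n y 0))) 2d≤g

      -- A lone item x ≥ l covers min(x, g) = l + (min(x, g) - l) = r + ω x, because l = d + r. In a
      -- bin of two, both items are at most l and weigh d each, while both exceed d and g ≥ 2d.
      weight≤cov : ∀ {xs} → Shape xs → r * single xs + Ω xs ≤ cov g xs
      weight≤cov (one {x} l≤x) = ≤-reflexive (begin
        r * 1 + (ω x + 0)     ≡⟨ cong₂ _+_ (*-identityʳ r) (+-identityʳ (ω x)) ⟩
        r + ω x               ≡⟨ r+ω x ⟩
        l + ((x ⊓ g) ∸ l)     ≡⟨ m+[n∸m]≡n (⊓-glb l≤x l≤g) ⟩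
        x ⊓ g                 ≡⟨ cong (_⊓ g) (+-identityʳ x) ⟨
        (x + 0) ⊓ g           ∎)
        where open ≡-Reasoning
      weight≤cov (two {x} {y} d<x d<y x≤l y≤l)
        rewrite *-zeroʳ r | ω-small x≤l | ω-small y≤l | +-identityʳ d = two-cov d<x d<y

      -- Holds for arbitrary bins: two items already weigh 2d, and g = 2d + r, so a surcharge of r
      -- per used bin is enough. The number `c` stands for the mark `e b`.
      cov≤weight : ∀ xs c → (∀ {y ys} → xs ≡ y ∷ ys → 1 ≤ c) → cov g xs ≤ r * c + Ω xs
      cov≤weight []           c h = z≤n
      cov≤weight (x ∷ xs)     c h = ≤-trans (bound xs) (+-monoˡ-≤ (Ω (x ∷ xs))
        (≤-trans (≤-reflexive (sym (*-identityʳ r))) (*-monoʳ-≤ r (h refl))))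
        where
        open ≤-Reasoning
        bound : ∀ xs → cov g (x ∷ xs) ≤ r + Ω (x ∷ xs)
        bound []       = begin
          (x + 0) ⊓ g       ≡⟨ cong (_⊓ g) (+-identityʳ x) ⟩
          x ⊓ g             ≤⟨ m≤n+m∸n (x ⊓ g) l ⟩
          l + ((x ⊓ g) ∸ l) ≡⟨ r+ω x ⟨
          r + ω x           ≡⟨ cong (r +_) (+-identityʳ (ω x)) ⟨
          r + (ω x + 0)     ∎
        bound (y ∷ ys) = begin
          cov g (x ∷ y ∷ ys) ≤⟨ m⊓n≤n (sumᴸ (x ∷ y ∷ ys)) g ⟩
          g                  ≡⟨ trans g≡2d+r (+-comm (d + d) r) ⟩
          r + (d + d)        ≤⟨ +-monoʳ-≤ r (+-mono-≤ (m≤m+n d _) (≤-trans (m≤m+n d _) (m≤m+n (ω y) _))) ⟩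
          r + Ω (x ∷ y ∷ ys) ∎

      p q : ℕ
      p = Σ< k (single ∘ L′)
      q = Σ< k (multiple ∘ L′)

      p+q≡k : p + q ≡ k
      p+q≡k = trans (sym (Σ-+ k (single ∘ L′) (multiple ∘ L′)))
        (trans (Σ-cong k λ b _ → single+multiple (L′ b)) (trans (Σ-const k 1) (*-identityʳ k)))

      -- By `same′` the total weights agree, so only the surcharges r count: `T′` is charged m of
      -- them, and the bins of `L′` with one item yield p.
      many-singles : m ≤ p → Σ< M (cov g ∘ T′) ≤ Σ< k (cov g ∘ L′)
      many-singles m≤p = begin
        Σ< M (cov g ∘ T′)                      ≤⟨ Σ-mono M (λ b b<M → cov≤weight (T′ b) (e b) (used′ b<M)) ⟩
        Σ< M (λ b → r * e b + Ω (T′ b))        ≡⟨ Σ-+ M (λ b → r * e b) (Ω ∘ T′) ⟩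
        Σ< M (λ b → r * e b) + Σ< M (Ω ∘ T′)   ≡⟨ cong₂ _+_ (Σ-*ˡ M r e) (sym (same′ ω)) ⟩
        r * m + Σ< k (Ω ∘ L′)                  ≤⟨ +-monoˡ-≤ _ (*-monoʳ-≤ r m≤p) ⟩
        r * p + Σ< k (Ω ∘ L′)                  ≡⟨ cong (_+ Σ< k (Ω ∘ L′)) (Σ-*ˡ k r (single ∘ L′)) ⟨
        Σ< k (λ b → r * single (L′ b)) + Σ< k (Ω ∘ L′) ≡⟨ Σ-+ k (λ b → r * single (L′ b)) (Ω ∘ L′) ⟨
        Σ< k (λ b → r * single (L′ b) + Ω (L′ b)) ≤⟨ Σ-mono k (λ b b<k → weight≤cov (L′-shape b b<k)) ⟩
        Σ< k (cov g ∘ L′)                      ∎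
        where open ≤-Reasoning

      -- The crude bound g m for the rival suffices here, because p < m and 3m ≤ 2k + 1 force many
      -- bins with two items. A bin covers at least l or 2d according to its shape; bin i covers all
      -- of g, which is at least r more.
      few-singles : g < l + a → p < m → Σ< M (cov g ∘ T′) ≤ Σ< k (cov g ∘ L′)
      few-singles g<l+a p<m = begin
        Σ< M (cov g ∘ T′)             ≤⟨ covT≤gm ⟩
        g * m                         ≤⟨ arith ⟩
        (l * p + (d + d) * q) + r     ≡⟨ cong (_+ r) (cong₂ _+_ (Σ-*ˡ k l (single ∘ L′)) (Σ-*ˡ k (d + d) (multiple ∘ L′))) ⟨
        (Σ< k (λ b → l * single (L′ b)) + Σ< k (λ b → (d + d) * multiple (L′ b))) + r
                                      ≡⟨ cong (_+ r) (Σ-+ k (λ b → l * single (L′ b)) (λ b → (d + d) * multiple (L′ b))) ⟨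
        Σ< k H + r                    ≤⟨ Σ-mono-at k i<k (λ b b<k _ → H≤cov (L′-shape b b<k))
                                          (≤-trans (H+r≤g (L′-shape i i<k)) (≤-reflexive (sym (covL′i g<l+a)))) ⟩
        Σ< k (cov g ∘ L′)             ∎
        where
        open ≤-Reasoning
        Hᴸ : List ℕ → ℕ
        Hᴸ xs = l * single xs + (d + d) * multiple xs
        H : ℕ → ℕ
        H = Hᴸ ∘ L′
        H-one : l * 1 + (d + d) * 0 ≡ l
        H-one rewrite *-zeroʳ (d + d) | *-identityʳ l = +-identityʳ l
        H-two : l * 0 + (d + d) * 1 ≡ d + d
        H-two rewrite *-zeroʳ l | *-identityʳ (d + d) = refl
        H≤cov : ∀ {xs} → Shape xs → Hᴸ xs ≤ cov g xs
        H≤cov (one {x} l≤x) = ≤-trans (≤-reflexive H-one)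
          (⊓-glb (≤-trans l≤x (m≤m+n x 0)) l≤g)
        H≤cov (two d<x d<y _ _) = ≤-trans (≤-reflexive H-two) (two-cov d<x d<y)
        H+r≤g : ∀ {xs} → Shape xs → Hᴸ xs + r ≤ g
        H+r≤g (one _) = ≤-trans (≤-reflexive (cong (_+ r) H-one))
          (≤-trans (+-monoˡ-≤ r (<⇒≤ l<2d)) (≤-reflexive (sym g≡2d+r)))
        H+r≤g (two _ _ _ _) = ≤-reflexive (trans (cong (_+ r) H-two) (sym g≡2d+r))
        -- With m = p + 1 + u, the inequality 3m ≤ 2(p + q) + 1 becomes p + 2 + 3u ≤ 2q; the term r
        -- u is raised to d u by r < d.
        arith : g * m ≤ (l * p + (d + d) * q) + r
        arith = subst₂ _≤_ (cong₂ _*_ (sym g≡2d+r) 1+p+u≡m)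
          (cong (λ l → (l * p + (d + d) * q) + r) (sym l≡d+r)) (begin
            (d + d + r) * (suc p + u)                  ≡⟨ e₁ d r p u ⟩
            (d + r) * p + d * (p + 2) + r + (2 * d * u + r * u) ≤⟨ +-monoʳ-≤ ((d + r) * p + d * (p + 2) + r) (+-monoʳ-≤ (2 * d * u) (*-monoˡ-≤ u (<⇒≤ r<d))) ⟩
            (d + r) * p + d * (p + 2) + r + (2 * d * u + d * u) ≡⟨ e₂ d r p u ⟩
            (d + r) * p + d * (p + 2 + 3 * u) + r      ≤⟨ +-monoˡ-≤ r (+-monoʳ-≤ _ (*-monoʳ-≤ d 2q)) ⟩
            (d + r) * p + d * (2 * q) + r              ≡⟨ e₃ d r p q ⟩
            ((d + r) * p + (d + d) * q) + r            ∎)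
          where
          u : ℕ
          u = m ∸ suc p
          1+p+u≡m : suc p + u ≡ m
          1+p+u≡m = m+[n∸m]≡n p<m
          e₁ : ∀ d r p u → (d + d + r) * (suc p + u) ≡ (d + r) * p + d * (p + 2) + r + (2 * d * u + r * u)
          e₁ = solve-∀
          e₂ : ∀ d r p u → (d + r) * p + d * (p + 2) + r + (2 * d * u + d * u) ≡ (d + r) * p + d * (p + 2 + 3 * u) + r
          e₂ = solve-∀
          e₃ : ∀ d r p q → (d + r) * p + d * (2 * q) + r ≡ ((d + r) * p + (d + d) * q) + r
          e₃ = solve-∀
          e₄ : ∀ p u → 3 * (suc p + u) ≡ (p + 2 + 3 * u) + (2 * p + 1)
          e₄ = solve-∀
          e₅ : ∀ p q → 2 * (p + q) + 1 ≡ 2 * q + (2 * p + 1)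
          e₅ = solve-∀
          2q : p + 2 + 3 * u ≤ 2 * q
          2q = +-cancelʳ-≤ (2 * p + 1) _ _ (begin
            (p + 2 + 3 * u) + (2 * p + 1) ≡⟨ e₄ p u ⟨
            3 * (suc p + u)               ≡⟨ cong (3 *_) 1+p+u≡m ⟩
            3 * m                         ≤⟨ 3m≤2k+1 ⟩
            2 * k + 1                     ≡⟨ cong (λ k → 2 * k + 1) p+q≡k ⟨
            2 * (p + q) + 1               ≡⟨ e₅ p q ⟩
            2 * q + (2 * p + 1)           ∎)

    cover-step : Σ< M (cov g ∘ T′) ≤ Σ< k (cov g ∘ L′)
    cover-step with l + a ≤? g | l ≟ 0 | 2 * g ≤? 3 * l
    ... | yes l+a≤g | _       | _        = easy (inj₂ l+a≤g)
    ... | no  _     | yes l≡0 | _        = easy (inj₁ l≡0)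
    ... | no  l+a≰g | no  _   | yes 2g≤3l = full 2g≤3l (≰⇒> l+a≰g)
    ... | no  l+a≰g | no  l≢0 | no 2g≰3l = cases (m ≤? W.p)
      where
      g<l+a : g < l + a
      g<l+a = ≰⇒> l+a≰g
      head≤ : ∀ xs → All (a ≤_) xs → sumᴸ xs ≢ 0 → a ≤ sumᴸ xs
      head≤ []       _         ≢0 = ⊥-elim (≢0 refl)
      head≤ (x ∷ xs) (a≤x ∷ _) _  = ≤-trans a≤x (m≤m+n x _)
      -- As l ≠ 0, bin i already holds an item, and all earlier items are at least a. This yields d
      -- < a ≤ l, so that l - d is a genuine difference.
      a≤l : a ≤ l
      a≤l = head≤ (L i) (a≤L i i<k) l≢0
      open ≤-Reasoning
      l≤g : l ≤ g
      l≤g = *-cancelˡ-≤ 2 (≤-trans (*-monoˡ-≤ l {2} {3} (s≤s (s≤s z≤n))) (<⇒≤ (≰⇒> 2g≰3l)))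
      d r : ℕ
      d = g ∸ l
      r = l ∸ d
      l+d≡g : l + d ≡ g
      l+d≡g = m+[n∸m]≡n l≤g
      d<a : d < a
      d<a = +-cancelˡ-< l d a (≤-<-trans (≤-reflexive l+d≡g) g<l+a)
      l≡d+r : l ≡ d + r
      l≡d+r = sym (m+[n∸m]≡n (≤-trans (<⇒≤ d<a) a≤l))
      e₀ : ∀ d r → d + r + d ≡ d + d + r
      e₀ = solve-∀
      e₁ : ∀ d r → 3 * d + 2 * r + r ≡ 3 * (d + r)
      e₁ = solve-∀
      e₂ : ∀ d r → 2 * (d + d + r) ≡ 3 * d + 2 * r + d
      e₂ = solve-∀
      g≡2d+r : g ≡ d + d + r
      g≡2d+r = trans (sym l+d≡g) (trans (cong (_+ d) l≡d+r) (e₀ d r))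
      -- In terms of d and r, the assumption 3l < 2g reads 3(d + r) < 2(2d + r).
      r<d : r < d
      r<d = +-cancelˡ-< (3 * d + 2 * r) r d (begin-strict
        3 * d + 2 * r + r  ≡⟨ e₁ d r ⟩
        3 * (d + r)        ≡⟨ cong (3 *_) l≡d+r ⟨
        3 * l              <⟨ ≰⇒> 2g≰3l ⟩
        2 * g              ≡⟨ cong (2 *_) g≡2d+r ⟩
        2 * (d + d + r)    ≡⟨ e₂ d r ⟩
        3 * d + 2 * r + d  ∎)
      module W = Weights d r l≡d+r g≡2d+r r<d d<a
      cases : Dec (m ≤ W.p) → Σ< M (cov g ∘ T′) ≤ Σ< k (cov g ∘ L′)
      cases (yes m≤p) = W.many-singles m≤p
      cases (no m≰p)  = W.few-singles g<l+a (≰⇒> m≰p)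

  step : Schedules k M e L′ T′
  step = record { tail≤ = tail≤′ ; sorted = sorted′ ; used = used′ ; same = same′ ; covers = cover-step }

overflow : ∀ {k M e L T} → Schedules k M e L T → ∀ g →
           Σ< k (λ b → sumᴸ (L b) ∸ g) ≤ Σ< M (λ b → sumᴸ (T b) ∸ g)
overflow {k} {M} {e} {L} {T} S g = +-cancelˡ-≤ (Σ< M (cov g ∘ T)) _ _ (begin
  Σ< M (cov g ∘ T) + Σ< k (λ b → sumᴸ (L b) ∸ g) ≤⟨ +-monoˡ-≤ _ (covers g) ⟩
  Σ< k (cov g ∘ L) + Σ< k (λ b → sumᴸ (L b) ∸ g) ≡⟨ split k L ⟩
  Σ< k (sumᴸ ∘ L)                                ≡⟨ total ⟩
  Σ< M (sumᴸ ∘ T)                                ≡⟨ split M T ⟨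
  Σ< M (cov g ∘ T) + Σ< M (λ b → sumᴸ (T b) ∸ g) ∎)
  where
  open Schedules S
  open ≤-Reasoning
  split : ∀ n B → Σ< n (cov g ∘ B) + Σ< n (λ b → sumᴸ (B b) ∸ g) ≡ Σ< n (sumᴸ ∘ B)
  split n B = trans (sym (Σ-+ n (cov g ∘ B) (λ b → sumᴸ (B b) ∸ g))) (Σ-cong n λ b _ →
    trans (cong (_+ (sumᴸ (B b) ∸ g)) (⊓-comm (sumᴸ (B b)) g)) (m⊓n+n∸m≡n g (sumᴸ (B b))))
  id-sum : ∀ n B → Σ< n (λ b → sumᴸ (map (λ x → x) (B b))) ≡ Σ< n (sumᴸ ∘ B)
  id-sum n B = Σ-cong n λ b _ → cong sumᴸ (map-id (B b))
  total : Σ< k (sumᴸ ∘ L) ≡ Σ< M (sumᴸ ∘ T)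
  total = trans (sym (id-sum k L)) (trans (same (λ x → x)) (id-sum M T))

-- Structured programs and their running time

k<2^bits : ∀ k → k < 2 ^ bits k
k<2^bits k = ≰⇒> λ p → <⇒≱ (n<1+n ⌊log₂ k ⌋)
  (≤-trans (≤-reflexive (sym (⌊log₂[2^n]⌋≡n (bits k)))) (⌊log₂⌋-mono-≤ p))

bits≤ : ∀ {k B} → 1 ≤ B → k < 2 ^ B → bits k ≤ B
bits≤ {k} {suc zero}    _ k<2 = s≤s (⌊log₂⌋-mono-≤ (≤-pred k<2))
bits≤ {k} {suc (suc B)} _ k<4 = s≤s (begin
  ⌊log₂ k ⌋              ≤⟨ m≤n+m∸n ⌊log₂ k ⌋ 1 ⟩
  suc (⌊log₂ k ⌋ ∸ 1)    ≡⟨ cong suc (⌊log₂⌊n/2⌋⌋≡⌊log₂n⌋∸1 k) ⟨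
  bits ⌊ k /2⌋           ≤⟨ bits≤ (s≤s z≤n) half ⟩
  suc B                  ∎)
  where
  open ≤-Reasoning
  half : ⌊ k /2⌋ < 2 ^ suc B
  half = ≰⇒> λ p → <⇒≱ k<4 (begin
    2 ^ suc B + (2 ^ suc B + 0)  ≡⟨ cong (2 ^ suc B +_) (+-identityʳ _) ⟩
    2 ^ suc B + 2 ^ suc B        ≤⟨ +-mono-≤ p (≤-trans p (⌊n/2⌋≤⌈n/2⌉ k)) ⟩
    ⌊ k /2⌋ + ⌈ k /2⌉            ≡⟨ ⌊n/2⌋+⌈n/2⌉≡n k ⟩
    k                            ∎)

n<2^n : ∀ n → n < 2 ^ n
n<2^n zero    = s≤s z≤n
n<2^n (suc n) = begin-strict
  suc n          <⟨ s≤s (n<2^n n) ⟩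
  1 + 2 ^ n      ≤⟨ +-monoˡ-≤ (2 ^ n) (m^n>0 2 n) ⟩
  2 ^ n + 2 ^ n  ≡⟨ cong (2 ^ n +_) (+-identityʳ _) ⟨
  2 ^ suc n      ∎
  where open ≤-Reasoning

2^-mono : ∀ {m n} → m ≤ n → 2 ^ m ≤ 2 ^ n
2^-mono = ^-monoʳ-≤ 2

2^+2^≤ : ∀ {A B} → 1 ≤ A → 1 ≤ B → 2 ^ A + 2 ^ B ≤ 2 ^ (A + B)
2^+2^≤ {A} {B} 1≤A 1≤B = ≤-trans (sum≤product (2^-mono 1≤A) (2^-mono 1≤B))
  (≤-reflexive (sym (^-distribˡ-+-* 2 A B)))
  where
  sum≤product : ∀ {p q} → 2 ≤ p → 2 ≤ q → p + q ≤ p * q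
  sum≤product {suc (suc p)} {suc (suc q)} _ _ = ≤-trans (m≤m+n _ (p + q + p * q)) (≤-reflexive (lem p q))
    where
    lem : ∀ p q → (2 + p) + (2 + q) + (p + q + p * q) ≡ (2 + p) * (2 + q)
    lem = solve-∀
  sum≤product {suc zero} (s≤s ()) _
  sum≤product {suc (suc _)} {suc zero} _ (s≤s ())

+-<2^ : ∀ {x y} A B → 1 ≤ A → 1 ≤ B → x < 2 ^ A → y < 2 ^ B → x + y < 2 ^ (A + B)
+-<2^ A B 1≤A 1≤B x< y< = <-≤-trans (+-mono-< x< y<) (2^+2^≤ 1≤A 1≤B)

*-<2^ : ∀ {x y} A B → x < 2 ^ A → y < 2 ^ B → x * y < 2 ^ (A + B)
*-<2^ A B x< y< = <-≤-trans (*-mono-< x< y<) (≤-reflexive (sym (^-distribˡ-+-* 2 A B)))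

infix  5 _at_≔_
infixr 4 _⨾_

-- The loop `for y m p` runs p for m * n times, where n is the first cell of the
-- input, while the first cell of array y counts down to 0.
data Prog : Set where
  skip   : Prog
  _at_≔_ : (array : ℕ) (index value : Expr) → Prog
  _⨾_    : Prog → Prog → Prog
  ifnz   : (test : Expr) (then else : Prog) → Prog
  for    : (counter factor : ℕ) (body : Prog) → Prog

down : ℕ → Cmd
down y = y at lit 0 ≔ y at lit 0 ⊖ lit 1

times : ℕ → Expr
times m = lit m ⊗ 0 at lit 0

compile : Prog → Cmd
compile skip         = skip
compile (a at i ≔ e) = a at i ≔ e
compile (p ⨾ q)      = compile p ⨾ compile q
compile (ifnz e p q) = ifnz e (compile p) (compile q)
compile (for y m p)  = y at lit 0 ≔ times m ⨾ whilenz (y at lit 0) (down y ⨾ compile p)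

branch : ℕ → Store → Store → Store
branch zero    s s′ = s′
branch (suc _) s s′ = s

loop : ℕ → (Store → Store) → ℕ → Store → Store
loop y f zero    s = s
loop y f (suc r) s = loop y f r (f (s [ y , 0 ↦ r ]))

exec : Prog → Store → Store
exec skip         s = s
exec (a at i ≔ e) s = s [ a , ⟦ i ⟧ s ↦ ⟦ e ⟧ s ]
exec (p ⨾ q)      s = exec q (exec p s)
exec (ifnz e p q) s = branch (⟦ e ⟧ s) (exec p s) (exec q s)
exec (for y m p)  s = loop y (exec p) (m * s 0 0) (s [ y , 0 ↦ m * s 0 0 ])

-- Arrays 0, 1, 2 hold the input. A value may be multiplied by expressions in
-- the input only, so that an assignment adds O(Z) bits.
reads : (ℕ → Bool) → Expr → Bool
reads Q (lit k)  = true
reads Q (a at e) = Q a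
reads Q (e ⊕ e′) = reads Q e ∧ reads Q e′
reads Q (e ⊖ e′) = reads Q e
reads Q (e ⊗ e′) = reads Q e ∧ reads Q e′

fixed : Expr → Bool
fixed = reads (_<ᵇ 3)

linear : Expr → Bool
linear (lit k)  = true
linear (a at e) = true
linear (e ⊕ e′) = linear e ∧ linear e′
linear (e ⊖ e′) = linear e
linear (e ⊗ e′) = linear e ∧ fixed e′

preserves : ℕ → Prog → Bool
preserves y skip         = true
preserves y (a at i ≔ e) = not (a ≡ᵇ y)
preserves y (p ⨾ q)      = preserves y p ∧ preserves y q
preserves y (ifnz e p q) = preserves y p ∧ preserves y q
preserves y (for x m p)  = not (x ≡ᵇ y) ∧ preserves y p

admissible : Prog → Bool
admissible skip         = true
admissible (a at i ≔ e) = (2 <ᵇ a) ∧ linear e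
admissible (p ⨾ q)      = admissible p ∧ admissible q
admissible (ifnz e p q) = admissible p ∧ admissible q
admissible (for y m p)  = (2 <ᵇ y) ∧ preserves y p ∧ admissible p

-- If the cells have at most L ≥ 1 bits, then the value of e has at most `∣ e ∣ * L` bits. Sums are
-- treated like products, by 2^A + 2^B ≤ 2^(A + B) for A, B ≥ 1; the measure `suc k` of a literal is
-- crude and rests on k < 2^k.
∣_∣ : Expr → ℕ
∣ lit k ∣  = suc k
∣ a at e ∣ = suc ∣ e ∣
∣ e ⊕ e′ ∣ = ∣ e ∣ + ∣ e′ ∣
∣ e ⊖ e′ ∣ = ∣ e ∣ + ∣ e′ ∣
∣ e ⊗ e′ ∣ = ∣ e ∣ + ∣ e′ ∣

1≤∣_∣ : ∀ e → 1 ≤ ∣ e ∣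
1≤∣ lit k ∣  = s≤s z≤n
1≤∣ a at e ∣ = s≤s z≤n
1≤∣ e ⊕ e′ ∣ = ≤-trans 1≤∣ e ∣ (m≤m+n _ _)
1≤∣ e ⊖ e′ ∣ = ≤-trans 1≤∣ e ∣ (m≤m+n _ _)
1≤∣ e ⊗ e′ ∣ = ≤-trans 1≤∣ e ∣ (m≤m+n _ _)

-- The bounds below take Z, a bound on the length of the input, and M, a bound
-- on the length of the contents of every cell at any time.
costBound : Expr → ℕ → ℕ
costBound (lit k)  M = bits k
costBound (a at e) M = costBound e M + M
costBound (e ⊕ e′) M = costBound e M + costBound e′ M + ∣ e ⊕ e′ ∣ * M
costBound (e ⊖ e′) M = costBound e M + costBound e′ M + ∣ e ⊖ e′ ∣ * M
costBound (e ⊗ e′) M = costBound e M + costBound e′ M + ∣ e ⊗ e′ ∣ * M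

growth : Prog → ℕ → ℕ
growth skip         Z = 0
growth (a at i ≔ e) Z = ∣ e ∣ * Z
growth (p ⨾ q)      Z = growth p Z + growth q Z
growth (ifnz e p q) Z = growth p Z + growth q Z
growth (for y m p)  Z = ∣ times m ∣ * Z + m * Z * growth p Z

testBound : ℕ → ℕ → ℕ
testBound y M = 1 + costBound (y at lit 0) M

assignBound : Expr → Expr → ℕ → ℕ
assignBound i e M = 1 + costBound i M + costBound e M

timeBound : Prog → ℕ → ℕ → ℕ
iterBound : ℕ → Prog → ℕ → ℕ → ℕ
timeBound skip         Z M = 1
timeBound (a at i ≔ e) Z M = assignBound i e M
timeBound (p ⨾ q)      Z M = timeBound p Z M + timeBound q Z M
timeBound (ifnz e p q) Z M = 1 + costBound e M + (timeBound p Z M + timeBound q Z M)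
timeBound (for y m p)  Z M = assignBound (lit 0) (times m) M +
  (m * Z * iterBound y p Z M + testBound y M)
iterBound y p Z M =
  testBound y M + (assignBound (lit 0) (y at lit 0 ⊖ lit 1) M + timeBound p Z M)

-- Loops run a multiple of n times, so n itself and not merely its length has to be bounded. It is,
-- since every item contributes at least one bit to the input.
record Input (Z : ℕ) (s : Store) : Set where
  field
    small : ∀ a i → a < 3 → s a i < 2 ^ Z
    n≤Z   : s 0 0 ≤ Z

Small : ℕ → Store → Set
Small L s = ∀ a i → s a i < 2 ^ L

T-join : ∀ x {y} → T x → T y → T (x ∧ y)
T-join true _ t = t

T-split : ∀ x {y} → T (x ∧ y) → T x × T y
T-split true t = tt , t

val<-reads : ∀ {Q L s} → 1 ≤ L → (∀ a i → T (Q a) → s a i < 2 ^ L) →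
             ∀ e → T (reads Q e) → ⟦ e ⟧ s < 2 ^ (∣ e ∣ * L)
val<-reads {Q} {L} {s} 1≤L h = go
  where
  pos : ∀ e → 1 ≤ ∣ e ∣ * L
  pos e = *-mono-≤ 1≤∣ e ∣ 1≤L
  go : ∀ e → T (reads Q e) → ⟦ e ⟧ s < 2 ^ (∣ e ∣ * L)
  go (lit k)  _ = <-≤-trans (<-trans (n<2^n k) (^-monoʳ-< 2 (s≤s (s≤s z≤n)) (n<1+n k)))
    (2^-mono (≤-trans (≤-reflexive (sym (*-identityʳ (suc k)))) (*-monoʳ-≤ (suc k) 1≤L)))
  go (a at e) t = <-≤-trans (h a _ t) (2^-mono (m≤m+n L _))
  go (e ⊕ e′) t with T-split (reads Q e) t
  ... | u , v rewrite *-distribʳ-+ L ∣ e ∣ ∣ e′ ∣ = +-<2^ (∣ e ∣ * L) _ (pos e) (pos e′) (go e u) (go e′ v)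
  go (e ⊖ e′) t rewrite *-distribʳ-+ L ∣ e ∣ ∣ e′ ∣ =
    ≤-<-trans (m∸n≤m (⟦ e ⟧ s) (⟦ e′ ⟧ s)) (<-≤-trans (go e t) (2^-mono (m≤m+n (∣ e ∣ * L) _)))
  go (e ⊗ e′) t with T-split (reads Q e) t
  ... | u , v rewrite *-distribʳ-+ L ∣ e ∣ ∣ e′ ∣ = *-<2^ (∣ e ∣ * L) _ (go e u) (go e′ v)

reads-any : ∀ e → T (reads (const true) e)
reads-any (lit k)  = tt
reads-any (a at e) = tt
reads-any (e ⊕ e′) = T-join (reads (const true) e) (reads-any e) (reads-any e′)
reads-any (e ⊖ e′) = reads-any e
reads-any (e ⊗ e′) = T-join (reads (const true) e) (reads-any e) (reads-any e′)

val< : ∀ {L s} → 1 ≤ L → Small L s → ∀ e → ⟦ e ⟧ s < 2 ^ (∣ e ∣ * L)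
val< 1≤L h e = val<-reads 1≤L (λ a i _ → h a i) e (reads-any e)

cost≤ : ∀ {M s} → 1 ≤ M → Small M s → ∀ e → exprCost e s ≤ costBound e M
cost≤ {M} {s} 1≤M h = go
  where
  bits-val : ∀ e → bits (⟦ e ⟧ s) ≤ ∣ e ∣ * M
  bits-val e = bits≤ (*-mono-≤ 1≤∣ e ∣ 1≤M) (val< 1≤M h e)
  go : ∀ e → exprCost e s ≤ costBound e M
  go (lit k)  = ≤-refl
  go (a at e) = +-mono-≤ (go e) (bits≤ 1≤M (h a _))
  go (e ⊕ e′) = +-mono-≤ (+-mono-≤ (go e) (go e′)) (bits-val (e ⊕ e′))
  go (e ⊖ e′) = +-mono-≤ (+-mono-≤ (go e) (go e′)) (bits-val (e ⊖ e′))
  go (e ⊗ e′) = +-mono-≤ (+-mono-≤ (go e) (go e′)) (bits-val (e ⊗ e′))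

-- The factor 2^L is taken out of both summands of a sum, and at most one factor of a product
-- carries it, so L is counted once. The bound `∣ e ∣ * L` would multiply the length at each
-- iteration of a loop; here only a multiple of Z is added.
linear< : ∀ {Z L s} → 1 ≤ Z → 1 ≤ L → Input Z s → Small L s →
          ∀ e → T (linear e) → ⟦ e ⟧ s < 2 ^ (L + ∣ e ∣ * Z)
linear< {Z} {L} {s} 1≤Z 1≤L I h = go
  where
  pos : ∀ e → 1 ≤ ∣ e ∣ * Z
  pos e = *-mono-≤ 1≤∣ e ∣ 1≤Z
  split : ∀ e e′ → L + (∣ e ∣ + ∣ e′ ∣) * Z ≡ (L + ∣ e ∣ * Z) + ∣ e′ ∣ * Z
  split e e′ = trans (cong (L +_) (*-distribʳ-+ Z ∣ e ∣ ∣ e′ ∣)) (sym (+-assoc L _ _))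
  sum< : ∀ A B {x y} → 1 ≤ A → 1 ≤ B → x < 2 ^ (L + A) → y < 2 ^ (L + B) → x + y < 2 ^ (L + A + B)
  sum< A B {x} {y} 1≤A 1≤B x< y< = begin-strict
    x + y                         <⟨ +-mono-< x< y< ⟩
    2 ^ (L + A) + 2 ^ (L + B)     ≡⟨ cong₂ _+_ (^-distribˡ-+-* 2 L A) (^-distribˡ-+-* 2 L B) ⟩
    2 ^ L * 2 ^ A + 2 ^ L * 2 ^ B ≡⟨ *-distribˡ-+ (2 ^ L) (2 ^ A) (2 ^ B) ⟨
    2 ^ L * (2 ^ A + 2 ^ B)       ≤⟨ *-monoʳ-≤ (2 ^ L) (2^+2^≤ 1≤A 1≤B) ⟩
    2 ^ L * 2 ^ (A + B)           ≡⟨ ^-distribˡ-+-* 2 L (A + B) ⟨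
    2 ^ (L + (A + B))             ≡⟨ cong (2 ^_) (+-assoc L A B) ⟨
    2 ^ (L + A + B)               ∎
    where open ≤-Reasoning
  go : ∀ e → T (linear e) → ⟦ e ⟧ s < 2 ^ (L + ∣ e ∣ * Z)
  go (lit k) _ = <-≤-trans (val<-reads {const false} {s = s} 1≤Z (λ _ _ ()) (lit k) tt) (2^-mono (m≤n+m _ L))
  go (a at e) _ = <-≤-trans (h a _) (2^-mono (m≤m+n L _))
  go (e ⊕ e′) t with T-split (linear e) t
  ... | u , v rewrite split e e′ = sum< _ _ (pos e) (pos e′) (go e u) (go e′ v)
  go (e ⊖ e′) t rewrite split e e′ =
    ≤-<-trans (m∸n≤m (⟦ e ⟧ s) (⟦ e′ ⟧ s)) (<-≤-trans (go e t) (2^-mono (m≤m+n (L + ∣ e ∣ * Z) (∣ e′ ∣ * Z))))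
  go (e ⊗ e′) t with T-split (linear e) t
  ... | u , v rewrite split e e′ = *-<2^ (L + ∣ e ∣ * Z) (∣ e′ ∣ * Z) (go e u)
    (val<-reads 1≤Z (λ a i a<3 → Input.small I a i (<ᵇ⇒< a 3 a<3)) e′ v)

upd-elim : ∀ (P : ℕ → Set) s a i v b j → P v → P (s b j) → P ((s [ a , i ↦ v ]) b j)
upd-elim P s a i v b j pv ps with (a ≡ᵇ b) ∧ (i ≡ᵇ j)
... | true  = pv
... | false = ps

upd-other : ∀ s {a b} i v j → a ≢ b → (s [ a , i ↦ v ]) b j ≡ s b j
upd-other s {a} {b} i v j a≢b rewrite ≢⇒≡ᵇ a b a≢b = refl

not-≡ᵇ : ∀ a b → T (not (a ≡ᵇ b)) → a ≢ b
not-≡ᵇ a b t a≡b with a ≡ᵇ b | ≡⇒≡ᵇ a b a≡b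
... | false | ()

loop-invariant : ∀ (Inv : ℕ → Store → Set) {y f} →
                 (∀ r {s} → Inv (suc r) s → Inv r (f (s [ y , 0 ↦ r ]))) →
                 ∀ r {s} → Inv r s → Inv 0 (loop y f r s)
loop-invariant Inv h zero    i = i
loop-invariant Inv h (suc r) i = loop-invariant Inv h r (h r i)

preserved : ∀ y p → T (preserves y p) → ∀ s j → exec p s y j ≡ s y j
preserved y skip         t s j = refl
preserved y (a at i ≔ e) t s j = upd-other s (⟦ i ⟧ s) _ j (not-≡ᵇ a y t)
preserved y (p ⨾ q)      t s j with T-split (preserves y p) t
... | u , v = trans (preserved y q v _ j) (preserved y p u s j)
preserved y (ifnz e p q) t s j with ⟦ e ⟧ s | T-split (preserves y p) t
... | zero  | u , v = preserved y q v s j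
... | suc _ | u , v = preserved y p u s j
preserved y (for x m p)  t s j with T-split (not (x ≡ᵇ y)) t
... | u , v = loop-invariant (λ _ s′ → s′ y j ≡ s y j)
  (λ r {s′} eq → trans (preserved y p v _ j) (trans (upd-other s′ 0 r j (not-≡ᵇ x y u)) eq))
  (m * s 0 0) (upd-other s 0 (m * s 0 0) j (not-≡ᵇ x y u))

record Halts (c : Cmd) (s s′ : Store) (Z t L : ℕ) : Set where
  constructor halts
  field
    {time}  : ℕ
    runs    : Runs c s time s′
    time≤   : time ≤ t
    input   : Input Z s′
    small   : Small L s′

update-input : ∀ {Z s a} i v → 2 < a → Input Z s → Input Z (s [ a , i ↦ v ])
update-input {Z} {s} {a} i v 2<a I = record
  { small = λ b j b<3 → subst (_< 2 ^ Z) (sym (upd-other s i v j (a≢ b<3))) (Input.small I b j b<3)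
  ; n≤Z   = subst (_≤ Z) (sym (upd-other s i v 0 (a≢ (s≤s z≤n)))) (Input.n≤Z I)
  }
  where
  a≢ : ∀ {b} → b < 3 → a ≢ b
  a≢ b<3 refl = <⇒≱ 2<a (≤-pred b<3)

module _ {Z M : ℕ} (1≤Z : 1 ≤ Z) where

  -- The length L of the cells grows along the run, whereas M bounds it at the end. All costs are
  -- charged at M, so each iteration of a loop has the same time bound.
  run : ∀ p → T (admissible p) → ∀ {s L} → Z ≤ L → Input Z s → Small L s → L + growth p Z ≤ M →
        Halts (compile p) s (exec p s) Z (timeBound p Z M) (L + growth p Z)

  run-while : ∀ y p → T (preserves y p) → T (admissible p) → 2 < y → ∀ r {s L} → s y 0 ≡ r →
              Z ≤ L → Input Z s → Small L s → L + r * growth p Z ≤ M →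
              Halts (whilenz (y at lit 0) (down y ⨾ compile p)) s (loop y (exec p) r s) Z
                    (r * iterBound y p Z M + testBound y M) (L + r * growth p Z)

  small-M : ∀ L {s g} → Small L s → L + g ≤ M → Small M s
  small-M L h L+g≤M a i = <-≤-trans (h a i) (2^-mono (≤-trans (m≤m+n L _) L+g≤M))

  1≤M : ∀ {L g} → Z ≤ L → L + g ≤ M → 1 ≤ M
  1≤M Z≤L L+g≤M = ≤-trans 1≤Z (≤-trans Z≤L (≤-trans (m≤m+n _ _) L+g≤M))

  run-assign : ∀ a i e → T (linear e) → 2 < a → ∀ {s L} → Z ≤ L → Input Z s → Small L s → L + ∣ e ∣ * Z ≤ M →
               Halts (a at i ≔ e) s (exec (a at i ≔ e) s) Z (assignBound i e M) (L + ∣ e ∣ * Z)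
  run-assign a i e lin 2<a {s} {L} Z≤L I h L≤M = halts run-≔
    (+-mono-≤ (+-monoʳ-≤ 1 (cost≤ (1≤M Z≤L L≤M) (small-M L h L≤M) i)) (cost≤ (1≤M Z≤L L≤M) (small-M L h L≤M) e))
    (update-input (⟦ i ⟧ s) _ 2<a I)
    (λ b j → upd-elim (_< 2 ^ (L + ∣ e ∣ * Z)) s a (⟦ i ⟧ s) (⟦ e ⟧ s) b j
      (linear< 1≤Z (≤-trans 1≤Z Z≤L) I h e lin)
      (<-≤-trans (h b j) (2^-mono (m≤m+n L _))))

  run skip _ {L = L} Z≤L I h L≤M = halts run-skip ≤-refl I
    (λ a i → <-≤-trans (h a i) (2^-mono (m≤m+n L 0)))
  run (a at i ≔ e) t Z≤L I h L≤M with T-split (2 <ᵇ a) t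
  ... | u , v = run-assign a i e v (<ᵇ⇒< 2 a u) Z≤L I h L≤M
  run (p ⨾ q) t {s} {L} Z≤L I h L≤M with T-split (admissible p) t | +-assoc L (growth p Z) (growth q Z)
  ... | u , v | eq with run p u Z≤L I h (≤-trans (+-monoʳ-≤ L (m≤m+n _ _)) L≤M)
  ... | halts r₁ t₁ I₁ h₁ with run q v (≤-trans Z≤L (m≤m+n L _)) I₁ h₁ (≤-trans (≤-reflexive eq) L≤M)
  ... | halts r₂ t₂ I₂ h₂ = halts (run-⨾ r₁ r₂) (+-mono-≤ t₁ t₂) I₂ (subst (λ L → Small L (exec q (exec p s))) eq h₂)
  run (ifnz e p q) t {s} {L} Z≤L I h L≤M with ⟦ e ⟧ s in eq | T-split (admissible p) t
  ... | zero | u , v with run q v Z≤L I h (≤-trans (+-monoʳ-≤ L (m≤n+m _ _)) L≤M)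
  ... | halts r₁ t₁ I₁ h₁ = halts (run-else eq r₁)
    (+-mono-≤ (+-monoʳ-≤ 1 (cost≤ (1≤M Z≤L L≤M) (small-M L h L≤M) e)) (≤-trans t₁ (m≤n+m _ _)))
    I₁ (λ a i → <-≤-trans (h₁ a i) (2^-mono (+-monoʳ-≤ L (m≤n+m _ _))))
  run (ifnz e p q) t {s} {L} Z≤L I h L≤M | suc w | u , v with run p u Z≤L I h (≤-trans (+-monoʳ-≤ L (m≤m+n _ _)) L≤M)
  ... | halts r₁ t₁ I₁ h₁ = halts (run-then (λ z → 1+n≢0 (trans (sym eq) z)) r₁)
    (+-mono-≤ (+-monoʳ-≤ 1 (cost≤ (1≤M Z≤L L≤M) (small-M L h L≤M) e)) (≤-trans t₁ (m≤m+n _ _)))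
    I₁ (λ a i → <-≤-trans (h₁ a i) (2^-mono (+-monoʳ-≤ L (m≤m+n _ _))))
  run (for y m p) t {s} {L} Z≤L I h L≤M with T-split (2 <ᵇ y) t
  ... | u , t′ with T-split (preserves y p) t′
  ... | v , w with run-assign y (lit 0) (times m) (T-join true tt tt) (<ᵇ⇒< 2 y u) Z≤L I h
                     (≤-trans (+-monoʳ-≤ L (m≤m+n _ _)) L≤M)
  ... | halts r₁ t₁ I₁ h₁ with run-while y p v w (<ᵇ⇒< 2 y u) (m * s 0 0) at-y (≤-trans Z≤L (m≤m+n L _)) I₁ h₁
                     (≤-trans (+-monoʳ-≤ (L + ∣ times m ∣ * Z) bound) (≤-trans (≤-reflexive (+-assoc L _ _)) L≤M))
    where
    at-y : (s [ y , 0 ↦ m * s 0 0 ]) y 0 ≡ m * s 0 0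
    at-y rewrite ≡ᵇ-refl y = refl
    bound : m * s 0 0 * growth p Z ≤ m * Z * growth p Z
    bound = *-monoˡ-≤ (growth p Z) (*-monoʳ-≤ m (Input.n≤Z I))
  ... | halts r₂ t₂ I₂ h₂ = halts (run-⨾ r₁ r₂)
    (+-mono-≤ t₁ (≤-trans t₂ (+-monoˡ-≤ _ (*-monoˡ-≤ (iterBound y p Z M) (*-monoʳ-≤ m (Input.n≤Z I))))))
    I₂ (λ a i → <-≤-trans (h₂ a i) (2^-mono (≤-trans (+-monoʳ-≤ (L + ∣ times m ∣ * Z)
         (*-monoˡ-≤ (growth p Z) (*-monoʳ-≤ m (Input.n≤Z I)))) (≤-reflexive (+-assoc L _ _)))))

  run-while y p pr ad 2<y zero {s} {L} eq Z≤L I h L≤M = halts (run-stop eq)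
    (+-monoʳ-≤ 1 (cost≤ (1≤M Z≤L L≤M) (small-M L h L≤M) (y at lit 0))) I
    (λ a i → <-≤-trans (h a i) (2^-mono (m≤m+n L 0)))
  run-while y p pr ad 2<y (suc r) {s} {L} eq Z≤L I h L≤M
    with run p ad Z≤L (update-input 0 r 2<y I) small₁ (≤-trans (+-monoʳ-≤ L (m≤m+n _ _)) L≤M)
    where
    small₁ : Small L (s [ y , 0 ↦ r ])
    small₁ a i = upd-elim (_< 2 ^ L) s y 0 r a i (<-trans (≤-reflexive (sym eq)) (h y 0)) (h a i)
  ... | halts {t₁} r₁ t₁≤ I₁ h₁
    with run-while y p pr ad 2<y r at-y (≤-trans Z≤L (m≤m+n L _)) I₁ h₁
           (≤-trans (≤-reflexive (+-assoc L _ _)) L≤M)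
    where
    at-y : exec p (s [ y , 0 ↦ r ]) y 0 ≡ r
    at-y = trans (preserved y p pr (s [ y , 0 ↦ r ]) 0) lem
      where
      lem : (s [ y , 0 ↦ r ]) y 0 ≡ r
      lem rewrite ≡ᵇ-refl y = refl
  ... | halts {t₂} r₂ t₂≤ I₂ h₂ = halts
    (run-loop (λ z → 1+n≢0 (trans (sym eq) z))
      (run-⨾ (subst (λ v → Runs (down y) s (1 + exprCost (lit 0) s + exprCost (y at lit 0 ⊖ lit 1) s) (s [ y , 0 ↦ v ])) (cong pred eq) run-≔) r₁) r₂)
    (≤-trans (+-mono-≤ (+-mono-≤ test (+-mono-≤ decr t₁≤)) t₂≤)
      (≤-reflexive (sym (+-assoc (iterBound y p Z M) _ _))))
    I₂ (subst (λ L → Small L (loop y (exec p) r (exec p (s [ y , 0 ↦ r ])))) (+-assoc L _ _) h₂)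
    where
    hM : Small M s
    hM = small-M L h L≤M
    test : 1 + exprCost (y at lit 0) s ≤ testBound y M
    test = +-monoʳ-≤ 1 (cost≤ (1≤M Z≤L L≤M) hM (y at lit 0))
    decr : 1 + exprCost (lit 0) s + exprCost (y at lit 0 ⊖ lit 1) s ≤ assignBound (lit 0) (y at lit 0 ⊖ lit 1) M
    decr = +-mono-≤ (+-monoʳ-≤ 1 (cost≤ (1≤M Z≤L L≤M) hM (lit 0))) (cost≤ (1≤M Z≤L L≤M) hM (y at lit 0 ⊖ lit 1))

-- Polynomial bounds on length and time.

PolyBounded : (ℕ → ℕ) → Set
PolyBounded f = ∃[ c ] ∃[ d ] (∀ Z → 1 ≤ Z → f Z ≤ c * Z ^ d)

poly-const : ∀ k → PolyBounded (const k)
poly-const k = k , 0 , λ Z _ → ≤-reflexive (sym (*-identityʳ k))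

poly-id : PolyBounded id
poly-id = 1 , 1 , λ Z _ → ≤-reflexive (sym (trans (*-identityˡ _) (*-identityʳ Z)))

poly-+ : ∀ {f g} → PolyBounded f → PolyBounded g → PolyBounded (λ Z → f Z + g Z)
poly-+ {f} {g} (c , d , p) (c′ , d′ , p′) = c + c′ , d + d′ , λ Z 1≤Z → begin
  f Z + g Z                              ≤⟨ +-mono-≤ (p Z 1≤Z) (p′ Z 1≤Z) ⟩
  c * Z ^ d + c′ * Z ^ d′                ≤⟨ +-mono-≤ (*-monoʳ-≤ c (raise Z 1≤Z (m≤m+n d d′)))
                                                     (*-monoʳ-≤ c′ (raise Z 1≤Z (m≤n+m d′ d))) ⟩
  c * Z ^ (d + d′) + c′ * Z ^ (d + d′)   ≡⟨ *-distribʳ-+ (Z ^ (d + d′)) c c′ ⟨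
  (c + c′) * Z ^ (d + d′)                ∎
  where
  open ≤-Reasoning
  raise : ∀ Z → 1 ≤ Z → ∀ {d d′} → d ≤ d′ → Z ^ d ≤ Z ^ d′
  raise (suc Z) _ = ^-monoʳ-≤ (suc Z)

poly-* : ∀ {f g} → PolyBounded f → PolyBounded g → PolyBounded (λ Z → f Z * g Z)
poly-* {f} {g} (c , d , p) (c′ , d′ , p′) = c * c′ , d + d′ , λ Z 1≤Z → begin
  f Z * g Z                    ≤⟨ *-mono-≤ (p Z 1≤Z) (p′ Z 1≤Z) ⟩
  (c * Z ^ d) * (c′ * Z ^ d′)  ≡⟨ lem c (Z ^ d) c′ (Z ^ d′) ⟩
  (c * c′) * (Z ^ d * Z ^ d′)  ≡⟨ cong ((c * c′) *_) (^-distribˡ-+-* Z d d′) ⟨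
  (c * c′) * Z ^ (d + d′)      ∎
  where
  open ≤-Reasoning
  lem : ∀ a b c d → (a * b) * (c * d) ≡ (a * c) * (b * d)
  lem = solve-∀

module _ {M : ℕ → ℕ} (poly-M : PolyBounded M) where

  poly-cost : ∀ e → PolyBounded (λ Z → costBound e (M Z))
  poly-cost (lit k)  = poly-const (bits k)
  poly-cost (a at e) = poly-+ (poly-cost e) poly-M
  poly-cost (e ⊕ e′) = poly-+ (poly-+ (poly-cost e) (poly-cost e′)) (poly-* (poly-const ∣ e ⊕ e′ ∣) poly-M)
  poly-cost (e ⊖ e′) = poly-+ (poly-+ (poly-cost e) (poly-cost e′)) (poly-* (poly-const ∣ e ⊖ e′ ∣) poly-M)
  poly-cost (e ⊗ e′) = poly-+ (poly-+ (poly-cost e) (poly-cost e′)) (poly-* (poly-const ∣ e ⊗ e′ ∣) poly-M)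

  poly-assign : ∀ i e → PolyBounded (λ Z → assignBound i e (M Z))
  poly-assign i e = poly-+ (poly-+ (poly-const 1) (poly-cost i)) (poly-cost e)

  poly-test : ∀ y → PolyBounded (λ Z → testBound y (M Z))
  poly-test y = poly-+ (poly-const 1) (poly-cost (y at lit 0))

  poly-time : ∀ p → PolyBounded (λ Z → timeBound p Z (M Z))
  poly-time skip         = poly-const 1
  poly-time (a at i ≔ e) = poly-assign i e
  poly-time (p ⨾ q)      = poly-+ (poly-time p) (poly-time q)
  poly-time (ifnz e p q) = poly-+ (poly-+ (poly-const 1) (poly-cost e)) (poly-+ (poly-time p) (poly-time q))
  poly-time (for y m p)  = poly-+ (poly-assign (lit 0) (times m))
    (poly-+ (poly-* (poly-* (poly-const m) poly-id)
              (poly-+ (poly-test y) (poly-+ (poly-assign (lit 0) (y at lit 0 ⊖ lit 1)) (poly-time p))))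
            (poly-test y))

poly-growth : ∀ p → PolyBounded (growth p)
poly-growth skip         = poly-const 0
poly-growth (a at i ≔ e) = poly-* (poly-const ∣ e ∣) poly-id
poly-growth (p ⨾ q)      = poly-+ (poly-growth p) (poly-growth q)
poly-growth (ifnz e p q) = poly-+ (poly-growth p) (poly-growth q)
poly-growth (for y m p)  = poly-+ (poly-* (poly-const ∣ times m ∣) poly-id)
  (poly-* (poly-* (poly-const m) poly-id) (poly-growth p))

-- Starting from L = Z, no cell ever exceeds Z + `growth p Z` bits. This is a polynomial in Z, which
-- is substituted for M in the time bound.
runs-in-poly-time : ∀ p → T (admissible p) → ∃[ c ] ∃[ d ]
  (∀ Z s → 1 ≤ Z → Input Z s → Small Z s →
   ∃[ t ] Runs (compile p) s t (exec p s) × t ≤ c * Z ^ d)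
runs-in-poly-time p ok with poly-time (poly-+ poly-id (poly-growth p)) p
... | c , d , bound = c , d , λ Z s 1≤Z I h →
  let H = run {M = Z + growth p Z} 1≤Z p ok ≤-refl I h ≤-refl
  in Halts.time H , Halts.runs H , ≤-trans (Halts.time≤ H) (bound Z 1≤Z)

-- Longest processing time first as a program

branch-elim : ∀ (P : Store → Set) c s s′ → (c ≢ 0 → P s) → (c ≡ 0 → P s′) → P (branch c s s′)
branch-elim P zero    s s′ h h′ = h′ refl
branch-elim P (suc c) s s′ h h′ = h λ ()

Frame : Prog → Store → Store → Set
Frame p s₀ s = ∀ a → T (preserves a p) → ∀ j → s a j ≡ s₀ a j

-- The counter is decreased before the body, so the body sees N - 1, ..., 0, and `Inv r` usually
-- speaks of the indices from r on. `Frame` supplies the arrays that the loop never writes, so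
-- invariants need not mention them.
for-invariant : ∀ (Inv : ℕ → Store → Set) y m p {s₀} N → m * s₀ 0 0 ≡ N →
  Inv N (s₀ [ y , 0 ↦ N ]) →
  (∀ r s → r < N → Frame (for y m p) s₀ s → Inv (suc r) s → Inv r (exec p (s [ y , 0 ↦ r ]))) →
  Inv 0 (exec (for y m p) s₀)
for-invariant Inv y m p {s₀} N refl init step =
  proj₂ (proj₂ (loop-invariant (λ r s → r ≤ N × Frame (for y m p) s₀ s × Inv r s)
    (λ r {s} (r<N , fr , i) → <⇒≤ r<N , fr′ r s fr , step r s r<N fr i)
    N (≤-refl , fr₀ , init)))
  where
  fr₀ : Frame (for y m p) s₀ (s₀ [ y , 0 ↦ N ])
  fr₀ a t j = upd-other s₀ 0 N j (not-≡ᵇ y a (proj₁ (T-split (not (y ≡ᵇ a)) t)))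
  fr′ : ∀ r s → Frame (for y m p) s₀ s → Frame (for y m p) s₀ (exec p (s [ y , 0 ↦ r ]))
  fr′ r s fr a t j with T-split (not (y ≡ᵇ a)) t
  ... | u , v = trans (preserved a p v _ j) (trans (upd-other s 0 r j (not-≡ᵇ y a u)) (fr a t j))

≤-split : ∀ {r j} → r ≤ j → r ≡ j ⊎ suc r ≤ j
≤-split r≤j with m≤n⇒m<n∨m≡n r≤j
... | inj₁ lt = inj₂ lt
... | inj₂ eq = inj₁ eq

-- Array 4 holds the scaled sizes, 5 the scaled sizes of the items that are still
-- to be packed, 6 the loads and 7 the bins of the items. The first cells of the
-- following arrays serve as registers: 8 holds the scaled capacity D, 9 the scaled
-- threshold g, 10 to 13 are loop counters (k - 1 is in 13), 14 and 15 hold the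
-- chosen item and bin, 16 and 17 the total overflow over g and over D, 18 the least
-- cost so far, and 19 the product of k and D * den β.
# : ℕ → Expr
# a = a at lit 0

argmax-body argmax argmin-body argmin : Prog
argmax-body = ifnz (5 at # 11 ⊖ 5 at # 14) (14 at lit 0 ≔ # 11) skip
argmax = 14 at lit 0 ≔ lit 0 ⨾ for 11 1 argmax-body
argmin-body = ifnz (6 at # 15 ⊖ 6 at # 11) (ifnz (# 13 ⊕ lit 1 ⊖ # 11) (15 at lit 0 ≔ # 11) skip) skip
argmin = 15 at lit 0 ≔ lit 0 ⨾ for 11 2 argmin-body

argmax-spec : ∀ s {n} → s 0 0 ≡ n → 1 ≤ n →
  exec argmax s 14 0 < n × (∀ j → j < n → s 5 j ≤ s 5 (exec argmax s 14 0))
argmax-spec s {n} n≡ 1≤n =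
  let i<n , h = for-invariant Inv 11 1 argmax-body {s [ 14 , 0 ↦ 0 ]} n (trans (*-identityˡ _) n≡)
                  (1≤n , λ j n≤j j<n → ⊥-elim (<⇒≱ j<n n≤j)) step
  in i<n , λ j → h j z≤n
  where
  Inv : ℕ → Store → Set
  Inv r s′ = s′ 14 0 < n × (∀ j → r ≤ j → j < n → s 5 j ≤ s 5 (s′ 14 0))
  step : ∀ r s′ → r < n → Frame (for 11 1 argmax-body) (s [ 14 , 0 ↦ 0 ]) s′ → Inv (suc r) s′ →
         Inv r (exec argmax-body (s′ [ 11 , 0 ↦ r ]))
  step r s′ r<n fr (i<n , h) = branch-elim (Inv r) (s′ 5 r ∸ s′ 5 (s′ 14 0)) (s″ [ 14 , 0 ↦ r ]) s″
    (λ ≢0 → r<n , λ j r≤j j<n → [ (λ { refl → ≤-refl })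
                                , (λ r<j → ≤-trans (h j r<j j<n) (<⇒≤ (lt ≢0))) ]′ (≤-split r≤j))
    (λ ≡0 → i<n , λ j r≤j j<n → [ (λ { refl → le ≡0 }) , (λ r<j → h j r<j j<n) ]′ (≤-split r≤j))
    where
    s″ : Store
    s″ = s′ [ 11 , 0 ↦ r ]
    lt : s′ 5 r ∸ s′ 5 (s′ 14 0) ≢ 0 → s 5 (s′ 14 0) < s 5 r
    lt ≢0 = subst₂ _<_ (fr 5 _ _) (fr 5 _ r) (≰⇒> (≢0 ∘ m≤n⇒m∸n≡0))
    le : s′ 5 r ∸ s′ 5 (s′ 14 0) ≡ 0 → s 5 r ≤ s 5 (s′ 14 0)
    le ≡0 = subst₂ _≤_ (fr 5 _ r) (fr 5 _ _) (m∸n≡0⇒m≤n ≡0)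

-- A loop cannot run k times, so all 2n bins are scanned and the inner test k ∸ index ≠ 0 rejects
-- those from k on. During LPT these are empty and would otherwise attract the items.
argmin-spec : ∀ s {n k} → s 0 0 ≡ n → s 13 0 + 1 ≡ k → k ≤ 2 * n →
  exec argmin s 15 0 < k × (∀ j → j < k → s 6 (exec argmin s 15 0) ≤ s 6 j)
argmin-spec s {n} {k} refl refl k≤2n =
  let i<k , h = for-invariant Inv 11 2 argmin-body {s [ 15 , 0 ↦ 0 ]} (2 * n) refl
                  (m≤n+m 1 (s 13 0) , λ j 2n≤j j<k → ⊥-elim (<⇒≱ j<k (≤-trans k≤2n 2n≤j))) step
  in i<k , λ j → h j z≤n
  where
  Inv : ℕ → Store → Set
  Inv r s′ = s′ 15 0 < k × (∀ j → r ≤ j → j < k → s 6 (s′ 15 0) ≤ s 6 j)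
  step : ∀ r s′ → r < 2 * n → Frame (for 11 2 argmin-body) (s [ 15 , 0 ↦ 0 ]) s′ → Inv (suc r) s′ →
         Inv r (exec argmin-body (s′ [ 11 , 0 ↦ r ]))
  step r s′ r<2n fr (i<k , h) = branch-elim (Inv r) (s′ 6 (s′ 15 0) ∸ s′ 6 r)
    (branch (s′ 13 0 + 1 ∸ r) (s″ [ 15 , 0 ↦ r ]) s″) s″
    (λ ≢0 → branch-elim (Inv r) (s′ 13 0 + 1 ∸ r) (s″ [ 15 , 0 ↦ r ]) s″
      (λ k∸r≢0 → subst (r <_) (cong (_+ 1) (fr 13 _ 0)) (≰⇒> (k∸r≢0 ∘ m≤n⇒m∸n≡0)) ,
         λ j r≤j j<k → [ (λ { refl → ≤-refl })
                       , (λ r<j → ≤-trans (<⇒≤ (lt ≢0)) (h j r<j j<k)) ]′ (≤-split r≤j))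
      (λ k∸r≡0 → i<k , λ j r≤j j<k → [ (λ { refl → ⊥-elim (<⇒≱ j<k
           (subst (_≤ r) (cong (_+ 1) (fr 13 _ 0)) (m∸n≡0⇒m≤n k∸r≡0))) })
         , (λ r<j → h j r<j j<k) ]′ (≤-split r≤j)))
    (λ ≡0 → i<k , λ j r≤j j<k → [ (λ { refl → le ≡0 }) , (λ r<j → h j r<j j<k) ]′ (≤-split r≤j))
    where
    s″ : Store
    s″ = s′ [ 11 , 0 ↦ r ]
    lt : s′ 6 (s′ 15 0) ∸ s′ 6 r ≢ 0 → s 6 r < s 6 (s′ 15 0)
    lt ≢0 = subst₂ _<_ (fr 6 _ r) (fr 6 _ _) (≰⇒> (≢0 ∘ m≤n⇒m∸n≡0))
    le : s′ 6 (s′ 15 0) ∸ s′ 6 r ≡ 0 → s 6 (s′ 15 0) ≤ s 6 r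
    le ≡0 = subst₂ _≤_ (fr 6 _ _) (fr 6 _ r) (m∸n≡0⇒m≤n ≡0)

upd : (ℕ → ℕ) → ℕ → ℕ → ℕ → ℕ
upd f i v j = if i ≡ᵇ j then v else f j

upd-at : ∀ f i v → upd f i v i ≡ v
upd-at f i v rewrite ≡ᵇ-refl i = refl

upd-off : ∀ f i v j → j ≢ i → upd f i v j ≡ f j
upd-off f i v j j≢i rewrite ≢⇒≡ᵇ i j (j≢i ∘ sym) = refl

binLoad : ℕ → (ℕ → ℕ) → (ℕ → ℕ) → ℕ → ℕ
binLoad n a σ b = Σ< n (λ j → if σ j ≡ᵇ b then a j else 0)

binLoad-cong : ∀ n {a a′ σ σ′} → (∀ j → j < n → a j ≡ a′ j) → (∀ j → j < n → σ j ≡ σ′ j) →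
               ∀ b → binLoad n a σ b ≡ binLoad n a′ σ′ b
binLoad-cong n ha hσ b = Σ-cong n λ j j<n → cong₂ (λ x y → if x ≡ᵇ b then y else 0) (hσ j j<n) (ha j j<n)

if-zero : ∀ c {x} → x ≡ 0 → (if c then x else 0) ≡ 0
if-zero true  x≡0 = x≡0
if-zero false x≡0 = refl

binLoad-none : ∀ n {a σ b} → (∀ j → j < n → σ j ≢ b) → binLoad n a σ b ≡ 0
binLoad-none n {a} {σ} {b} h = Σ-zero n λ j j<n → cong (if_then a j else 0) (≢⇒≡ᵇ (σ j) b (h j j<n))

-- A packing τ into bins 0, …, M - 1, where e marks the bins in use, with so few
-- bins that longest processing time on k bins is at least as good.
record Rival (n k M : ℕ) (τ e : ℕ → ℕ) : Set where
  field
    τ<M  : ∀ j → j < n → τ j < M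
    used : ∀ j → j < n → 1 ≤ e (τ j)
    few  : 3 * Σ< M e ≤ 2 * k + 1

-- Here w holds the sizes of the items that are still to be packed and 0 for the
-- other items.
module Rounds {n k M : ℕ} (N : ℕ) {a τ e : ℕ → ℕ} (a≥1 : ∀ j → j < n → 1 ≤ a j) (R : Rival n k M τ e) where
  open Rival R

  packed : (ℕ → ℕ) → ℕ → ℕ
  packed w j = a j ∸ w j

  -- The lists `L` and `T′` exist only in the proof. `T′` is the rival restricted to the items
  -- packed so far, in the order in which LPT packs them.
  record RoundInv (r : ℕ) (w l o : ℕ → ℕ) : Set where
    field
      L T′  : ℕ → List ℕ
      sched : Schedules k M e L T′
      cases : ∀ j → j < n → w j ≡ 0 ⊎ w j ≡ a j
      unpacked : Σ< n (λ j → 1 ⊓ w j) ≡ r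
      o<k   : ∀ j → j < n → w j ≡ 0 → o j < k
      load  : ∀ b → b < N → l b ≡ binLoad n (packed w) o b
      load₁ : ∀ b → b < k → l b ≡ sumᴸ (L b)
      load₂ : ∀ b → b < M → binLoad n (packed w) τ b ≡ sumᴸ (T′ b)
      w≤L   : ∀ j b → j < n → b < k → All (w j ≤_) (L b)

  binLoad-pack : ∀ {w i} σ σ′ → i < n → w i ≡ a i → (∀ j → j < n → j ≢ i → σ′ j ≡ σ j) → ∀ b →
                 binLoad n (packed (upd w i 0)) σ′ b
                 ≡ (if σ′ i ≡ᵇ b then a i else 0) + binLoad n (packed w) σ b
  binLoad-pack {w} {i} σ σ′ i<n wi≡ai h b = trans
    (sym (Σ-at n i<n
      (λ j j<n j≢i → cong₂ (λ x y → if x ≡ᵇ b then a j ∸ y else 0) (sym (h j j<n j≢i)) (sym (upd-off w i 0 j j≢i)))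
      atᵢ))
    (+-comm (binLoad n (packed w) σ b) _)
    where
    atᵢ : (if σ i ≡ᵇ b then a i ∸ w i else 0) + (if σ′ i ≡ᵇ b then a i else 0)
         ≡ (if σ′ i ≡ᵇ b then a i ∸ upd w i 0 i else 0)
    atᵢ rewrite upd-at w i 0 | if-zero (σ i ≡ᵇ b) (trans (cong (a i ∸_) wi≡ai) (n∸n≡0 (a i))) = refl

  sum-insert : ∀ c x B b → sumᴸ (insert c x B b) ≡ (if c ≡ᵇ b then x else 0) + sumᴸ (B b)
  sum-insert c x B b with c ≡ᵇ b
  ... | true  = refl
  ... | false = refl

  upd-+ : ∀ l c x b → upd l c (l c + x) b ≡ (if c ≡ᵇ b then x else 0) + l b
  upd-+ l c x b with c ≡ᵇ b in eq
  ... | false = refl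
  ... | true rewrite ≡ᵇ⇒≡ c b (subst T (sym eq) tt) = +-comm (l b) x

  round : ∀ {r w l o i c} → RoundInv (suc r) w l o → i < n → (∀ j → j < n → w j ≤ w i) →
          c < k → (∀ b → b < k → l c ≤ l b) →
          RoundInv r (upd w i 0) (upd l c (l c + w i)) (upd o i c)
  round {r} {w} {l} {o} {i} {c} I i<n max c<k min = record
    { L     = insert c (w i) L
    ; T′    = insert (τ i) (w i) T′
    ; sched = Step.step sched c<k (τ<M i i<n) (λ b → w≤L i b i<n)
                (λ b b<k → subst₂ _≤_ (load₁ c c<k) (load₁ b b<k) (min b b<k)) (used i i<n) few
    ; cases = cases′
    ; unpacked = suc-injective (trans (+-comm 1 _) (trans (Σ-at n i<n
                (λ j _ j≢i → cong (1 ⊓_) (upd-off w i 0 j j≢i)) count-i) unpacked))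
    ; o<k   = o<k′
    ; load  = λ b b<N → trans (upd-+ l c (w i) b) (trans (cong₂ _+_ (cong₂ (λ x y → if x ≡ᵇ b then y else 0)
                (sym (upd-at o i c)) wi≡ai) (load b b<N))
                (sym (binLoad-pack o (upd o i c) i<n wi≡ai (λ j _ → upd-off o i c j) b)))
    ; load₁ = λ b b<k → trans (upd-+ l c (w i) b) (trans (cong ((if c ≡ᵇ b then w i else 0) +_) (load₁ b b<k))
                (sym (sum-insert c (w i) L b)))
    ; load₂ = λ b b<M → trans (binLoad-pack τ τ i<n wi≡ai (λ _ _ _ → refl) b)
                (trans (cong₂ (λ x y → (if τ i ≡ᵇ b then x else 0) + y) (sym wi≡ai) (load₂ b b<M))
                (sym (sum-insert (τ i) (w i) T′ b)))
    ; w≤L   = w≤L′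
    }
    where
    open RoundInv I
    w′≤w : ∀ j → upd w i 0 j ≤ w j
    w′≤w j with i ≡ᵇ j
    ... | true  = z≤n
    ... | false = ≤-refl
    -- As an item is still unpacked, the maximum of `w` is positive; packed items have `w j ≡ 0`, so
    -- the chosen item is a new one.
    wi≢0 : w i ≢ 0
    wi≢0 wi≡0 = 1+n≢0 (trans (sym unpacked) (Σ-zero n λ j j<n →
      cong (1 ⊓_) (n≤0⇒n≡0 (≤-trans (max j j<n) (≤-reflexive wi≡0)))))
    wi≥1 : 1 ≤ w i
    wi≥1 = n≢0⇒n>0 wi≢0
    wi≡ai : w i ≡ a i
    wi≡ai = [ (λ wi≡0 → ⊥-elim (wi≢0 wi≡0)) , id ]′ (cases i i<n)
    cases′ : ∀ j → j < n → upd w i 0 j ≡ 0 ⊎ upd w i 0 j ≡ a j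
    cases′ j j<n with i ≡ᵇ j
    ... | true  = inj₁ refl
    ... | false = cases j j<n
    count-i : 1 ⊓ upd w i 0 i + 1 ≡ 1 ⊓ w i
    count-i rewrite upd-at w i 0 = sym (m≤n⇒m⊓n≡m wi≥1)
    o<k′ : ∀ j → j < n → upd w i 0 j ≡ 0 → upd o i c j < k
    o<k′ j j<n w≡0 with i ≡ᵇ j
    ... | true  = c<k
    ... | false = o<k j j<n w≡0
    w≤L′ : ∀ j b → j < n → b < k → All (upd w i 0 j ≤_) (insert c (w i) L b)
    w≤L′ j b j<n b<k with c ≡ᵇ b
    ... | true  = ≤-trans (w′≤w j) (max j j<n) ∷ All.map (≤-trans (w′≤w j)) (w≤L j b j<n b<k)
    ... | false = All.map (≤-trans (w′≤w j)) (w≤L j b j<n b<k)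

  start : ∀ {w l o} → (∀ j → j < n → w j ≡ a j) → (∀ b → b < N → l b ≡ 0) → k ≤ N → RoundInv n w l o
  start {w} {l} {o} w≡a l≡0 k≤N = record
    { L     = const []
    ; T′    = const []
    ; sched = record
      { tail≤  = λ _ ()
      ; sorted = λ _ ()
      ; used   = λ _ ()
      ; same   = λ h → trans (Σ-zero k λ _ _ → refl) (sym (Σ-zero M λ _ _ → refl))
      ; covers = λ g → ≤-trans (≤-reflexive (Σ-zero M λ _ _ → refl)) z≤n
      }
    ; cases = λ j j<n → inj₂ (w≡a j j<n)
    ; unpacked = trans (Σ-cong n λ j j<n → trans (cong (1 ⊓_) (w≡a j j<n)) (m≤n⇒m⊓n≡m (a≥1 j j<n)))
                (trans (Σ-const n 1) (*-identityʳ n))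
    ; o<k   = λ j j<n w≡0 → ⊥-elim (<⇒≢ (a≥1 j j<n) (sym (trans (sym (w≡a j j<n)) w≡0)))
    ; load  = λ b b<N → trans (l≡0 b b<N) (sym (nothing o b))
    ; load₁ = λ b b<k → l≡0 b (<-≤-trans b<k k≤N)
    ; load₂ = λ b _ → nothing τ b
    ; w≤L   = λ _ _ _ _ → []
    }
    where
    nothing : ∀ σ b → binLoad n (packed w) σ b ≡ 0
    nothing σ b = Σ-zero n λ j j<n → if-zero (σ j ≡ᵇ b) (trans (cong (a j ∸_) (w≡a j j<n)) (n∸n≡0 (a j)))

  RoundInv-cong : ∀ {r w w′ l l′ o o′} → (∀ j → w′ j ≡ w j) → (∀ b → l′ b ≡ l b) → (∀ j → o′ j ≡ o j) →
                  RoundInv r w l o → RoundInv r w′ l′ o′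
  RoundInv-cong w′≡w l′≡l o′≡o I = record
    { L     = L
    ; T′    = T′
    ; sched = sched
    ; cases = λ j j<n → [ (λ z → inj₁ (trans (w′≡w j) z)) , (λ z → inj₂ (trans (w′≡w j) z)) ]′ (cases j j<n)
    ; unpacked = trans (Σ-cong n λ j _ → cong (1 ⊓_) (w′≡w j)) unpacked
    ; o<k   = λ j j<n w′≡0 → subst (_< k) (sym (o′≡o j)) (o<k j j<n (trans (sym (w′≡w j)) w′≡0))
    ; load  = λ b b<N → trans (l′≡l b) (trans (load b b<N)
                (binLoad-cong n (λ j _ → cong (a j ∸_) (sym (w′≡w j))) (λ j _ → sym (o′≡o j)) b))
    ; load₁ = λ b b<k → trans (l′≡l b) (load₁ b b<k)
    ; load₂ = λ b b<M → trans (binLoad-cong n {σ = τ} (λ j _ → cong (a j ∸_) (w′≡w j)) (λ _ _ → refl) b) (load₂ b b<M)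
    ; w≤L   = λ j b j<n b<k → subst (λ x → All (x ≤_) (L b)) (sym (w′≡w j)) (w≤L j b j<n b<k)
    }
    where open RoundInv I

  module Finish {w l o : ℕ → ℕ} (I : RoundInv 0 w l o) where
    open RoundInv I

    w≡0 : ∀ j → j < n → w j ≡ 0
    w≡0 j j<n with w j | term≤Σ n {λ j → 1 ⊓ w j} j<n
    ... | zero  | _ = refl
    ... | suc _ | p = ⊥-elim (<⇒≱ (s≤s z≤n) (≤-trans p (≤-reflexive unpacked)))

    packed≡a : ∀ j → j < n → packed w j ≡ a j
    packed≡a j j<n = cong (a j ∸_) (w≡0 j j<n)

    finish-o : ∀ j → j < n → o j < k
    finish-o j j<n = o<k j j<n (w≡0 j j<n)

    finish-load : ∀ b → b < N → l b ≡ binLoad n a o b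
    finish-load b b<N = trans (load b b<N) (binLoad-cong n {σ = o} packed≡a (λ _ _ → refl) b)

    finish-load₂ : ∀ b → b < M → sumᴸ (T′ b) ≡ binLoad n a τ b
    finish-load₂ b b<M = trans (sym (load₂ b b<M)) (binLoad-cong n {σ = τ} packed≡a (λ _ _ → refl) b)

    finish-overflow : ∀ g → Σ< k (λ b → l b ∸ g) ≤ Σ< M (λ b → binLoad n a τ b ∸ g)
    finish-overflow g = begin
      Σ< k (λ b → l b ∸ g)              ≡⟨ Σ-cong k (λ b b<k → cong (_∸ g) (load₁ b b<k)) ⟩
      Σ< k (λ b → sumᴸ (L b) ∸ g)       ≤⟨ overflow sched g ⟩
      Σ< M (λ b → sumᴸ (T′ b) ∸ g)      ≡⟨ Σ-cong M (λ b b<M → cong (_∸ g)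
                                             (finish-load₂ b b<M)) ⟩
      Σ< M (λ b → binLoad n a τ b ∸ g)  ∎
      where open ≤-Reasoning

-- The search for the number of bins

copy : ℕ → ℕ → Prog
copy a b = for 11 1 (b at # 11 ≔ a at # 11)

clear round-body rounds lpt : Prog
clear = for 11 2 (6 at # 11 ≔ lit 0)
round-body = argmax ⨾ argmin ⨾ 6 at # 15 ≔ 6 at # 15 ⊕ 5 at # 14 ⨾ 7 at # 14 ≔ # 15 ⨾ 5 at # 14 ≔ lit 0
rounds = for 12 1 round-body
lpt = copy 4 5 ⨾ clear ⨾ rounds

upd-array : ∀ s a i v j → (s [ a , i ↦ v ]) a j ≡ upd (s a) i v j
upd-array s a i v j rewrite ≡ᵇ-refl a = refl

copy-spec : ∀ a b s {n} → s 0 0 ≡ n → b ≢ a → 11 ≢ a → 11 ≢ b → ∀ j → j < n → exec (copy a b) s b j ≡ s a j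
copy-spec a b s {n} n≡ b≢a 11≢a 11≢b j j<n =
  proj₂ (for-invariant Inv 11 1 (b at # 11 ≔ a at # 11) {s} n (trans (*-identityˡ _) n≡)
    ((λ j → upd-other s 0 n j 11≢a) , λ j n≤j j<n → ⊥-elim (<⇒≱ j<n n≤j)) step) j z≤n j<n
  where
  Inv : ℕ → Store → Set
  Inv r s′ = (∀ j → s′ a j ≡ s a j) × (∀ j → r ≤ j → j < n → s′ b j ≡ s a j)
  step : ∀ r s′ → r < n → Frame (for 11 1 (b at # 11 ≔ a at # 11)) s s′ → Inv (suc r) s′ →
         Inv r (exec (b at # 11 ≔ a at # 11) (s′ [ 11 , 0 ↦ r ]))
  step r s′ r<n _ (same , done) =
    (λ j → trans (upd-other s″ r _ j b≢a) (trans (upd-other s′ 0 r j 11≢a) (same j))) ,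
    (λ j r≤j j<n → trans (upd-array s″ b r (s″ a r) j) (new j (≤-split r≤j) j<n))
    where
    s″ : Store
    s″ = s′ [ 11 , 0 ↦ r ]
    new : ∀ j → r ≡ j ⊎ suc r ≤ j → j < n → upd (s″ b) r (s″ a r) j ≡ s a j
    new j (inj₁ refl) j<n = trans (upd-at (s″ b) r _) (trans (upd-other s′ 0 r r 11≢a) (same r))
    new j (inj₂ r<j)  j<n = trans (upd-off (s″ b) r _ j (>⇒≢ r<j)) (trans (upd-other s′ 0 r j 11≢b) (done j r<j j<n))

clear-spec : ∀ s {n} → s 0 0 ≡ n → ∀ b → b < 2 * n → exec clear s 6 b ≡ 0
clear-spec s {n} refl b b<N = for-invariant Inv 11 2 (6 at # 11 ≔ lit 0) {s} (2 * n) refl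
  (λ b N≤b b<N → ⊥-elim (<⇒≱ b<N N≤b)) step b z≤n b<N
  where
  Inv : ℕ → Store → Set
  Inv r s′ = ∀ b → r ≤ b → b < 2 * n → s′ 6 b ≡ 0
  step : ∀ r s′ → r < 2 * n → Frame (for 11 2 (6 at # 11 ≔ lit 0)) s s′ → Inv (suc r) s′ →
         Inv r (exec (6 at # 11 ≔ lit 0) (s′ [ 11 , 0 ↦ r ]))
  step r s′ _ _ done b r≤b b<N with ≤-split r≤b
  ... | inj₁ refl = upd-at (s′ 6) r 0
  ... | inj₂ r<b  = trans (upd-off (s′ 6) r 0 b (>⇒≢ r<b)) (done b r<b b<N)

record Balanced (n k N : ℕ) (a l o : ℕ → ℕ) : Set where
  field
    o<k   : ∀ j → j < n → o j < k
    loads : ∀ b → b < N → l b ≡ binLoad n a o b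
    best  : ∀ {M τ e} → Rival n k M τ e → ∀ g →
            Σ< k (λ b → l b ∸ g) ≤ Σ< M (λ b → binLoad n a τ b ∸ g)

-- The invariant of the run refers to a rival. This one, with all items in one bin regardless of
-- capacity, gives access to the facts about LPT alone: the range of the bins and the loads.
trivial-rival : ∀ {n k} → 1 ≤ k → Rival n k 1 (const 0) (const 1)
trivial-rival 1≤k = record
  { τ<M = λ _ _ → s≤s z≤n ; used = λ _ _ → ≤-refl ; few = +-monoˡ-≤ 1 (*-monoʳ-≤ 2 1≤k) }

lpt-spec : ∀ s {n k} → s 0 0 ≡ n → 1 ≤ n → s 13 0 + 1 ≡ k → k ≤ 2 * n → (∀ j → j < n → 1 ≤ s 4 j) →
           Balanced n k (2 * n) (s 4) (exec lpt s 6) (exec lpt s 7)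
lpt-spec s {n} {k} refl 1≤n refl k≤2n a≥1 = record
  { o<k   = F.finish-o
  ; loads = F.finish-load
  ; best  = λ R → Rounds.Finish.finish-overflow (2 * n) a≥1 R (final R)
  }
  where
  s₁ s₂ : Store
  s₁ = exec (copy 4 5) s
  s₂ = exec clear s₁
  pres₁ : ∀ a → T (preserves a (copy 4 5)) → ∀ j → s₁ a j ≡ s a j
  pres₁ a t = preserved a (copy 4 5) t s
  pres₂ : ∀ a → T (preserves a clear) → ∀ j → s₂ a j ≡ s₁ a j
  pres₂ a t = preserved a clear t s₁
  w≡a : ∀ j → j < n → s₂ 5 j ≡ s 4 j
  w≡a j j<n = trans (pres₂ 5 _ j) (copy-spec 4 5 s refl (λ ()) (λ ()) (λ ()) j j<n)
  l≡0 : ∀ b → b < 2 * n → s₂ 6 b ≡ 0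
  l≡0 = clear-spec s₁ (pres₁ 0 _ 0)

  module _ {M : ℕ} {τ e : ℕ → ℕ} (R : Rival n k M τ e) where
    open Rounds (2 * n) {s 4} a≥1 R

    final : RoundInv 0 (exec lpt s 5) (exec lpt s 6) (exec lpt s 7)
    final = for-invariant Inv 12 1 round-body {s₂} n
      (trans (*-identityˡ _) (trans (pres₂ 0 _ 0) (pres₁ 0 _ 0)))
      (start w≡a l≡0 k≤2n) step
      where
      Inv : ℕ → Store → Set
      Inv r s′ = RoundInv r (s′ 5) (s′ 6) (s′ 7)
      step : ∀ r s′ → r < n → Frame rounds s₂ s′ → Inv (suc r) s′ →
             Inv r (exec round-body (s′ [ 12 , 0 ↦ r ]))
      step r s′ r<n fr I = round I₄ (subst (_< n) (sym (pm 14 _ 0)) i<n) max c<k min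
        where
        s₃ s₄ s₅ : Store
        s₃ = s′ [ 12 , 0 ↦ r ]
        s₄ = exec argmax s₃
        s₅ = exec argmin s₄
        px : ∀ a → T (preserves a argmax) → ∀ j → s₄ a j ≡ s₃ a j
        px a t = preserved a argmax t s₃
        pm : ∀ a → T (preserves a argmin) → ∀ j → s₅ a j ≡ s₄ a j
        pm a t = preserved a argmin t s₄
        n₃ : s₃ 0 0 ≡ n
        n₃ = trans (fr 0 _ 0) (trans (pres₂ 0 _ 0) (pres₁ 0 _ 0))
        k₄ : s₄ 13 0 + 1 ≡ k
        k₄ = cong (_+ 1) (trans (px 13 _ 0) (trans (fr 13 _ 0) (trans (pres₂ 13 _ 0) (pres₁ 13 _ 0))))
        i<n : s₄ 14 0 < n
        i<n = proj₁ (argmax-spec s₃ n₃ 1≤n)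
        I₄ : RoundInv (suc r) (s₅ 5) (s₅ 6) (s₅ 7)
        I₄ = RoundInv-cong (λ j → trans (pm 5 _ j) (px 5 _ j)) (λ j → trans (pm 6 _ j) (px 6 _ j))
               (λ j → trans (pm 7 _ j) (px 7 _ j)) I
        max : ∀ j → j < n → s₅ 5 j ≤ s₅ 5 (s₅ 14 0)
        max j j<n rewrite pm 14 _ 0 | pm 5 _ j | pm 5 _ (s₄ 14 0) | px 5 _ j | px 5 _ (s₄ 14 0) =
          proj₂ (argmax-spec s₃ n₃ 1≤n) j j<n
        c<k : s₅ 15 0 < k
        c<k = proj₁ (argmin-spec s₄ (trans (px 0 _ 0) n₃) k₄ k≤2n)
        min : ∀ b → b < k → s₅ 6 (s₅ 15 0) ≤ s₅ 6 b
        min b b<k rewrite pm 6 _ b | pm 6 _ (s₅ 15 0) =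
          proj₂ (argmin-spec s₄ (trans (px 0 _ 0) n₃) k₄ k≤2n) b b<k

  module F = Rounds.Finish (2 * n) a≥1 (trivial-rival (m≤n+m 1 (s 13 0))) (final (trivial-rival (m≤n+m 1 (s 13 0))))

tally-body tally : Prog
tally-body = 16 at lit 0 ≔ # 16 ⊕ (6 at # 11 ⊖ # 9) ⨾ 17 at lit 0 ≔ # 17 ⊕ (6 at # 11 ⊖ # 8)
tally = 16 at lit 0 ≔ lit 0 ⨾ 17 at lit 0 ≔ lit 0 ⨾ for 11 2 tally-body

tally-spec : ∀ s {n} → s 0 0 ≡ n →
  exec tally s 16 0 ≡ Σ< (2 * n) (λ b → s 6 b ∸ s 9 0) × exec tally s 17 0 ≡ Σ< (2 * n) (λ b → s 6 b ∸ s 8 0)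
tally-spec s {n} refl =
  let p , q = for-invariant Inv 11 2 tally-body {s₁} (2 * n) refl (refl , refl) step
  in trans (sym (+-identityʳ _)) p , trans (sym (+-identityʳ _)) q
  where
  s₁ : Store
  s₁ = s [ 16 , 0 ↦ 0 ] [ 17 , 0 ↦ 0 ]
  over : ℕ → ℕ → ℕ
  over g b = s 6 b ∸ g
  Inv : ℕ → Store → Set
  Inv r s′ = s′ 16 0 + Σ< r (over (s 9 0)) ≡ Σ< (2 * n) (over (s 9 0)) ×
             s′ 17 0 + Σ< r (over (s 8 0)) ≡ Σ< (2 * n) (over (s 8 0))
  shift : ∀ x y g r → y ≡ over g r → x + Σ< (suc r) (over g) ≡ Σ< (2 * n) (over g) →
          (x + y) + Σ< r (over g) ≡ Σ< (2 * n) (over g)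
  shift x y g r refl eq = trans (trans (+-assoc x y _) (cong (x +_) (trans (+-comm y _) (sym (Σ-last r (over g)))))) eq
  step : ∀ r s′ → r < 2 * n → Frame (for 11 2 tally-body) s₁ s′ → Inv (suc r) s′ →
         Inv r (exec tally-body (s′ [ 11 , 0 ↦ r ]))
  step r s′ _ fr (p , q) =
    shift (s′ 16 0) _ (s 9 0) r (cong₂ _∸_ (fr 6 _ r) (fr 9 _ 0)) p ,
    shift (s′ 17 0) _ (s 8 0) r (cong₂ _∸_ (fr 6 _ r) (fr 8 _ 0)) q

-- The product of k and D * den β would have two factors, k and D, outside the input, which is not
-- `linear`. It is therefore maintained by subtracting D * den β whenever k decreases.
try search : Expr → Prog
try cost = 19 at lit 0 ≔ # 19 ⊖ # 8 ⊗ 0 at lit 2 ⨾ lpt ⨾ tally ⨾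
  ifnz (# 18 ⊖ cost) (ifnz (# 17) skip (18 at lit 0 ≔ cost ⨾ copy 7 3)) skip
search cost = for 13 2 (try cost)

over : (ℕ → ℕ) → ℕ → ℕ → ℕ
over l g b = l b ∸ g

record Found (n : ℕ) (a : ℕ → ℕ) (D g : ℕ) (f : ℕ → ℕ → ℕ) (c : ℕ) (o : ℕ → ℕ) : Set where
  field
    k    : ℕ
    o<k  : ∀ j → j < n → o j < k
    fits : Σ< k (over (binLoad n a o) D) ≡ 0
    cost : f k (Σ< k (over (binLoad n a o) g)) ≡ c

Found-cong : ∀ {n a D g f c c′ o o′} → c ≡ c′ → (∀ j → j < n → o j ≡ o′ j) →
             Found n a D g f c o → Found n a D g f c′ o′
Found-cong {n} {a} {D} {g} {f} {o = o} {o′} refl h F = record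
  { k    = k
  ; o<k  = λ j j<n → subst (_< k) (h j j<n) (o<k j j<n)
  ; fits = trans (same D) fits
  ; cost = trans (cong (f k) (same g)) cost
  }
  where
  open Found F
  same : ∀ g → Σ< k (over (binLoad n a o′) g) ≡ Σ< k (over (binLoad n a o) g)
  same g = Σ-cong k λ b _ → cong (_∸ g) (binLoad-cong n {a} (λ _ _ → refl) (λ j j<n → sym (h j j<n)) b)

-- The rival is charged for its own overflow but for the k bins of LPT instead of its own number of
-- bins; the loss of the factor 3/2 is accounted for later.
LowerBound : (n : ℕ) (a : ℕ → ℕ) (D g : ℕ) (f : ℕ → ℕ → ℕ) (c k : ℕ) → Set
LowerBound n a D g f c k = ∀ {M τ e} → Rival n k M τ e →
  Σ< M (over (binLoad n a τ) D) ≡ 0 → c ≤ f k (Σ< M (over (binLoad n a τ) g))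

record CostExpr (s₀ : Store) (e : Expr) : Set where
  field
    f      : ℕ → ℕ → ℕ
    mono   : ∀ k {V V′} → V ≤ V′ → f k V ≤ f k V′
    value  : ∀ s k → (∀ j → s 0 j ≡ s₀ 0 j) → s 8 0 ≡ s₀ 8 0 → s 13 0 + 1 ≡ k →
             s 19 0 ≡ k * (s₀ 8 0 * s₀ 0 2) → ⟦ e ⟧ s ≡ f k (s 16 0)

module _ {ce : Expr} {s₀ : Store} (C : CostExpr s₀ ce) {n : ℕ} (n≡ : s₀ 0 0 ≡ n) (1≤n : 1 ≤ n)
         (a≥1 : ∀ j → j < n → 1 ≤ s₀ 4 j) (K≡ : s₀ 19 0 ≡ suc (2 * n) * (s₀ 8 0 * s₀ 0 2)) where
  open CostExpr C

  private
    D g T₀ : ℕ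
    D  = s₀ 8 0
    g  = s₀ 9 0
    T₀ = s₀ 18 0
    a : ℕ → ℕ
    a = s₀ 4

  record SearchInv (r : ℕ) (s : Store) : Set where
    field
      K     : s 19 0 ≡ suc r * (D * s₀ 0 2)
      found : s 18 0 ≡ T₀ ⊎ Found n a D g f (s 18 0) (s 3)
      lower : ∀ k → r < k → k ≤ 2 * n → LowerBound n a D g f (s 18 0) k

  search-invariant : SearchInv 0 (exec (search ce) s₀)
  search-invariant = for-invariant SearchInv 13 2 (try ce) {s₀} (2 * n) (cong (2 *_) n≡)
    (record { K = K≡ ; found = inj₁ refl ; lower = λ k N<k k≤N → ⊥-elim (<⇒≱ N<k k≤N) }) step
    where
    step : ∀ r s → r < 2 * n → Frame (search ce) s₀ s → SearchInv (suc r) s →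
           SearchInv r (exec (try ce) (s [ 13 , 0 ↦ r ]))
    step r s r<N fr I = branch-elim (SearchInv r) (s₃ 18 0 ∸ ⟦ ce ⟧ s₃) (branch (s₃ 17 0) s₃ s₄) s₃
      (λ ≢0 → branch-elim (SearchInv r) (s₃ 17 0) s₃ s₄
        (λ viol≢0 → record
          { K = K₃
          ; found = found₃
          -- If LPT exceeds the capacity on k bins, then so does every rival for k, by the overflow
          -- inequality with threshold D; the lower bound for k is vacuous.
          ; lower = lower-by λ R fits → ⊥-elim (viol≢0 (n≤0⇒n≡0 (begin
              s₃ 17 0                     ≡⟨ viol≡ ⟩
              Σ< k (over l D)             ≤⟨ best R D ⟩
              _                           ≡⟨ fits ⟩
              0                           ∎)))
          })
        (λ viol≡0 → record
          { K = trans (pc 19 _ 0) K₃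
          ; found = inj₂ (Found-cong (sym (pc 18 _ 0))
              (λ j j<n → sym (copy-spec 7 3 s₃′ n₃ (λ ()) (λ ()) (λ ()) j j<n)) (record
              { k = k
              ; o<k = λ j j<n → subst (_< k) (sym (pt 7 _ j)) (o<k j j<n)
              ; fits = trans (sym (trans viol≡ (same D))) viol≡0
              ; cost = sym (trans cost≡ (cong (f k) (same g)))
              }))
          ; lower = λ k′ r<k′ k′≤N R fits → ≤-trans (≤-reflexive (pc 18 _ 0))
              (improve k′ r<k′ k′≤N (≰⇒> (≢0 ∘ m≤n⇒m∸n≡0)) R fits)
          }))
      (λ ≡0 → record
        { K = K₃
        ; found = found₃
        ; lower = lower-by λ R fits → ≤-trans (m∸n≡0⇒m≤n ≡0) (cost-best R fits)
        })
      where
      open ≤-Reasoning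
      open SearchInv I
      k : ℕ
      k = suc r
      s₁ s₂ s₃ s₃′ s₄ : Store
      s₁ = exec (19 at lit 0 ≔ # 19 ⊖ # 8 ⊗ 0 at lit 2) (s [ 13 , 0 ↦ r ])
      s₂ = exec lpt s₁
      s₃ = exec tally s₂
      s₃′ = s₃ [ 18 , 0 ↦ ⟦ ce ⟧ s₃ ]
      s₄ = exec (copy 7 3) s₃′
      pl : ∀ a → T (preserves a lpt) → ∀ j → s₂ a j ≡ s₁ a j
      pl a t = preserved a lpt t s₁
      pt : ∀ a → T (preserves a tally) → ∀ j → s₃ a j ≡ s₂ a j
      pt a t = preserved a tally t s₂
      pc : ∀ a → T (preserves a (copy 7 3)) → ∀ j → s₄ a j ≡ s₃′ a j
      pc a t = preserved a (copy 7 3) t s₃′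
      l : ℕ → ℕ
      l = s₂ 6
      n₁ : s₁ 0 0 ≡ n
      n₁ = trans (fr 0 _ 0) n≡
      n₃ : s₃′ 0 0 ≡ n
      n₃ = trans (pt 0 _ 0) (trans (pl 0 _ 0) n₁)
      balanced : Balanced n k (2 * n) (s 4) (s₂ 6) (s₂ 7)
      balanced = lpt-spec s₁ {n} {k} n₁ 1≤n (+-comm r 1) r<N
        (λ j j<n → subst (1 ≤_) (sym (fr 4 _ j)) (a≥1 j j<n))
      open Balanced balanced using (o<k)
      same-a : ∀ σ b → binLoad n (s 4) σ b ≡ binLoad n a σ b
      same-a σ = binLoad-cong n {σ = σ} (λ j _ → fr 4 _ j) (λ _ _ → refl)
      loads : ∀ b → b < 2 * n → l b ≡ binLoad n a (s₂ 7) b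
      loads b b<N = trans (Balanced.loads balanced b b<N) (same-a (s₂ 7) b)
      best : ∀ {M τ e} → Rival n k M τ e → ∀ g → Σ< k (over l g) ≤ Σ< M (over (binLoad n a τ) g)
      best {M} {τ} R g = ≤-trans (Balanced.best balanced R g)
        (≤-reflexive (Σ-cong M λ b _ → cong (_∸ g) (same-a τ b)))
      same : ∀ g → Σ< k (over l g) ≡ Σ< k (over (binLoad n a (s₃ 7)) g)
      same g = Σ-cong k λ b b<k → cong (_∸ g) (trans (loads b (<-≤-trans b<k r<N))
        (binLoad-cong n {a} (λ _ _ → refl) (λ j _ → sym (pt 7 _ j)) b))
      total : ∀ g g′ → g′ ≡ g → Σ< (2 * n) (λ b → s₂ 6 b ∸ g′) ≡ Σ< k (over l g)
      total g _ refl = Σ-extend r<N λ b k≤b b<N → trans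
        (cong (_∸ g) (trans (loads b b<N)
          (binLoad-none n {a} {s₂ 7} λ j j<n → <⇒≢ (<-≤-trans (o<k j j<n) k≤b))))
        (0∸n≡0 g)
      tallied : s₃ 16 0 ≡ Σ< (2 * n) (λ b → s₂ 6 b ∸ s₂ 9 0) × s₃ 17 0 ≡ Σ< (2 * n) (λ b → s₂ 6 b ∸ s₂ 8 0)
      tallied = tally-spec s₂ (trans (pl 0 _ 0) n₁)
      viol≡ : s₃ 17 0 ≡ Σ< k (over l D)
      viol≡ = trans (proj₂ tallied) (total D _ (trans (pl 8 _ 0) (fr 8 _ 0)))
      K₃ : s₃ 19 0 ≡ suc r * (D * s₀ 0 2)
      K₃ = trans (pt 19 _ 0) (trans (pl 19 _ 0) (trans
        (cong₂ _∸_ K (cong₂ _*_ (fr 8 _ 0) (fr 0 _ 2)))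
        (m+n∸m≡n (D * s₀ 0 2) (suc r * (D * s₀ 0 2)))))
      cost≡ : ⟦ ce ⟧ s₃ ≡ f k (Σ< k (over l g))
      cost≡ = trans (value s₃ k (λ j → trans (pt 0 _ j) (trans (pl 0 _ j) (fr 0 _ j)))
                (trans (pt 8 _ 0) (trans (pl 8 _ 0) (fr 8 _ 0)))
                (trans (cong (_+ 1) (trans (pt 13 _ 0) (pl 13 _ 0))) (+-comm r 1)) K₃)
        (cong (f k) (trans (proj₁ tallied) (total g _ (trans (pl 9 _ 0) (fr 9 _ 0)))))
      T₃ : s₃ 18 0 ≡ s 18 0
      T₃ = trans (pt 18 _ 0) (pl 18 _ 0)
      found₃ : s₃ 18 0 ≡ T₀ ⊎ Found n a D g f (s₃ 18 0) (s₃ 3)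
      found₃ = [ (λ eq → inj₁ (trans T₃ eq))
               , (λ F → inj₂ (Found-cong (sym T₃) (λ j _ → sym (trans (pt 3 _ j) (pl 3 _ j))) F)) ]′ found
      cost-best : LowerBound n a D g f (⟦ ce ⟧ s₃) k
      cost-best R fits = ≤-trans (≤-reflexive cost≡) (mono k (best R g))
      lower₃ : ∀ k′ → k < k′ → k′ ≤ 2 * n → LowerBound n a D g f (s₃ 18 0) k′
      lower₃ k′ k<k′ k′≤N R fits = ≤-trans (≤-reflexive T₃) (lower k′ k<k′ k′≤N R fits)
      lower-by : LowerBound n a D g f (s₃ 18 0) k → ∀ k′ → r < k′ → k′ ≤ 2 * n → LowerBound n a D g f (s₃ 18 0) k′
      lower-by h k′ k≤k′ k′≤N with ≤-split k≤k′
      ... | inj₁ refl = h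
      ... | inj₂ k<k′ = lower₃ k′ k<k′ k′≤N
      improve : ∀ k′ → r < k′ → k′ ≤ 2 * n → ⟦ ce ⟧ s₃ < s₃ 18 0 → LowerBound n a D g f (⟦ ce ⟧ s₃) k′
      improve k′ k≤k′ k′≤N lt R fits with ≤-split k≤k′
      ... | inj₁ refl = cost-best R fits
      ... | inj₂ k<k′ = ≤-trans (<⇒≤ lt) (lower₃ k′ k<k′ k′≤N R fits)

-- Scaling to integers

-- The common denominator is the product of den G and all den s_j, whose length is polynomial. Round
-- r multiplies everything scaled so far by den s_r. Size r itself becomes num s_r times the old D,
-- which is s_r times the new one.
multiply scale prepare : Prog
multiply = for 11 1 (4 at # 11 ≔ 4 at # 11 ⊗ 2 at # 10)
scale = multiply ⨾ 4 at # 10 ≔ # 8 ⊗ 1 at # 10 ⨾ 8 at lit 0 ≔ # 8 ⊗ 2 at # 10 ⨾ 9 at lit 0 ≔ # 9 ⊗ 2 at # 10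
prepare = 8 at lit 0 ≔ 0 at lit 4 ⨾ 9 at lit 0 ≔ 0 at lit 3 ⨾ for 10 1 scale

multiply-spec : ∀ s {n} → s 0 0 ≡ n → ∀ j → j < n → exec multiply s 4 j ≡ s 4 j * s 2 (s 10 0)
multiply-spec s {n} n≡ j j<n = proj₂ (for-invariant Inv 11 1 body {s} n (trans (*-identityˡ _) n≡)
  ((λ j _ → refl) , (λ j n≤j j<n → ⊥-elim (<⇒≱ j<n n≤j))) step) j z≤n j<n
  where
  body : Prog
  body = 4 at # 11 ≔ 4 at # 11 ⊗ 2 at # 10
  Inv : ℕ → Store → Set
  Inv r s′ = (∀ j → j < r → s′ 4 j ≡ s 4 j) × (∀ j → r ≤ j → j < n → s′ 4 j ≡ s 4 j * s 2 (s 10 0))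
  step : ∀ r s′ → r < n → Frame (for 11 1 body) s s′ → Inv (suc r) s′ → Inv r (exec body (s′ [ 11 , 0 ↦ r ]))
  step r s′ r<n fr (todo , done) =
    (λ j j<r → trans (upd-off (s′ 4) r v j (<⇒≢ j<r)) (todo j (m≤n⇒m≤1+n j<r))) ,
    (λ j r≤j j<n → new j (≤-split r≤j) j<n)
    where
    v : ℕ
    v = s′ 4 r * s′ 2 (s′ 10 0)
    v≡ : v ≡ s 4 r * s 2 (s 10 0)
    v≡ = cong₂ _*_ (todo r (n<1+n r)) (trans (fr 2 _ (s′ 10 0)) (cong (s 2) (fr 10 _ 0)))
    new : ∀ j → r ≡ j ⊎ suc r ≤ j → j < n → upd (s′ 4) r v j ≡ s 4 j * s 2 (s 10 0)
    new j (inj₁ refl) _   = trans (upd-at (s′ 4) r v) v≡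
    new j (inj₂ r<j)  j<n = trans (upd-off (s′ 4) r v j (>⇒≢ r<j)) (done j r<j j<n)

record Scaled (s₀ : Store) (n : ℕ) (a : ℕ → ℕ) (D g : ℕ) : Set where
  field
    a-scaled : ∀ j → j < n → a j * s₀ 2 j ≡ s₀ 1 j * D
    g-scaled : g * s₀ 0 4 ≡ s₀ 0 3 * D
    D≥1      : 1 ≤ D

prepare-spec : ∀ s {n} → s 0 0 ≡ n → 1 ≤ s 0 4 → (∀ j → j < n → 1 ≤ s 2 j) →
               Scaled s n (exec prepare s 4) (exec prepare s 8 0) (exec prepare s 9 0)
prepare-spec s {n} n≡ 1≤gd 1≤den =
  let p , q , r = for-invariant Inv 10 1 scale {s₁} n (trans (*-identityˡ _) n≡)
                    ((λ j n≤j j<n → ⊥-elim (<⇒≱ j<n n≤j)) , refl , 1≤gd) step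
  in record { a-scaled = λ j → p j z≤n ; g-scaled = q ; D≥1 = r }
  where
  s₁ : Store
  s₁ = s [ 8 , 0 ↦ s 0 4 ] [ 9 , 0 ↦ s 0 3 ]
  Inv : ℕ → Store → Set
  Inv r s′ = (∀ j → r ≤ j → j < n → s′ 4 j * s 2 j ≡ s 1 j * s′ 8 0) ×
             s′ 9 0 * s 0 4 ≡ s 0 3 * s′ 8 0 × 1 ≤ s′ 8 0
  step : ∀ r s′ → r < n → Frame (for 10 1 scale) s₁ s′ → Inv (suc r) s′ → Inv r (exec scale (s′ [ 10 , 0 ↦ r ]))
  step r s′ r<n fr (A , G , P) = (λ j r≤j j<n → new j (≤-split r≤j) j<n) ,
    trans (cong (λ x → x * c * s 0 4) (pm 9 _ 0)) (trans (swap (s′ 9 0) c (s 0 4)) (trans (cong (_* c) G) (trans (*-assoc (s 0 3) _ c) (cong (λ x → s 0 3 * (x * c)) (sym (pm 8 _ 0)))))) ,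
    *-mono-≤ (subst (1 ≤_) (sym (pm 8 _ 0)) P) (subst (1 ≤_) (sym c≡) (1≤den r r<n))
    where
    s₂ s₃ : Store
    s₂ = s′ [ 10 , 0 ↦ r ]
    s₃ = exec multiply s₂
    pm : ∀ a → T (preserves a multiply) → ∀ j → s₃ a j ≡ s₂ a j
    pm a t = preserved a multiply t s₂
    c : ℕ
    c = s₃ 2 (s₃ 10 0)
    c≡ : c ≡ s 2 r
    c≡ = trans (pm 2 _ _) (trans (fr 2 _ _) (cong (s 2) (pm 10 _ 0)))
    swap : ∀ x y z → x * y * z ≡ x * z * y
    swap = solve-∀
    swap′ : ∀ x y z → x * y * z ≡ y * (x * z)
    swap′ = solve-∀
    x : ℕ
    x = s₃ 8 0 * s₃ 1 (s₃ 10 0)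
    new : ∀ j → r ≡ j ⊎ suc r ≤ j → j < n → upd (s₃ 4) (s₃ 10 0) x j * s 2 j ≡ s 1 j * (s₃ 8 0 * c)
    new j (inj₁ refl) j<n rewrite pm 10 _ 0 | upd-at (s₃ 4) r (s₃ 8 0 * s₃ 1 r) | pm 2 _ r | fr 2 _ r | pm 1 _ r | fr 1 _ r =
      swap′ (s₃ 8 0) (s 1 r) (s 2 r)
    new j (inj₂ r<j) j<n = begin
      upd (s₃ 4) (s₃ 10 0) x j * s 2 j ≡⟨ cong (_* s 2 j) (upd-off (s₃ 4) (s₃ 10 0) x j (λ j≡ → >⇒≢ r<j (trans j≡ (pm 10 _ 0)))) ⟩
      s₃ 4 j * s 2 j                  ≡⟨ cong (_* s 2 j) (multiply-spec s₂ (trans (fr 0 _ 0) n≡) j j<n) ⟩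
      s′ 4 j * s′ 2 r * s 2 j          ≡⟨ swap (s′ 4 j) (s′ 2 r) (s 2 j) ⟩
      s′ 4 j * s 2 j * s′ 2 r          ≡⟨ cong₂ _*_ (A j r<j j<n) (trans (fr 2 _ r) (sym c≡)) ⟩
      s 1 j * s′ 8 0 * c               ≡⟨ *-assoc (s 1 j) _ c ⟩
      s 1 j * (s′ 8 0 * c)             ≡⟨ cong (λ d → s 1 j * (d * c)) (pm 8 _ 0) ⟨
      s 1 j * (s₃ 8 0 * c)             ∎
      where open ≡-Reasoning

-- The complete program and what it finds.

K-init : Prog
K-init = 19 at lit 0 ≔ # 8 ⊗ (0 at lit 2 ⊗ (lit 2 ⊗ # 0 ⊕ lit 1))

init program : Expr → Expr → Prog
init ce te = (prepare ⨾ K-init) ⨾ 18 at lit 0 ≔ te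
program ce te = init ce te ⨾ search ce

three-halves : ℕ → ℕ
three-halves m = m + ⌊ m /2⌋

-- Rounding down loses at most one half of a bin, which the summand 1 compensates.
3m≤2k+1 : ∀ m → 3 * m ≤ 2 * three-halves m + 1
3m≤2k+1 m = begin
  3 * m                                ≡⟨ e₁ m ⟩
  2 * m + m                            ≡⟨ cong (2 * m +_) (⌊n/2⌋+⌈n/2⌉≡n m) ⟨
  2 * m + (⌊ m /2⌋ + ⌈ m /2⌉)          ≤⟨ +-monoʳ-≤ (2 * m) (+-monoʳ-≤ ⌊ m /2⌋ (⌊n/2⌋-mono (n≤1+n (suc m)))) ⟩
  2 * m + (⌊ m /2⌋ + suc ⌊ m /2⌋)      ≡⟨ e₂ m ⌊ m /2⌋ ⟩
  2 * (m + ⌊ m /2⌋) + 1                ∎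
  where
  open ≤-Reasoning
  e₁ : ∀ m → 3 * m ≡ 2 * m + m
  e₁ = solve-∀
  e₂ : ∀ m h → 2 * m + (h + suc h) ≡ 2 * (m + h) + 1
  e₂ = solve-∀

2k≤3m : ∀ m → 2 * three-halves m ≤ 3 * m
2k≤3m m = begin
  2 * (m + ⌊ m /2⌋)               ≡⟨ e₁ m ⌊ m /2⌋ ⟩
  2 * m + (⌊ m /2⌋ + ⌊ m /2⌋)     ≤⟨ +-monoʳ-≤ (2 * m) (+-monoʳ-≤ ⌊ m /2⌋ (⌊n/2⌋≤⌈n/2⌉ m)) ⟩
  2 * m + (⌊ m /2⌋ + ⌈ m /2⌉)     ≡⟨ cong (2 * m +_) (⌊n/2⌋+⌈n/2⌉≡n m) ⟩
  2 * m + m                       ≡⟨ e₂ m ⟩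
  3 * m                           ∎
  where
  open ≤-Reasoning
  e₁ : ∀ m h → 2 * (m + h) ≡ 2 * m + (h + h)
  e₁ = solve-∀
  e₂ : ∀ m → 2 * m + m ≡ 3 * m
  e₂ = solve-∀

three-halves≤ : ∀ {m n} → m ≤ n → three-halves m ≤ 2 * n
three-halves≤ {m} {n} m≤n = +-mono-≤ m≤n (≤-trans (⌊n/2⌋≤n m) (≤-trans m≤n (≤-reflexive (sym (+-identityʳ n)))))

binLoad-id : ∀ n a b → b < n → binLoad n a id b ≡ a b
binLoad-id n a b b<n = trans (sym (trans (cong (_+ a b) (sym (Σ-zero n (λ _ _ → refl))))
  (Σ-at n {f = const 0} b<n (λ j _ j≢b → sym (cong (if_then a j else 0) (≢⇒≡ᵇ j b j≢b)))
    (sym (cong (if_then a b else 0) (≡ᵇ-refl b)))))) refl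

-- One item per bin is always within capacity. This rival shows that the search improves on its
-- initial cost and hence writes an output.
singletons : ∀ {n} → Rival n (three-halves n) n id (const 1)
singletons {n} = record
  { τ<M = λ _ j<n → j<n ; used = λ _ _ → ≤-refl
  ; few = ≤-trans (≤-reflexive (cong (3 *_) (trans (Σ-const n 1) (*-identityʳ n)))) (3m≤2k+1 n) }

-- The program works for every pair of expressions for the cost of a packing and
-- for the initial cost, where the cost is a monotone function of the number k of
-- bins and the total overflow.
record CostModel (s₀ : Store) (n : ℕ) (ce te : Expr) : Set where
  field
    f     : ℕ → ℕ → ℕ → ℕ
    start : ℕ → ℕ
    mono  : ∀ D k {V V′} → V ≤ V′ → f D k V ≤ f D k V′
    value : ∀ s D k → (∀ j → s 0 j ≡ s₀ 0 j) → s 8 0 ≡ D → s 13 0 + 1 ≡ k →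
            s 19 0 ≡ k * (D * s₀ 0 2) → ⟦ ce ⟧ s ≡ f D k (s 16 0)
    start-value : ∀ s D → (∀ j → s 0 j ≡ s₀ 0 j) → s 8 0 ≡ D →
                  s 19 0 ≡ suc (2 * n) * (D * s₀ 0 2) → ⟦ te ⟧ s ≡ start D

-- The output array is written only when a packing within capacity beats the initial cost. The
-- premise of `result`, about one item per bin charged for `three-halves n` bins, guarantees that
-- this happens.
record Solved (s₀ : Store) (n : ℕ) (f : ℕ → ℕ → ℕ → ℕ) (start : ℕ → ℕ) (o : ℕ → ℕ) : Set where
  field
    a      : ℕ → ℕ
    D g    : ℕ
    scaled : Scaled s₀ n a D g
    a≤D    : ∀ j → j < n → a j ≤ D
    result : f D (three-halves n) (Σ< n (over a g)) < start D →
             ∃[ c ] c < start D × Found n a D g (f D) c o ×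
             (∀ k → 0 < k → k ≤ 2 * n → LowerBound n a D g (f D) c k)

module Solve (s₀ : Store) {n : ℕ} (n≡ : s₀ 0 0 ≡ n) (1≤n : 1 ≤ n) (1≤gd : 1 ≤ s₀ 0 4)
  (1≤den : ∀ j → j < n → 1 ≤ s₀ 2 j) (1≤num : ∀ j → j < n → 1 ≤ s₀ 1 j)
  (num≤den : ∀ j → j < n → s₀ 1 j ≤ s₀ 2 j) (ce te : Expr) where

  s₁ : Store
  s₁ = exec (init ce te) s₀

  a : ℕ → ℕ
  a = s₁ 4

  D g : ℕ
  D = s₁ 8 0
  g = s₁ 9 0

  scaled : Scaled s₀ n a D g
  scaled = prepare-spec s₀ n≡ 1≤gd 1≤den
  open Scaled scaled

  s₀-kept : ∀ j → s₁ 0 j ≡ s₀ 0 j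
  s₀-kept = preserved 0 prepare tt s₀

  a≥1 : ∀ j → j < n → 1 ≤ a j
  a≥1 j j<n = n≢0⇒n>0 λ a≡0 → <⇒≢ (*-mono-≤ (1≤num j j<n) D≥1)
    (sym (trans (sym (a-scaled j j<n)) (cong (_* s₀ 2 j) a≡0)))

  a≤D : ∀ j → j < n → a j ≤ D
  a≤D j j<n with s₀ 2 j | 1≤den j j<n | a-scaled j j<n | num≤den j j<n
  ... | suc d | _ | eq | le = *-cancelʳ-≤ (a j) D (suc d) (begin
    a j * suc d     ≡⟨ eq ⟩
    s₀ 1 j * D      ≤⟨ *-monoˡ-≤ D le ⟩
    suc d * D       ≡⟨ *-comm (suc d) D ⟩
    D * suc d       ∎)
    where open ≤-Reasoning

  K≡ : s₁ 19 0 ≡ suc (2 * n) * (D * s₁ 0 2)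
  K≡ = begin
    D′ * (s 0 2 * (2 * s 0 0 + 1))  ≡⟨ cong₂ (λ x y → D′ * (x * (2 * y + 1))) (s₀-kept 2) (trans (s₀-kept 0) n≡) ⟩
    D′ * (s₀ 0 2 * (2 * n + 1))     ≡⟨ lem D′ (s₀ 0 2) n ⟩
    suc (2 * n) * (D′ * s₀ 0 2)     ≡⟨ cong (λ x → suc (2 * n) * (D′ * x)) (s₀-kept 2) ⟨
    suc (2 * n) * (D′ * s 0 2)      ∎
    where
    open ≡-Reasoning
    s : Store
    s = exec prepare s₀
    D′ : ℕ
    D′ = s 8 0
    lem : ∀ D b n → D * (b * (2 * n + 1)) ≡ suc (2 * n) * (D * b)
    lem = solve-∀

  module _ (C : CostModel s₀ n ce te) where
    open CostModel C

    s₂ : Store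
    s₂ = exec (search ce) s₁

    K≡′ : s₁ 19 0 ≡ suc (2 * n) * (D * s₀ 0 2)
    K≡′ = trans K≡ (cong (λ b → suc (2 * n) * (D * b)) (s₀-kept 2))

    cost : CostExpr s₁ ce
    cost = record
      { f     = f D
      ; mono  = mono D
      ; value = λ s k kept D≡ k≡ K≡ → value s D k (λ j → trans (kept j) (s₀-kept j)) D≡ k≡
                  (trans K≡ (cong (λ b → k * (D * b)) (s₀-kept 2)))
      }

    final : SearchInv cost (trans (s₀-kept 0) n≡) 1≤n a≥1 K≡ 0 s₂
    final = search-invariant cost (trans (s₀-kept 0) n≡) 1≤n a≥1 K≡
    open SearchInv final using (found; lower)

    start≡ : s₁ 18 0 ≡ start D
    start≡ = start-value (exec (prepare ⨾ K-init) s₀) D s₀-kept refl K≡′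

    solved : Solved s₀ n (f) start (s₂ 3)
    solved = record { a = a ; D = D ; g = g ; scaled = scaled ; a≤D = a≤D ; result = result }
      where
      loads : ∀ g → Σ< n (over (binLoad n a id) g) ≡ Σ< n (over a g)
      loads g = Σ-cong n λ b b<n → cong (_∸ g) (binLoad-id n a b b<n)
      result : f D (three-halves n) (Σ< n (over a g)) < start D →
               ∃[ c ] c < start D × Found n a D g (f D) c (s₂ 3) ×
               (∀ k → 0 < k → k ≤ 2 * n → LowerBound n a D g (f D) c k)
      result lt = s₂ 18 0 , subst (s₂ 18 0 <_) start≡ c<T ,
        [ (λ c≡T → ⊥-elim (<⇒≢ c<T c≡T)) , id ]′ found , lower
        where
        c<T : s₂ 18 0 < s₁ 18 0
        c<T = ≤-<-trans (lower (three-halves n) (≤-trans 1≤n (m≤m+n n _)) (three-halves≤ {n} ≤-refl) singletons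
          (trans (loads D) (Σ-zero n λ b b<n → m≤n⇒m∸n≡0 (a≤D b b<n))))
          (<-≤-trans (≤-<-trans (≤-reflexive (cong (f D (three-halves n)) (loads g))) lt) (≤-reflexive (sym start≡)))

-- Rational and scaled quantities

-- Abstract, so that arguments of ι can be inferred.
abstract
  ι : ℕ → ℚ
  ι = ℕ→ℚ

  ι≡ℕ→ℚ : ∀ k → ι k ≡ ℕ→ℚ k
  ι≡ℕ→ℚ k = refl

  ι-0 : ι 0 ≡ 0ℚ
  ι-0 = refl

  ι-mk : ∀ k → ι k ≡ mkℚ (ℤ.+ k) 0 (coprime-sym (1-coprimeTo k))
  ι-mk k = ℚₚ.normalize-coprime (coprime-sym (1-coprimeTo k))

  ι-+ : ∀ a b → ι (a + b) ≡ ι a ℚ.+ ι b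
  ι-+ a b rewrite ι-mk a | ι-mk b = cong (ℚ._/ 1) (sym (cong₂ ℤ._+_ (ℤₚ.*-identityʳ (ℤ.+ a)) (ℤₚ.*-identityʳ (ℤ.+ b))))

  ι-* : ∀ a b → ι (a * b) ≡ ι a ℚ.* ι b
  ι-* a b rewrite ι-mk a | ι-mk b = cong (ℚ._/ 1) (ℤₚ.pos-* a b)

  ι-mono : ∀ {a b} → a ≤ b → ι a ℚ.≤ ι b
  ι-mono {a} {b} a≤b rewrite ι-mk a | ι-mk b = ℚ.*≤* (ℤₚ.*-monoʳ-≤-nonNeg (ℤ.+ 1) (ℤ.+≤+ a≤b))

  ι-cancel : ∀ {a b} → ι a ℚ.≤ ι b → a ≤ b
  ι-cancel {a} {b} h with subst₂ ℚ._≤_ (ι-mk a) (ι-mk b) h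
  ... | ℚ.*≤* p = ℤₚ.drop‿+≤+ (subst₂ ℤ._≤_ (ℤₚ.*-identityʳ (ℤ.+ a)) (ℤₚ.*-identityʳ (ℤ.+ b)) p)

  ι≥0 : ∀ k → ℚ.NonNegative (ι k)
  ι≥0 k = ℚₚ.normalize-nonNeg k 1

  ι>0 : ∀ {k} → 1 ≤ k → ℚ.Positive (ι k)
  ι>0 {suc k} _ = ℚₚ.normalize-pos (suc k) 1

num/den : ∀ {q} → 0ℚ ℚ.≤ q → q ℚ.* ι (den q) ≡ ι (num q)
num/den {q@(mkℚ (ℤ.+ k) d _)} _ rewrite ι-mk (suc d) | ι-mk k = ℚₚ.toℚᵘ-injective (begin
  toℚᵘ (q ℚ.* whole (suc d))                  ≈⟨ ℚₚ.toℚᵘ-homo-* q (whole (suc d)) ⟩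
  mkℚᵘ (ℤ.+ k) d ℚᵘ.* mkℚᵘ (ℤ.+ suc d) 0          ≈⟨ *≡* (trans (ℤₚ.*-identityʳ (ℤ.+ k ℤ.* ℤ.+ suc d))
                                                   (cong (λ x → ℤ.+ k ℤ.* ℤ.+ x) (sym (*-identityʳ (suc d))))) ⟩
  mkℚᵘ (ℤ.+ k) 0                                ∎)
  where
  open ℚᵘₚ.≃-Reasoning
  whole : ℕ → ℚ
  whole k = mkℚ (ℤ.+ k) 0 (coprime-sym (1-coprimeTo k))
num/den {mkℚ ℤ.-[1+ k ] d c} (ℚ.*≤* ())

num≤den : ∀ {q} → 0ℚ ℚ.≤ q → q ℚ.≤ 1ℚ → num q ≤ den q
num≤den {q} q≥0 q≤1 = ι-cancel (subst₂ ℚ._≤_ (num/den q≥0) (ℚₚ.*-identityˡ (ι (den q)))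
  (ℚₚ.*-monoʳ-≤-nonNeg (ι (den q)) {{ι≥0 (den q)}} q≤1))

num≥1 : ∀ {q} → 0ℚ ℚ.< q → 1 ≤ num q
num≥1 {q} q>0 = n≢0⇒n>0 λ num≡0 → ℚₚ.<-irrefl refl (ℚₚ.<-≤-trans q>0 (ℚₚ.*-cancelʳ-≤-pos (ι (den q)) {{ι>0 (s≤s z≤n)}}
  (ℚₚ.≤-reflexive (trans (num/den (ℚₚ.<⇒≤ q>0)) (trans (cong ι num≡0) (trans ι-0 (sym (ℚₚ.*-zeroˡ (ι (den q))))))))))

∑-ι : ∀ {m} {x : Fin m → ℚ} {X : Fin m → ℕ} {c} → (∀ j → x j ℚ.* c ≡ ι (X j)) → ∑ℚ x ℚ.* c ≡ ι (∑ℕ X)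
∑-ι {zero}          {c = c} h = trans (ℚₚ.*-zeroˡ c) (sym ι-0)
∑-ι {suc m} {x} {X} {c} h = trans (ℚₚ.*-distribʳ-+ c (x zero) _)
  (trans (cong₂ ℚ._+_ (h zero) (∑-ι (h ∘ suc))) (sym (ι-+ (X zero) _)))

ext : ∀ {n} → (Fin n → ℕ) → ℕ → ℕ
ext {zero}  h j       = 0
ext {suc n} h zero    = h zero
ext {suc n} h (suc j) = ext (h ∘ suc) j

ext-toℕ : ∀ {n} (h : Fin n → ℕ) i → ext h (toℕ i) ≡ h i
ext-toℕ h zero    = refl
ext-toℕ h (suc i) = ext-toℕ (h ∘ suc) i

ext-elim : ∀ {n} (P : ℕ → Set) {h : Fin n → ℕ} → P 0 → (∀ i → P (h i)) → ∀ j → P (ext h j)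
ext-elim {zero}  P p0 p j       = p0
ext-elim {suc n} P p0 p zero    = p zero
ext-elim {suc n} P p0 p (suc j) = ext-elim P p0 (p ∘ suc) j

ext-< : ∀ {n} (P : ℕ → Set) {h : Fin n → ℕ} → (∀ i → P (h i)) → ∀ j → j < n → P (ext h j)
ext-< P p zero    (s≤s _)   = p zero
ext-< P p (suc j) (s≤s j<n) = ext-< P (p ∘ suc) j j<n

select≡ext : ∀ {n} (h : Fin n → ℕ) j → ∑ℕ (λ i → if toℕ i ≡ᵇ j then h i else 0) ≡ ext h j
select≡ext {zero}  h j       = refl
select≡ext {suc n} h zero    = trans (cong (h zero +_) (Σ-zero n λ _ _ → refl)) (+-identityʳ _)
select≡ext {suc n} h (suc j) = select≡ext (h ∘ suc) j

does-≟ : ∀ {m} (i j : Fin m) → does (i ≟ᶠ j) ≡ (toℕ i ≡ᵇ toℕ j)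
does-≟ i j with i ≟ᶠ j
... | yes refl = sym (≡ᵇ-refl (toℕ i))
... | no i≢j   = sym (≢⇒≡ᵇ (toℕ i) (toℕ j) (i≢j ∘ toℕ-injective))

∑-mono : ∀ {k} {f g : Fin k → ℕ} → (∀ i → f i ≤ g i) → ∑ℕ f ≤ ∑ℕ g
∑-mono {zero}  h = z≤n
∑-mono {suc k} h = +-mono-≤ (h zero) (∑-mono (h ∘ suc))

term≤∑ : ∀ {k} (f : Fin k → ℕ) i → f i ≤ ∑ℕ f
term≤∑ f zero    = m≤m+n _ _
term≤∑ f (suc i) = ≤-trans (term≤∑ (f ∘ suc) i) (m≤n+m _ (f zero))

indicator : Bool → ℕ
indicator b = if b then 1 else 0

count-tabulate : ∀ {n} {A : Set} {P : A → Set} (P? : Decidable P) (h : Fin n → A) →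
                 count P? (tabulate h) ≡ ∑ℕ (λ i → indicator (does (P? (h i))))
count-tabulate {zero}  P? h = refl
count-tabulate {suc n} P? h with does (P? (h zero))
... | true  = cong suc (count-tabulate P? (h ∘ suc))
... | false = count-tabulate P? (h ∘ suc)

∑≥0 : ∀ {m} {x : Fin m → ℚ} → (∀ j → 0ℚ ℚ.≤ x j) → 0ℚ ℚ.≤ ∑ℚ x
∑≥0 {zero}  h = ℚₚ.≤-refl
∑≥0 {suc m} h = ℚₚ.+-mono-≤ (h zero) (∑≥0 (h ∘ suc))

module _ {x y : ℚ} {X Y A B : ℕ} (x≡ : x ℚ.* ι A ≡ ι X) (y≡ : y ℚ.* ι B ≡ ι Y) (A≥1 : 1 ≤ A) (B≥1 : 1 ≤ B) where

  private
    x′ : x ℚ.* ι (A * B) ≡ ι (X * B)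
    x′ = trans (cong (x ℚ.*_) (ι-* A B)) (trans (sym (ℚₚ.*-assoc x (ι A) (ι B)))
      (trans (cong (ℚ._* ι B) x≡) (sym (ι-* X B))))
    y′ : y ℚ.* ι (A * B) ≡ ι (Y * A)
    y′ = trans (cong (y ℚ.*_) (trans (cong ι (*-comm A B)) (ι-* B A))) (trans (sym (ℚₚ.*-assoc y (ι B) (ι A)))
      (trans (cong (ℚ._* ι A) y≡) (sym (ι-* Y A))))

  cross-≤ : X * B ≤ Y * A → x ℚ.≤ y
  cross-≤ h = ℚₚ.*-cancelʳ-≤-pos (ι (A * B)) {{ι>0 (*-mono-≤ A≥1 B≥1)}}
    (subst₂ ℚ._≤_ (sym x′) (sym y′) (ι-mono h))

  cross-≤⁻¹ : x ℚ.≤ y → X * B ≤ Y * A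
  cross-≤⁻¹ h = ι-cancel (subst₂ ℚ._≤_ x′ y′ (ℚₚ.*-monoʳ-≤-nonNeg (ι (A * B)) {{ι≥0 (A * B)}} h))

three-halves-≤ : ∀ x y {X Y A} → x ℚ.* ι A ≡ ι X → y ℚ.* ι A ≡ ι Y → 1 ≤ A → 2 * X ≤ 3 * Y →
                 x ℚ.≤ (ℤ.+ 3 ℚ./ 2) ℚ.* y
three-halves-≤ x y {X} {Y} {A} x≡ y≡ A≥1 h = cross-≤ {x} {r ℚ.* y} {X} {3 * Y} {A} {2 * A} x≡ scaled A≥1 (*-mono-≤ {1} {2} (s≤s z≤n) A≥1)
  (≤-trans (≤-reflexive (e₁ X A)) (*-monoˡ-≤ A h))
  where
  open ≡-Reasoning
  e₁ : ∀ X A → X * (2 * A) ≡ 2 * X * A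
  e₁ = solve-∀
  r : ℚ
  r = ℤ.+ 3 ℚ./ 2
  ι3 : r ℚ.* ι 2 ≡ ι 3
  ι3 = trans (cong (r ℚ.*_) (ι≡ℕ→ℚ 2)) (sym (ι≡ℕ→ℚ 3))
  scaled : r ℚ.* y ℚ.* ι (2 * A) ≡ ι (3 * Y)
  scaled = begin
    r ℚ.* y ℚ.* ι (2 * A)           ≡⟨ cong (r ℚ.* y ℚ.*_) (ι-* 2 A) ⟩
    r ℚ.* y ℚ.* (ι 2 ℚ.* ι A)       ≡⟨ cong (ℚ._* (ι 2 ℚ.* ι A)) (ℚₚ.*-comm r y) ⟩
    y ℚ.* r ℚ.* (ι 2 ℚ.* ι A)       ≡⟨ ℚₚ.*-assoc (y ℚ.* r) (ι 2) (ι A) ⟨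
    y ℚ.* r ℚ.* ι 2 ℚ.* ι A         ≡⟨ cong (ℚ._* ι A) (trans (ℚₚ.*-assoc y r (ι 2)) (cong (y ℚ.*_) ι3)) ⟩
    y ℚ.* ι 3 ℚ.* ι A               ≡⟨ cong (ℚ._* ι A) (ℚₚ.*-comm y (ι 3)) ⟩
    ι 3 ℚ.* y ℚ.* ι A               ≡⟨ trans (ℚₚ.*-assoc (ι 3) y (ι A)) (cong (ι 3 ℚ.*_) y≡) ⟩
    ι 3 ℚ.* ι Y                     ≡⟨ ι-* 3 Y ⟨
    ι (3 * Y)                       ∎

-- Packings and energies of rational items in scaled integers.

module Bridge (I : Items) {a : ℕ → ℕ} {D g : ℕ} (D≥1 : 1 ≤ D)
  (a-scaled : ∀ i → a (toℕ i) * den (Items.s I i) ≡ num (Items.s I i) * D)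
  (g-scaled : g * den (Items.G I) ≡ num (Items.G I) * D) where
  open Items I

  scaled-≡ : ∀ {q X} → 0ℚ ℚ.≤ q → X * den q ≡ num q * D → q ℚ.* ι D ≡ ι X
  scaled-≡ {q} {X} q≥0 eq = ℚₚ.≤-antisym (cancel (ℚₚ.≤-reflexive same)) (cancel (ℚₚ.≤-reflexive (sym same)))
    where
    open ≡-Reasoning
    cancel : ∀ {x y} → x ℚ.* ι (den q) ℚ.≤ y ℚ.* ι (den q) → x ℚ.≤ y
    cancel = ℚₚ.*-cancelʳ-≤-pos (ι (den q)) {{ι>0 (s≤s z≤n)}}
    same : q ℚ.* ι D ℚ.* ι (den q) ≡ ι X ℚ.* ι (den q)
    same = begin
      q ℚ.* ι D ℚ.* ι (den q)   ≡⟨ ℚₚ.*-assoc q (ι D) _ ⟩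
      q ℚ.* (ι D ℚ.* ι (den q)) ≡⟨ cong (q ℚ.*_) (ℚₚ.*-comm (ι D) _) ⟩
      q ℚ.* (ι (den q) ℚ.* ι D) ≡⟨ ℚₚ.*-assoc q _ (ι D) ⟨
      q ℚ.* ι (den q) ℚ.* ι D   ≡⟨ cong (ℚ._* ι D) (num/den q≥0) ⟩
      ι (num q) ℚ.* ι D         ≡⟨ ι-* (num q) D ⟨
      ι (num q * D)             ≡⟨ cong ι eq ⟨
      ι (X * den q)             ≡⟨ ι-* X (den q) ⟩
      ι X ℚ.* ι (den q)         ∎

  -- A common denominator of all energies: loads and G are multiples of 1/D, and β is a multiple of
  -- 1/den β.
  K : ℕ
  K = D * den β

  K≥1 : 1 ≤ K
  K≥1 = *-mono-≤ D≥1 (s≤s (z≤n {↧ₙ β ∸ 1}))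

  bins : ∀ {m} → (Fin n → Fin m) → ℕ → ℕ
  bins σ = ext (toℕ ∘ σ)

  s-scaled : ∀ i → s i ℚ.* ι D ≡ ι (a (toℕ i))
  s-scaled i = scaled-≡ (ℚₚ.<⇒≤ (s>0 i)) (a-scaled i)

  load-scaled : ∀ {m} (σ : Fin n → Fin m) j → load σ j ℚ.* ι D ≡ ι (binLoad n a (bins σ) (toℕ j))
  load-scaled σ j = ∑-ι λ i → trans (choose i)
    (cong (λ b → ι (if b then a (toℕ i) else 0))
      (trans (does-≟ (σ i) j) (cong (_≡ᵇ toℕ j) (sym (ext-toℕ (toℕ ∘ σ) i)))))
    where
    choose : ∀ i → (if does (σ i ≟ᶠ j) then s i else 0ℚ) ℚ.* ι D ≡ ι (if does (σ i ≟ᶠ j) then a (toℕ i) else 0)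
    choose i with does (σ i ≟ᶠ j)
    ... | true  = s-scaled i
    ... | false = trans (ℚₚ.*-zeroˡ (ι D)) (sym ι-0)

  -- Since β ≥ 0, the positive part in f becomes truncated subtraction of natural numbers.
  f-scaled : ∀ x {X} → x ℚ.* ι D ≡ ι X → f x ℚ.* ι K ≡ ι (num β * (X ∸ g))
  f-scaled x {X} x≡ = begin
    (0ℚ ℚ.⊔ (β ℚ.* (x ℚ.- G))) ℚ.* ι K          ≡⟨ ℚₚ.*-distribʳ-⊔-nonNeg (ι K) {{ι≥0 K}} 0ℚ (β ℚ.* (x ℚ.- G)) ⟩
    (0ℚ ℚ.* ι K) ℚ.⊔ (β ℚ.* (x ℚ.- G) ℚ.* ι K)  ≡⟨ cong₂ ℚ._⊔_ (ℚₚ.*-zeroˡ (ι K)) product ⟩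
    0ℚ ℚ.⊔ (ι B ℚ.* (ι X ℚ.- ι g))              ≡⟨ positive-part ⟩
    ι (B * (X ∸ g))                             ∎
    where
    open ≡-Reasoning
    B : ℕ
    B = num β
    difference : (x ℚ.- G) ℚ.* ι D ≡ ι X ℚ.- ι g
    difference = trans (ℚₚ.*-distribʳ-+ (ι D) x (ℚ.- G))
      (cong₂ ℚ._+_ x≡ (trans (sym (ℚₚ.neg-distribˡ-* G (ι D))) (cong ℚ.-_ (scaled-≡ G≥0 g-scaled))))
    product : β ℚ.* (x ℚ.- G) ℚ.* ι K ≡ ι B ℚ.* (ι X ℚ.- ι g)
    product = begin
      β ℚ.* y ℚ.* ι (D * den β)           ≡⟨ cong (β ℚ.* y ℚ.*_) (trans (ι-* D (den β)) (ℚₚ.*-comm (ι D) _)) ⟩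
      β ℚ.* y ℚ.* (ι (den β) ℚ.* ι D)     ≡⟨ ℚₚ.*-assoc β y _ ⟩
      β ℚ.* (y ℚ.* (ι (den β) ℚ.* ι D))   ≡⟨ cong (β ℚ.*_) (trans (sym (ℚₚ.*-assoc y (ι (den β)) (ι D)))
                                               (trans (cong (ℚ._* ι D) (ℚₚ.*-comm y (ι (den β)))) (ℚₚ.*-assoc (ι (den β)) y (ι D)))) ⟩
      β ℚ.* (ι (den β) ℚ.* (y ℚ.* ι D))   ≡⟨ ℚₚ.*-assoc β _ _ ⟨
      β ℚ.* ι (den β) ℚ.* (y ℚ.* ι D)     ≡⟨ cong₂ ℚ._*_ (num/den β≥0) difference ⟩
      ι B ℚ.* (ι X ℚ.- ι g)               ∎
      where
      y : ℚ
      y = x ℚ.- G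
    positive-part : 0ℚ ℚ.⊔ (ι B ℚ.* (ι X ℚ.- ι g)) ≡ ι (B * (X ∸ g))
    positive-part with ≤-total X g
    ... | inj₁ X≤g rewrite m≤n⇒m∸n≡0 X≤g | *-zeroʳ B | ι-0 = ℚₚ.p≥q⇒p⊔q≡p
      (ℚₚ.≤-trans (ℚₚ.*-monoˡ-≤-nonNeg (ι B) {{ι≥0 B}}
        (ℚₚ.≤-trans (ℚₚ.+-monoˡ-≤ (ℚ.- ι g) (ι-mono X≤g)) (ℚₚ.≤-reflexive (ℚₚ.+-inverseʳ (ι g)))))
        (ℚₚ.≤-reflexive (ℚₚ.*-zeroʳ (ι B))))
    ... | inj₂ g≤X = trans (cong (λ z → 0ℚ ℚ.⊔ (ι B ℚ.* z)) (begin
        ι X ℚ.- ι g                     ≡⟨ cong (λ z → ι z ℚ.- ι g) (m∸n+n≡m g≤X) ⟨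
        ι (X ∸ g + g) ℚ.- ι g           ≡⟨ cong (ℚ._- ι g) (ι-+ (X ∸ g) g) ⟩
        ι (X ∸ g) ℚ.+ ι g ℚ.- ι g       ≡⟨ ℚₚ.+-assoc (ι (X ∸ g)) (ι g) _ ⟩
        ι (X ∸ g) ℚ.+ (ι g ℚ.- ι g)     ≡⟨ cong (ι (X ∸ g) ℚ.+_) (ℚₚ.+-inverseʳ (ι g)) ⟩
        ι (X ∸ g) ℚ.+ 0ℚ                ≡⟨ ℚₚ.+-identityʳ _ ⟩
        ι (X ∸ g)                       ∎))
      (trans (cong (0ℚ ℚ.⊔_) (sym (ι-* B (X ∸ g)))) (ℚₚ.p≤q⇒p⊔q≡q (subst (ℚ._≤ ι (B * (X ∸ g))) ι-0 (ι-mono z≤n))))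

  excess : ∀ {m} → (Fin n → Fin m) → ℕ → ℕ
  excess {m} σ c = Σ< m (over (binLoad n a (bins σ)) c)

  E-scaled : ∀ {m} (σ : Fin n → Fin m) → ∑ℚ (λ j → f (load σ j)) ℚ.* ι K ≡ ι (num β * excess σ g)
  E-scaled {m} σ = trans (∑-ι λ j → f-scaled (load σ j) (load-scaled σ j))
    (cong ι (Σ-*ˡ m (num β) (over (binLoad n a (bins σ)) g)))

  alone-scaled : ∑ℚ (λ i → f (s i)) ℚ.* ι K ≡ ι (num β * Σ< n (over a g))
  alone-scaled = trans (∑-ι λ i → f-scaled (s i) (s-scaled i)) (cong ι (Σ-*ˡ n (num β) (over a g)))

  fits : ∀ {m} (σ : Fin n → Fin m) → (∀ j → load σ j ℚ.≤ 1ℚ) → excess σ D ≡ 0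
  fits {m} σ h = Σ-zero m λ j j<m → m≤n⇒m∸n≡0 (ι-cancel
    (subst (λ b → ι (binLoad n a (bins σ) b) ℚ.≤ ι D) (toℕ-fromℕ< j<m)
      (subst₂ ℚ._≤_ (load-scaled σ (fromℕ< j<m)) (ℚₚ.*-identityˡ (ι D))
        (ℚₚ.*-monoʳ-≤-nonNeg (ι D) {{ι≥0 D}} (h (fromℕ< j<m))))))

  fits⁻¹ : ∀ {m} (σ : Fin n → Fin m) → excess σ D ≡ 0 → ∀ j → load σ j ℚ.≤ 1ℚ
  fits⁻¹ {m} σ h j = ℚₚ.*-cancelʳ-≤-pos (ι D) {{ι>0 D≥1}}
    (subst₂ ℚ._≤_ (sym (load-scaled σ j)) (sym (ℚₚ.*-identityˡ (ι D)))
      (ι-mono (m∸n≡0⇒m≤n (n≤0⇒n≡0 (≤-trans (term≤Σ m {over (binLoad n a (bins σ)) D} (toℕ<n j)) (≤-reflexive h))))))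

  module _ (σ : Packing I) where
    open Packing σ

    inUse : ℕ → ℕ
    inUse = ext (λ j → indicator (does (any? (λ i → assign i ≟ᶠ j))))

    b≡ΣinUse : b ≡ Σ< m inUse
    b≡ΣinUse = trans (count-tabulate (λ j → any? (λ i → assign i ≟ᶠ j)) id)
      (sum-cong-≗ {m} λ j → sym (ext-toℕ _ j))

    inUse-assign : ∀ i → inUse (toℕ (assign i)) ≡ 1
    inUse-assign i = trans (ext-toℕ _ (assign i))
      (cong indicator (dec-true (any? (λ i′ → assign i′ ≟ᶠ assign i)) (i , refl)))

    bins-< : ∀ (P : ℕ → Set) → (∀ i → P (toℕ (assign i))) → ∀ j → j < n → P (bins assign j)
    bins-< P h = ext-< P h

    -- A packing may declare empty bins, so `m` can be far larger than `b`. The marks `inUse` make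
    -- the condition one on `b`.
    rival : ∀ {k} → 3 * b ≤ 2 * k + 1 → Rival n k m (bins assign) inUse
    rival few = record
      { τ<M  = bins-< (_< m) (λ i → toℕ<n (assign i))
      ; used = bins-< (λ j → 1 ≤ inUse j) (λ i → ≤-reflexive (sym (inUse-assign i)))
      ; few  = subst (λ b → 3 * b ≤ _) b≡ΣinUse few
      }

    b≥1 : 1 ≤ n → 1 ≤ b
    b≥1 1≤n = subst (1 ≤_) (sym b≡ΣinUse) (≤-trans (≤-reflexive (sym (inUse-assign (fromℕ< 1≤n))))
      (term≤Σ m {inUse} (toℕ<n (assign (fromℕ< 1≤n)))))

    -- Incidences of items and bins are counted twice: a used bin meets at least one item, an item
    -- exactly one bin.
    b≤n : b ≤ n
    b≤n = begin
      b                                                           ≡⟨ count-tabulate (λ j → any? (λ i → assign i ≟ᶠ j)) id ⟩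
      ∑ℕ (λ j → indicator (does (any? (λ i → assign i ≟ᶠ j))))     ≤⟨ ∑-mono (λ j → hit j) ⟩
      ∑ℕ (λ j → ∑ℕ (λ i → indicator (does (assign i ≟ᶠ j))))       ≡⟨ ∑-comm (λ j i → indicator (does (assign i ≟ᶠ j))) ⟩
      ∑ℕ (λ i → ∑ℕ (λ j → indicator (does (assign i ≟ᶠ j))))       ≡⟨ sum-cong-≗ (λ i → once (assign i)) ⟩
      Σ< n (const 1)                                              ≡⟨ trans (Σ-const n 1) (*-identityʳ n) ⟩
      n                                                           ∎
      where
      open ≤-Reasoning
      hit : ∀ j → indicator (does (any? (λ i → assign i ≟ᶠ j))) ≤ ∑ℕ (λ i → indicator (does (assign i ≟ᶠ j)))
      hit j with any? (λ i → assign i ≟ᶠ j)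
      ... | no _        = z≤n
      ... | yes (i , p) = ≤-trans (≤-reflexive (cong indicator (sym (dec-true (assign i ≟ᶠ j) p))))
        (term≤∑ (λ i → indicator (does (assign i ≟ᶠ j))) i)
      flip-≟ : ∀ {k} (i j : Fin k) → does (i ≟ᶠ j) ≡ (toℕ j ≡ᵇ toℕ i)
      flip-≟ i j with i ≟ᶠ j
      ... | yes refl = sym (≡ᵇ-refl (toℕ i))
      ... | no i≢j   = sym (≢⇒≡ᵇ (toℕ j) (toℕ i) (i≢j ∘ sym ∘ toℕ-injective))
      once : ∀ {k} (i : Fin k) → ∑ℕ (λ j → indicator (does (i ≟ᶠ j))) ≡ 1
      once {k} i = trans (sum-cong-≗ (λ j → cong indicator (flip-≟ i j)))
        (trans (select≡ext {k} (const 1) (toℕ i)) (ext-toℕ {k} (const 1) i))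

-- The approximation guarantees

module _ (I : Items) where
  open Items I

  n≤itemsSize : n ≤ itemsSize I
  n≤itemsSize = begin
    n                                 ≡⟨ trans (Σ-const n 1) (*-identityʳ n) ⟨
    Σ< n (const 1)                    ≤⟨ ∑-mono {n} (λ i → ≤-trans (s≤s z≤n) (m≤m+n (bits (num (s i))) _)) ⟩
    ∑ℕ (λ i → bitsℚ (s i))            ≤⟨ m≤n+m _ (bits n + bitsℚ β + bitsℚ G) ⟩
    itemsSize I                       ∎
    where open ≤-Reasoning

  module _ {U : ℚ} {Z : ℕ} (size≤Z : itemsSize I ≤ Z) (numU : num U < 2 ^ Z) (denU : den U < 2 ^ Z) where

    memory-small : Small Z (memory I U)
    memory-small = go
      where
      fit : ∀ k → bits k ≤ itemsSize I → k < 2 ^ Z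
      fit k h = <-≤-trans (k<2^bits k) (2^-mono (≤-trans h size≤Z))
      0<2^Z : 0 < 2 ^ Z
      0<2^Z = m^n>0 2 Z
      item≤ : ∀ i → bitsℚ (s i) ≤ itemsSize I
      item≤ i = ≤-trans (term≤∑ (λ i → bitsℚ (s i)) i) (m≤n+m _ (bits n + bitsℚ β + bitsℚ G))
      β≤ : bitsℚ β ≤ itemsSize I
      β≤ = ≤-trans (m≤n+m (bitsℚ β) (bits n)) (≤-trans (m≤m+n _ (bitsℚ G)) (m≤m+n _ _))
      G≤ : bitsℚ G ≤ itemsSize I
      G≤ = ≤-trans (m≤n+m (bitsℚ G) (bits n + bitsℚ β)) (m≤m+n _ _)
      go : Small Z (memory I U)
      go 0 0 = fit n (≤-trans (m≤m+n (bits n) (bitsℚ β)) (≤-trans (m≤m+n _ (bitsℚ G)) (m≤m+n _ _)))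
      go 0 1 = fit (num β) (≤-trans (m≤m+n _ _) β≤)
      go 0 2 = fit (den β) (≤-trans (m≤n+m _ (bits (num β))) β≤)
      go 0 3 = fit (num G) (≤-trans (m≤m+n _ _) G≤)
      go 0 4 = fit (den G) (≤-trans (m≤n+m _ (bits (num G))) G≤)
      go 0 5 = numU
      go 0 6 = denU
      go 0 (suc (suc (suc (suc (suc (suc (suc _))))))) = 0<2^Z
      go 1 j = subst (_< 2 ^ Z) (sym (select≡ext (λ i → num (s i)) j)) (ext-elim (_< 2 ^ Z) 0<2^Z
        (λ i → fit (num (s i)) (≤-trans (m≤m+n _ _) (item≤ i))) j)
      go 2 j = subst (_< 2 ^ Z) (sym (select≡ext (λ i → den (s i)) j)) (ext-elim (_< 2 ^ Z) 0<2^Z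
        (λ i → fit (den (s i)) (≤-trans (m≤n+m _ (bits (num (s i)))) (item≤ i))) j)
      go (suc (suc (suc _))) _ = 0<2^Z

    memory-input : Input Z (memory I U)
    memory-input = record { small = λ a i _ → memory-small a i ; n≤Z = ≤-trans n≤itemsSize size≤Z }

  1≤itemsSize : 1 ≤ itemsSize I
  1≤itemsSize = s≤s z≤n

  noItems : n ≡ 0 → Packing I
  noItems n≡0 = record { m = 0 ; assign = λ i → ⊥-elim (none i) ; load≤1 = λ () }
    where
    none : Fin n → ⊥
    none i = n≮0 (subst (toℕ i <_) n≡0 (toℕ<n i))

module _ {I : Items} (σ : Packing I) where
  open Items I
  open Packing σ

  E≥0 : 0ℚ ℚ.≤ E
  E≥0 = ∑≥0 λ j → ℚₚ.p≤p⊔q 0ℚ (β ℚ.* (load assign j ℚ.- G))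

  b≥0 : 0ℚ ℚ.≤ ℕ→ℚ b
  b≥0 = subst₂ ℚ._≤_ ι-0 (ι≡ℕ→ℚ b) (ι-mono z≤n)

0≤3/2* : ∀ {x} → 0ℚ ℚ.≤ x → 0ℚ ℚ.≤ (ℤ.+ 3 ℚ./ 2) ℚ.* x
0≤3/2* = ℚₚ.*-monoˡ-≤-nonNeg (ℤ.+ 3 ℚ./ 2)

module _ (I : Items) (U : ℚ) where
  open Items I

  stored : ∀ (P : ℕ → ℕ → Set) → (∀ i → P (num (s i)) (den (s i))) →
           ∀ j → j < n → P (memory I U 1 j) (memory I U 2 j)
  stored P h j j<n = subst (λ j → P (memory I U 1 j) (memory I U 2 j)) (toℕ-fromℕ< j<n)
    (subst₂ P (sym (pick (λ i → num (s i)))) (sym (pick (λ i → den (s i)))) (h i))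
    where
    i : Fin n
    i = fromℕ< j<n
    pick : ∀ h → ∑ℕ (λ i′ → if toℕ i′ ≡ᵇ toℕ i then h i′ else 0) ≡ h i
    pick h = trans (select≡ext h (toℕ i)) (ext-toℕ h i)

  solve : 1 ≤ n → ∀ ce te (C : CostModel (memory I U) n ce te) →
          Solved (memory I U) n (CostModel.f C) (CostModel.start C) (exec (program ce te) (memory I U) 3)
  solve 1≤n ce te C = Solve.solved (memory I U) refl 1≤n (s≤s z≤n)
    (stored (λ _ d → 1 ≤ d) (λ i → s≤s z≤n))
    (stored (λ k _ → 1 ≤ k) (λ i → num≥1 (s>0 i)))
    (stored _≤_ (λ i → num≤den (ℚₚ.<⇒≤ (s>0 i)) (s≤1 i))) ce te C

module Run (I : Items) (U : ℚ) (1≤n : 1 ≤ Items.n I) {a : ℕ → ℕ} {D g : ℕ}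
           (scaled : Scaled (memory I U) (Items.n I) a D g) where
  open Items I

  a-scaled : ∀ i → a (toℕ i) * den (s i) ≡ num (s i) * D
  a-scaled i = subst₂ (λ k d → a (toℕ i) * d ≡ k * D) (pick (λ i → num (s i))) (pick (λ i → den (s i)))
    (Scaled.a-scaled scaled (toℕ i) (toℕ<n i))
    where
    pick : ∀ h → ∑ℕ (λ i′ → if toℕ i′ ≡ᵇ toℕ i then h i′ else 0) ≡ h i
    pick h = trans (select≡ext h (toℕ i)) (ext-toℕ h i)

  open Bridge I {a} {D} {g} (Scaled.D≥1 scaled) a-scaled (Scaled.g-scaled scaled) public

  -- From 1 ≤ b ≤ n it follows that `three-halves b` is among the numbers of bins that the search
  -- has tried.
  bounded : ∀ f {c} → (∀ k → 0 < k → k ≤ 2 * n → LowerBound n a D g f c k) →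
            (τ : Packing I) → c ≤ f (three-halves (Packing.b τ)) (excess (Packing.assign τ) g)
  bounded f lower τ = lower (three-halves b) (≤-trans (b≥1 τ 1≤n) (m≤m+n b _)) (three-halves≤ (b≤n τ))
    (rival τ (3m≤2k+1 b)) (fits assign load≤1)
    where open Packing τ

  module Output {f : ℕ → ℕ → ℕ} {c : ℕ} {o : ℕ → ℕ} (F : Found n a D g f c o) where
    open Found F renaming (fits to fitsᵒ) public

    assign : Fin n → Fin k
    assign i = fromℕ< (o<k (toℕ i) (toℕ<n i))

    bins≡o : ∀ j → j < n → bins assign j ≡ o j
    bins≡o j j<n = subst (λ j → bins assign j ≡ o j) (toℕ-fromℕ< j<n)
      (trans (ext-toℕ (toℕ ∘ assign) (fromℕ< j<n)) (toℕ-fromℕ< _))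

    excess≡ : ∀ g → excess assign g ≡ Σ< k (over (binLoad n a o) g)
    excess≡ g = Σ-cong k λ b _ → cong (_∸ g) (binLoad-cong n {a} (λ _ _ → refl) bins≡o b)

    packing : Packing I
    packing = record { m = k ; assign = assign ; load≤1 = fits⁻¹ assign (trans (excess≡ D) fitsᵒ) }

    b≤k : Packing.b packing ≤ k
    b≤k = count≤n (λ j → any? (λ i → assign i ≟ᶠ j)) (allFin k)

    encodes : ∀ i → o (toℕ i) ≡ toℕ (assign i)
    encodes i = sym (toℕ-fromℕ< _)

-- The cost is k + E for GBP, scaled by D * den β. For CGBP it is k plus 2n + 1
-- times the scaled excess of E over U, so that it is less than the initial cost
-- 2n + 1 only if E ≤ U.
ce₁ te₁ ce₂ te₂ : Expr
ce₁ = # 19 ⊕ # 16 ⊗ 0 at lit 1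
te₁ = # 19 ⊕ # 8 ⊗ (# 0 ⊗ 0 at lit 1)
ce₂ = # 13 ⊕ lit 1 ⊕ (# 16 ⊗ (0 at lit 1 ⊗ 0 at lit 6) ⊖ # 8 ⊗ (0 at lit 2 ⊗ 0 at lit 5)) ⊗ (lit 2 ⊗ # 0 ⊕ lit 1)
te₂ = lit 2 ⊗ # 0 ⊕ lit 1

module _ (I : Items) where
  open Items I hiding (f)

  model₁ : CostModel (memory I 0ℚ) n ce₁ te₁
  model₁ = record
    { f     = λ D k V → k * (D * den β) + V * num β
    ; start = λ D → suc (2 * n) * (D * den β) + D * (n * num β)
    ; mono  = λ D k V≤V′ → +-monoʳ-≤ _ (*-monoˡ-≤ (num β) V≤V′)
    ; value = λ s D k kept _ _ K≡ → cong₂ _+_ K≡ (cong (s 16 0 *_) (kept 1))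
    ; start-value = λ s D kept D≡ K≡ → cong₂ _+_ K≡ (cong₂ _*_ D≡ (cong₂ _*_ (kept 0) (kept 1)))
    }

module GBP-run (I : Items) (1≤n : 1 ≤ Items.n I) {o : ℕ → ℕ}
  (S : Solved (memory I 0ℚ) (Items.n I) (CostModel.f (model₁ I)) (CostModel.start (model₁ I)) o) where
  open Items I hiding (f)
  open Solved S
  open Run I 0ℚ 1≤n scaled

  f : ℕ → ℕ → ℕ
  f = CostModel.f (model₁ I) D

  f-value : ∀ k V → f k V ≡ k * K + num β * V
  f-value k V = cong (k * K +_) (*-comm V (num β))

  -- The origin of `te₁`: one item per bin is charged for at most 2n < 2n + 1 bins, and its overflow
  -- is at most n D, since no scaled size exceeds D.
  start : f (three-halves n) (Σ< n (over a g)) < CostModel.start (model₁ I) D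
  start = begin-strict
    f (three-halves n) V              ≡⟨ f-value (three-halves n) V ⟩
    three-halves n * K + num β * V    <⟨ +-mono-<-≤ (*-monoˡ-< K {{>-nonZero K≥1}} (s≤s (three-halves≤ {n} ≤-refl)))
                                          (*-monoʳ-≤ (num β) V≤) ⟩
    suc (2 * n) * K + num β * (n * D) ≡⟨ cong (suc (2 * n) * K +_) (lem (num β) n D) ⟨
    suc (2 * n) * K + D * (n * num β) ∎
    where
    open ≤-Reasoning
    V : ℕ
    V = Σ< n (over a g)
    V≤ : V ≤ n * D
    V≤ = ≤-trans (Σ-mono n (λ j j<n → ≤-trans (m∸n≤m (a j) g) (a≤D j j<n))) (≤-reflexive (Σ-const n D))
    lem : ∀ b n D → D * (n * b) ≡ b * (n * D)
    lem = solve-∀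

  value-scaled : (τ : Packing I) →
                 (ℕ→ℚ (Packing.b τ) ℚ.+ Packing.E τ) ℚ.* ι K
                 ≡ ι (Packing.b τ * K + num β * excess (Packing.assign τ) g)
  value-scaled τ = trans (ℚₚ.*-distribʳ-+ (ι K) (ℕ→ℚ b) E)
    (trans (cong₂ ℚ._+_ (trans (cong (ℚ._* ι K) (sym (ι≡ℕ→ℚ b))) (sym (ι-* b K))) (E-scaled assign))
           (sym (ι-+ (b * K) _)))
    where open Packing τ

  Answer : Set
  Answer = Σ[ σ ∈ Packing I ] (∀ i → o (toℕ i) ≡ toℕ (Packing.assign σ i)) ×
            (∀ (τ : Packing I) → ℕ→ℚ (Packing.b σ) ℚ.+ Packing.E σ ℚ.≤ (ℤ.+ 3 ℚ./ 2) ℚ.* (ℕ→ℚ (Packing.b τ) ℚ.+ Packing.E τ))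

  module _ {c : ℕ} (F : Found n a D g f c o)
           (lower : ∀ k → 0 < k → k ≤ 2 * n → LowerBound n a D g f c k) where
    module O = Output F
    open O using (packing; encodes)
    open ≤-Reasoning
    -- The search charges for all k bins, some of which LPT may leave empty.
    output≤c : Packing.b packing * K + num β * excess O.assign g ≤ c
    output≤c = begin
      Packing.b packing * K + num β * excess O.assign g  ≤⟨ +-monoˡ-≤ _ (*-monoˡ-≤ K O.b≤k) ⟩
      O.k * K + num β * excess O.assign g                ≡⟨ f-value O.k (excess O.assign g) ⟨
      f O.k (excess O.assign g)                          ≡⟨ cong (f O.k) (O.excess≡ g) ⟩
      f O.k (Σ< O.k (over (binLoad n a o) g))            ≡⟨ O.cost ⟩
      c                                                  ∎
    -- Only the number of bins needs the factor 3/2: the cost at `three-halves b` bins is bounded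
    -- with the overflow of `τ` itself.
    2c≤ : (τ : Packing I) → 2 * c ≤ 3 * (Packing.b τ * K + num β * excess (Packing.assign τ) g)
    2c≤ τ = begin
      2 * c                              ≤⟨ *-monoʳ-≤ 2 (bounded f lower τ) ⟩
      2 * f (three-halves b) V           ≡⟨ cong (2 *_) (f-value (three-halves b) V) ⟩
      2 * (three-halves b * K + V′)      ≡⟨ e₁ (three-halves b) K V′ ⟩
      (2 * three-halves b) * K + 2 * V′  ≤⟨ +-mono-≤ (*-monoˡ-≤ K (2k≤3m b)) (*-monoˡ-≤ V′ {2} {3} (s≤s (s≤s z≤n))) ⟩
      (3 * b) * K + 3 * V′               ≡⟨ e₂ b K V′ ⟩
      3 * (b * K + V′)                   ∎
      where
      b V V′ : ℕ
      b  = Packing.b τ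
      V  = excess (Packing.assign τ) g
      V′ = num β * V
      e₁ : ∀ k K V → 2 * (k * K + V) ≡ (2 * k) * K + 2 * V
      e₁ = solve-∀
      e₂ : ∀ b K V → (3 * b) * K + 3 * V ≡ 3 * (b * K + V)
      e₂ = solve-∀

    answer : Answer
    answer = packing , encodes , λ τ →
      three-halves-≤ (ℕ→ℚ (Packing.b packing) ℚ.+ Packing.E packing) (ℕ→ℚ (Packing.b τ) ℚ.+ Packing.E τ)
        (value-scaled packing) (value-scaled τ) K≥1 (≤-trans (*-monoʳ-≤ 2 output≤c) (2c≤ τ))

  correct : Answer
  correct = let _ , _ , F , lower = result start in answer F lower

module _ (I : ConstrainedItems) where
  open ConstrainedItems I hiding (f)

  0≤U : 0ℚ ℚ.≤ U
  0≤U = ℚₚ.≤-trans (∑≥0 λ i → ℚₚ.p≤p⊔q 0ℚ (β ℚ.* (s i ℚ.- G))) U≥∑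

  model₂ : CostModel (memory items U) n ce₂ te₂
  model₂ = record
    { f     = λ D k V → k + (V * (num β * den U) ∸ D * (den β * num U)) * (2 * n + 1)
    ; start = λ D → 2 * n + 1
    ; mono  = λ D k V≤V′ → +-monoʳ-≤ k (*-monoˡ-≤ (2 * n + 1)
                (∸-monoˡ-≤ (D * (den β * num U)) (*-monoˡ-≤ (num β * den U) V≤V′)))
    ; value = λ s D k kept D≡ k≡ _ → cong₂ _+_ k≡ (cong₂ _*_
                (cong₂ _∸_ (cong (s 16 0 *_) (cong₂ _*_ (kept 1) (kept 6)))
                           (cong₂ _*_ D≡ (cong₂ _*_ (kept 2) (kept 5))))
                (cong (λ n → 2 * n + 1) (kept 0)))
    ; start-value = λ s D kept _ _ → cong (λ n → 2 * n + 1) (kept 0)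
    }

module CGBP-run (I : ConstrainedItems) (1≤n : 1 ≤ ConstrainedItems.n I) {o : ℕ → ℕ}
  (S : Solved (memory (ConstrainedItems.items I) (ConstrainedItems.U I)) (ConstrainedItems.n I)
              (CostModel.f (model₂ I)) (CostModel.start (model₂ I)) o) where
  open ConstrainedItems I hiding (f)
  open Solved S
  open Run items U 1≤n scaled

  f : ℕ → ℕ → ℕ
  f = CostModel.f (model₂ I) D

  over-U : ℕ → ℕ
  over-U V = (num β * V) * den U ∸ num U * K

  f-value : ∀ k V → f k V ≡ k + over-U V * (2 * n + 1)
  f-value k V = cong (λ x → k + x * (2 * n + 1)) (cong₂ _∸_ (e₁ V (num β) (den U)) (e₂ D (den β) (num U)))
    where
    e₁ : ∀ V b u → V * (b * u) ≡ (b * V) * u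
    e₁ = solve-∀
    e₂ : ∀ D b u → D * (b * u) ≡ u * (D * b)
    e₂ = solve-∀

  within : ∀ {E V} → E ℚ.* ι K ≡ ι (num β * V) → E ℚ.≤ U → over-U V ≡ 0
  within E≡ E≤U = m≤n⇒m∸n≡0 (cross-≤⁻¹ E≡ (num/den (0≤U I)) K≥1 (s≤s z≤n) E≤U)

  within⁻¹ : ∀ {E V} → E ℚ.* ι K ≡ ι (num β * V) → over-U V ≡ 0 → E ℚ.≤ U
  within⁻¹ E≡ h = cross-≤ E≡ (num/den (0≤U I)) K≥1 (s≤s z≤n) (m∸n≡0⇒m≤n h)

  f-within : ∀ k {V} → over-U V ≡ 0 → f k V ≡ k
  f-within k {V} h = trans (f-value k V) (trans (cong (λ x → k + x * (2 * n + 1)) h) (+-identityʳ k))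

  -- The hypothesis `U≥∑` says precisely that one item per bin respects U, so this rival incurs no
  -- penalty and costs at most 2n.
  start : f (three-halves n) (Σ< n (over a g)) < 2 * n + 1
  start = begin-strict
    f (three-halves n) (Σ< n (over a g)) ≡⟨ f-within (three-halves n) (within alone-scaled U≥∑) ⟩
    three-halves n                       ≤⟨ three-halves≤ {n} ≤-refl ⟩
    2 * n                                <⟨ n<1+n (2 * n) ⟩
    suc (2 * n)                          ≡⟨ +-comm 1 (2 * n) ⟩
    2 * n + 1                            ∎
    where open ≤-Reasoning

  Answer : Set
  Answer = Σ[ σ ∈ ConstrainedPacking I ] (∀ i → o (toℕ i) ≡ toℕ (ConstrainedPacking.assign σ i)) ×
            (∀ (τ : ConstrainedPacking I) →
             ℕ→ℚ (ConstrainedPacking.b σ) ℚ.≤ (ℤ.+ 3 ℚ./ 2) ℚ.* ℕ→ℚ (ConstrainedPacking.b τ))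

  module _ {c : ℕ} (c<T : c < 2 * n + 1) (F : Found n a D g f c o)
           (lower : ∀ k → 0 < k → k ≤ 2 * n → LowerBound n a D g f c k) where
    module O = Output F
    V : ℕ
    V = excess O.assign g
    cost≡ : O.k + over-U V * (2 * n + 1) ≡ c
    cost≡ = trans (sym (f-value O.k V)) (trans (cong (f O.k) (O.excess≡ g)) O.cost)
    k≤c : O.k ≤ c
    k≤c = ≤-trans (m≤m+n O.k _) (≤-reflexive cost≡)
    feasible : over-U V ≡ 0
    feasible = small (over-U V) (≤-<-trans (≤-trans (m≤n+m _ O.k) (≤-reflexive cost≡)) c<T)
      where
      small : ∀ x → x * (2 * n + 1) < 2 * n + 1 → x ≡ 0
      small zero    _ = refl
      small (suc x) h = ⊥-elim (<⇒≱ h (m≤m+n (2 * n + 1) _))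
    unit : ∀ b → ℕ→ℚ b ℚ.* ι 1 ≡ ι b
    unit b = trans (cong (ℚ._* ι 1) (sym (ι≡ℕ→ℚ b))) (trans (sym (ι-* b 1)) (cong ι (*-identityʳ b)))
    2c≤ : (τ : ConstrainedPacking I) → 2 * c ≤ 3 * ConstrainedPacking.b τ
    2c≤ τ = begin
      2 * c                                         ≤⟨ *-monoʳ-≤ 2 (bounded f lower packing) ⟩
      2 * f (three-halves b) (excess assign g)      ≡⟨ cong (2 *_) (f-within (three-halves b) (within (E-scaled assign) E≤U)) ⟩
      2 * three-halves b                            ≤⟨ 2k≤3m b ⟩
      3 * b                                         ∎
      where
      open ≤-Reasoning
      open ConstrainedPacking τ

    answer : Answer
    answer = record { packing = O.packing ; E≤U = within⁻¹ (E-scaled O.assign) feasible } , O.encodes , λ τ →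
      three-halves-≤ (ℕ→ℚ (Packing.b O.packing)) (ℕ→ℚ (ConstrainedPacking.b τ)) (unit (Packing.b O.packing)) (unit (ConstrainedPacking.b τ)) ≤-refl
        (≤-trans (*-monoʳ-≤ 2 (≤-trans O.b≤k k≤c)) (2c≤ τ))

  correct : Answer
  correct = let _ , c<T , F , lower = result start in answer c<T F lower

-- Assembling algorithm, running time and ratio.

1<2^ : ∀ {Z} → 1 ≤ Z → 1 < 2 ^ Z
1<2^ 1≤Z = ≤-trans ≤-refl (2^-mono 1≤Z)

module _ (P : MinProblem) where
  open MinProblem P

  approximates : ∀ r p → T (admissible p) → (∀ I → 1 ≤ size I) →
                 (∀ I → Input (size I) (input I)) → (∀ I → Small (size I) (input I)) →
                 (∀ I → ∃[ σ ] Encodes I (exec p (input I)) σ × (∀ τ → value I σ ℚ.≤ r ℚ.* value I τ)) →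
                 PolyTimeApprox P r
  approximates r p ok size≥1 input-fits small solution with runs-in-poly-time p ok
  ... | c , d , runs = compile p , c , d , λ I →
    let t , run , t≤ = runs (size I) (input I) (size≥1 I) (input-fits I) (small I)
        σ , encodes , best = solution I
    in t , exec p (input I) , σ , run , t≤ , encodes ,
       λ opt (( τ , τ-opt ) , _) → subst (λ x → value I σ ℚ.≤ r ℚ.* x) τ-opt (best τ)

approx-GBP : PolyTimeApprox GBP (ℤ.+ 3 ℚ./ 2)
approx-GBP = approximates GBP (ℤ.+ 3 ℚ./ 2) (program ce₁ te₁) tt 1≤itemsSize
  (λ I → memory-input I ≤-refl (m^n>0 2 (itemsSize I)) (1<2^ (1≤itemsSize I)))
  (λ I → memory-small I ≤-refl (m^n>0 2 (itemsSize I)) (1<2^ (1≤itemsSize I)))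
  (λ I → solution I (Items.n I ≟ 0))
  where
  solution : ∀ I → Dec (Items.n I ≡ 0) →
             ∃[ σ ] EncodesPacking (exec (program ce₁ te₁) (memory I 0ℚ)) σ × (∀ τ →
             ℕ→ℚ (Packing.b σ) ℚ.+ Packing.E σ ℚ.≤ (ℤ.+ 3 ℚ./ 2) ℚ.* (ℕ→ℚ (Packing.b τ) ℚ.+ Packing.E τ))
  solution I (no n≢0)  = GBP-run.correct I (n≢0⇒n>0 n≢0) (solve I 0ℚ (n≢0⇒n>0 n≢0) ce₁ te₁ (model₁ I))
  -- Without items any store encodes the packing with no bins, whose value is 0.
  solution I (yes n≡0) = noItems I n≡0 , (λ i → ⊥-elim (n≮0 (subst (toℕ i <_) n≡0 (toℕ<n i)))) ,
    λ τ → 0≤3/2* (ℚₚ.+-mono-≤ (b≥0 τ) (E≥0 τ))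

approx-CGBP : PolyTimeApprox CGBP (ℤ.+ 3 ℚ./ 2)
approx-CGBP = approximates CGBP (ℤ.+ 3 ℚ./ 2) (program ce₂ te₂) tt
  (λ I → ≤-trans (1≤itemsSize (items I)) (m≤m+n _ (bitsℚ (U I))))
  (λ I → memory-input (items I) (m≤m+n _ (bitsℚ (U I))) (numU I) (denU I))
  (λ I → memory-small (items I) (m≤m+n _ (bitsℚ (U I))) (numU I) (denU I))
  (λ I → solution I (Items.n (items I) ≟ 0))
  where
  open ConstrainedItems using (items; U)
  numU : ∀ I → num (U I) < 2 ^ (itemsSize (items I) + bitsℚ (U I))
  numU I = <-≤-trans (k<2^bits (num (U I)))
    (2^-mono (≤-trans (m≤m+n _ (bits (den (U I)))) (m≤n+m _ (itemsSize (items I)))))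
  denU : ∀ I → den (U I) < 2 ^ (itemsSize (items I) + bitsℚ (U I))
  denU I = <-≤-trans (k<2^bits (den (U I)))
    (2^-mono (≤-trans (m≤n+m _ (bits (num (U I)))) (m≤n+m _ (itemsSize (items I)))))
  solution : ∀ I → Dec (Items.n (items I) ≡ 0) →
             ∃[ σ ] EncodesPacking (exec (program ce₂ te₂) (memory (items I) (U I))) (ConstrainedPacking.packing σ) ×
             (∀ (τ : ConstrainedPacking I) →
              ℕ→ℚ (ConstrainedPacking.b σ) ℚ.≤ (ℤ.+ 3 ℚ./ 2) ℚ.* ℕ→ℚ (ConstrainedPacking.b τ))
  solution I (no n≢0)  = CGBP-run.correct I (n≢0⇒n>0 n≢0)
    (solve (items I) (U I) (n≢0⇒n>0 n≢0) ce₂ te₂ (model₂ I))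
  solution I (yes n≡0) = record { packing = noItems (items I) n≡0 ; E≤U = 0≤U I } ,
    (λ i → ⊥-elim (n≮0 (subst (toℕ i <_) n≡0 (toℕ<n i)))) ,
    λ τ → 0≤3/2* (b≥0 (ConstrainedPacking.packing τ))

open import Data.Integer.Base using (+_)
open import Data.Rational.Base using (_/_)

mainTheorem2 : PolyTimeApprox GBP (+ 3 / 2) × PolyTimeApprox CGBP (+ 3 / 2)
mainTheorem2 = approx-GBP , approx-CGBP
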